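{- Assume $\mathsf{ISP}(\omega_2)$. If $\kappa>2^{\aleph_0}$ is a cardinal carrying a uniform indecomposable ultrafilter, then either $\kappa$ is a measurable cardinal or $\kappa$ is the supremum of countably many measurable cardinals.
   Context: For a regular $\theta$, a structure $M\prec H(\theta)$ is $\aleph_1$-guessing if for every $z\in M$ and every $b\subseteq z$ such that $b\cap a\in M$ for every countable $a\in M$, there is $b'\in M$ with $b'\cap M=b\cap M$. $\mathsf{ISP}(\omega_2)$ asserts that for all sufficiently large regular $\theta$, the set of $M\in\mathcal P_{\aleph_2}(H(\theta))$ with $M\prec H(\theta)$ and $M$ $\aleph_1$-guessing is stationary in $\mathcal P_{\aleph_2}(H(\theta))$. An ultrafilter $U$ over $\kappa$ is uniform if all its members have size $\kappa$; it is $\mu$-indecomposable if for every $f:\kappa\to\mu$ there is $H\subseteq\mu$, $|H|<\mu$, with $f^{ -1}[H]\in U$; it is indecomposable if it is $\mu$-indecomposable for every cardinal $\mu\in[\aleph_1,\kappa)$. -}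

module Defs where

open import Level using (Level; Lift; suc)
open import Data.Bool.Base using (Bool; true; false)
open import Data.Empty.Polymorphic using (⊥)
open import Data.Fin.Base using (Fin)
open import Data.Maybe.Base using (Maybe; maybe′)
open import Data.Nat.Base using (ℕ) renaming (zero to 0ℕ; suc to 1+_)
open import Data.Product using (Σ; ∃; ∃₂; ∃!; _×_; _,_; proj₁)
open import Data.Sum.Base using (_⊎_)
open import Data.Vec.Functional using (Vector; _∷_)
open import Function.Base using (_∘_)
open import Function.Bundles using (_⇔_)
open import Relation.Nullary.Negation using (¬_)

private variable
  ℓ : Level
  n : ℕ

------------------------------------------------------------------------
-- The universe of sets

-- Aczel's cumulative hierarchy, with extensional equality _≈_ in place of a
-- quotient. Under excluded middle at level suc ℓ, (V ℓ , ≈ , ∈) satisfies ZF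
-- (separation and replacement hold for arbitrary Agda predicates);
-- choice is the separate predicate Choice below. In this file "set" means
-- an element of V ℓ, and all the notions of set theory are those of V ℓ.
-- Sets that cannot be constructed without excluded middle (function spaces,
-- ℵ₁, H(θ), ...) are introduced by their defining property, which
-- determines them up to ≈.

data V (ℓ : Level) : Set (suc ℓ) where
  sup : (I : Set ℓ) → (I → V ℓ) → V ℓ

Index : V ℓ → Set ℓ
Index (sup I _) = I

elem : (x : V ℓ) → Index x → V ℓ
elem (sup _ f) = f

infix 4 _≈_ _∈_ _⊆_ _≃_ _≼_ _≺_

_≈_ : V ℓ → V ℓ → Set ℓ
sup I f ≈ sup J g = (∀ i → ∃ λ j → f i ≈ g j) × (∀ j → ∃ λ i → f i ≈ g j)

_∈_ : V ℓ → V ℓ → Set ℓ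
x ∈ sup J g = ∃ λ j → x ≈ g j

_⊆_ : V ℓ → V ℓ → Set (suc ℓ)
x ⊆ y = ∀ z → z ∈ x → z ∈ y

------------------------------------------------------------------------
-- Basic constructions

∅ : V ℓ
∅ = sup ⊥ λ ()

pair : V ℓ → V ℓ → V ℓ
pair {ℓ} x y = sup (Lift ℓ Bool) λ where
  (Level.lift true)  → x
  (Level.lift false) → y

singleton : V ℓ → V ℓ
singleton x = pair x x

⟪_,_⟫ : V ℓ → V ℓ → V ℓ
⟪ x , y ⟫ = pair (singleton x) (pair x y)

-- { z ∈ x ∣ P z }; only used for P respecting ≈.
sep : V ℓ → (V ℓ → Set ℓ) → V ℓ
sep (sup I f) P = sup (Σ I (P ∘ f)) (f ∘ proj₁)

infixl 7 _∩_ _∖_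

_∩_ : V ℓ → V ℓ → V ℓ
x ∩ y = sep x (_∈ y)

_∖_ : V ℓ → V ℓ → V ℓ
x ∖ y = sep x (λ z → ¬ z ∈ y)

-- { z ∈ x ∣ z belongs to every member of F }
⋂[_] : V ℓ → V ℓ → V ℓ
⋂[ x ] F = sep x (λ z → ∀ j → z ∈ elem F j)

-- x ∪ {x}
succ : V ℓ → V ℓ
succ x = sup (Maybe (Index x)) (maybe′ (elem x) x)

nat : ℕ → V ℓ
nat 0ℕ     = ∅
nat (1+ n) = succ (nat n)

ω : V ℓ
ω {ℓ} = sup (Lift ℓ ℕ) (nat ∘ Level.lower)

------------------------------------------------------------------------
-- Functions and comparison of cardinalities

IsFunction : V ℓ → V ℓ → V ℓ → Set (suc ℓ)
IsFunction f A B =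
  (∀ p → p ∈ f → ∃₂ λ x y → x ∈ A × y ∈ B × p ≈ ⟪ x , y ⟫) ×
  (∀ x → x ∈ A → ∃! _≈_ λ y → ⟪ x , y ⟫ ∈ f)

IsInjection : V ℓ → V ℓ → V ℓ → Set (suc ℓ)
IsInjection f A B =
  IsFunction f A B ×
  (∀ x x′ y → ⟪ x , y ⟫ ∈ f → ⟪ x′ , y ⟫ ∈ f → x ≈ x′)

IsBijection : V ℓ → V ℓ → V ℓ → Set (suc ℓ)
IsBijection f A B =
  IsInjection f A B × (∀ y → y ∈ B → ∃ λ x → ⟪ x , y ⟫ ∈ f)

-- f⁻¹[ H ] for a function f with domain A
preimage : (f A H : V ℓ) → V ℓ
preimage f A H = sep A (λ x → ∃ λ j → ⟪ x , elem H j ⟫ ∈ f)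

-- |A| = |B|, |A| ≤ |B| and |A| < |B|
_≃_ _≼_ _≺_ : V ℓ → V ℓ → Set (suc ℓ)
A ≃ B = ∃ λ f → IsBijection f A B
A ≼ B = ∃ λ f → IsInjection f A B
A ≺ B = A ≼ B × ¬ (B ≼ A)

Countable : V ℓ → Set (suc ℓ)
Countable A = A ≼ ω

-- The axiom of choice: every family of nonempty sets has a choice function.
Choice : (ℓ : Level) → Set (suc ℓ)
Choice ℓ = (F : V ℓ) → (∀ x → x ∈ F → ∃ λ y → y ∈ x) →
  ∃₂ λ f B → IsFunction f F B × (∀ x y → ⟪ x , y ⟫ ∈ f → y ∈ x)

------------------------------------------------------------------------
-- Ordinals and cardinals

Transitive : V ℓ → Set (suc ℓ)
Transitive x = ∀ y → y ∈ x → y ⊆ x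

-- von Neumann ordinals; ∈ is well-founded on V ℓ, so a linear order by ∈
-- is automatically a well-order. The order on ordinals: α < β is α ∈ β and
-- α ≤ β is α ⊆ β.
IsOrdinal : V ℓ → Set (suc ℓ)
IsOrdinal α =
  Transitive α ×
  (∀ x y → x ∈ α → y ∈ α → x ∈ y ⊎ x ≈ y ⊎ y ∈ x)

IsCardinal : V ℓ → Set (suc ℓ)
IsCardinal κ = IsOrdinal κ × (∀ α → α ∈ κ → ¬ (α ≃ κ))

-- ν = μ⁺
IsSuccessorCardinal : V ℓ → V ℓ → Set (suc ℓ)
IsSuccessorCardinal μ ν =
  IsCardinal ν × μ ∈ ν × (∀ λ′ → IsCardinal λ′ → μ ∈ λ′ → ν ⊆ λ′)

-- x = ℵₙ = ωₙ
IsAleph : ℕ → V ℓ → Set (suc ℓ)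
IsAleph {ℓ} 0ℕ x = Lift (suc ℓ) (x ≈ ω)
IsAleph (1+ n) x = ∃ λ y → IsAleph n y × IsSuccessorCardinal y x

-- c = μ ^ ν, the cardinality of the set F of all functions ν → μ
IsCardinalPower : (μ ν c : V ℓ) → Set (suc ℓ)
IsCardinalPower μ ν c =
  IsCardinal c × ∃ λ F → (∀ f → f ∈ F ⇔ IsFunction f ν μ) × F ≃ c

IsRegular : V ℓ → Set (suc ℓ)
IsRegular θ =
  IsCardinal θ × ω ⊆ θ ×
  (∀ α f → α ∈ θ → IsFunction f α θ →
    ∃ λ β → β ∈ θ × (∀ ξ η → ⟪ ξ , η ⟫ ∈ f → η ∈ β))

-- κ is the least upper bound of the set of ordinals A
IsSupremum : V ℓ → V ℓ → Set (suc ℓ)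
IsSupremum A κ =
  IsOrdinal κ × (∀ α → α ∈ A → α ⊆ κ) ×
  (∀ β → IsOrdinal β → (∀ α → α ∈ A → α ⊆ β) → κ ⊆ β)

------------------------------------------------------------------------
-- H(θ) and elementary submodels

IsTransitiveClosure : V ℓ → V ℓ → Set (suc ℓ)
IsTransitiveClosure x t =
  x ⊆ t × Transitive t × (∀ s → x ⊆ s → Transitive s → t ⊆ s)

-- H = H(θ) = { x ∣ |trcl(x)| < θ }
IsH : V ℓ → V ℓ → Set (suc ℓ)
IsH θ H = ∀ x → x ∈ H ⇔ (∃ λ t → IsTransitiveClosure x t × t ≺ θ)

-- First-order formulas of the language {∈, =} with n free variables, in de
-- Bruijn style. Since ω is indexed by ℕ, these are also the formulas
-- in the sense of V ℓ.
data Formula (n : ℕ) : Set where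
  _∈′_ _≈′_ : Fin n → Fin n → Formula n
  ¬′_       : Formula n → Formula n
  _∧′_      : Formula n → Formula n → Formula n
  ∀′_       : Formula (1+ n) → Formula n

Satisfies : (A : V ℓ) → Formula n → Vector (V ℓ) n → Set (suc ℓ)
Satisfies {ℓ} A (i ∈′ j) ρ = Lift (suc ℓ) (ρ i ∈ ρ j)
Satisfies {ℓ} A (i ≈′ j) ρ = Lift (suc ℓ) (ρ i ≈ ρ j)
Satisfies A (¬′ φ)   ρ = ¬ Satisfies A φ ρ
Satisfies A (φ ∧′ ψ) ρ = Satisfies A φ ρ × Satisfies A ψ ρ
Satisfies A (∀′ φ)   ρ = ∀ x → x ∈ A → Satisfies A φ (x ∷ ρ)

IsElementarySubmodel : V ℓ → V ℓ → Set (suc ℓ)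
IsElementarySubmodel {ℓ} M N =
  M ⊆ N ×
  (∀ {n} (φ : Formula n) (ρ : Vector (V ℓ) n) → (∀ i → ρ i ∈ M) →
    Satisfies M φ ρ ⇔ Satisfies N φ ρ)

------------------------------------------------------------------------
-- Stationarity in 𝒫_μ(X), and ISP

-- x ∈ 𝒫_μ(X)
InPow : (μ X x : V ℓ) → Set (suc ℓ)
InPow μ X x = x ⊆ X × x ≺ μ

-- C is closed and unbounded in 𝒫_μ(X): cofinal in 𝒫_μ(X) under ⊆, and closed
-- under unions u of nonempty increasing sequences s of length α < μ.
IsClub : (μ X C : V ℓ) → Set (suc ℓ)
IsClub μ X C =
  (∀ x → x ∈ C → InPow μ X x) ×
  (∀ x → InPow μ X x → ∃ λ y → y ∈ C × x ⊆ y) ×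
  (∀ α s u → α ∈ μ → ∅ ∈ α → IsFunction s α C →
    (∀ ξ η x y → ξ ∈ η → ⟪ ξ , x ⟫ ∈ s → ⟪ η , y ⟫ ∈ s → x ⊆ y) →
    (∀ z → z ∈ u ⇔ (∃₂ λ ξ x → ⟪ ξ , x ⟫ ∈ s × z ∈ x)) →
    u ∈ C)

-- { x ∈ 𝒫_μ(X) ∣ S x } is stationary in 𝒫_μ(X).
IsStationary : (μ X : V ℓ) → (V ℓ → Set (suc ℓ)) → Set (suc ℓ)
IsStationary μ X S =
  ∀ C → IsClub μ X C → ∃ λ x → x ∈ C × InPow μ X x × S x

-- M is ℵ₁-guessing.
IsGuessing : V ℓ → Set (suc ℓ)
IsGuessing M =
  ∀ z b → z ∈ M → b ⊆ z →
  (∀ a → a ∈ M → Countable a → b ∩ a ∈ M) →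
  ∃ λ b′ → b′ ∈ M × b′ ∩ M ≈ b ∩ M

ISP : V ℓ → Set (suc ℓ)
ISP {ℓ} μ =
  ∃ λ (θ₀ : V ℓ) → IsOrdinal θ₀ ×
  (∀ θ H → IsRegular θ → θ₀ ∈ θ → IsH θ H →
    IsStationary μ H (λ M → IsElementarySubmodel M H × IsGuessing M))

------------------------------------------------------------------------
-- Ultrafilters and measurable cardinals

IsUltrafilter : (κ U : V ℓ) → Set (suc ℓ)
IsUltrafilter κ U =
  (∀ X → X ∈ U → X ⊆ κ) ×
  κ ∈ U ×
  ¬ (∅ ∈ U) ×
  (∀ X Y → X ∈ U → X ⊆ Y → Y ⊆ κ → Y ∈ U) ×
  (∀ X Y → X ∈ U → Y ∈ U → X ∩ Y ∈ U) ×
  (∀ X → X ⊆ κ → X ∈ U ⊎ κ ∖ X ∈ U)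

IsUniform : (κ U : V ℓ) → Set (suc ℓ)
IsUniform κ U = ∀ X → X ∈ U → X ≃ κ

IsIndecomposableAt : (μ κ U : V ℓ) → Set (suc ℓ)
IsIndecomposableAt μ κ U =
  ∀ f → IsFunction f κ μ →
  ∃ λ H → H ⊆ μ × H ≺ μ × preimage f κ H ∈ U

IsIndecomposable : (κ U : V ℓ) → Set (suc ℓ)
IsIndecomposable κ U =
  ∀ ℵ₁ μ → IsAleph 1 ℵ₁ → IsCardinal μ → ℵ₁ ⊆ μ → μ ∈ κ →
  IsIndecomposableAt μ κ U

IsComplete : (κ U : V ℓ) → Set (suc ℓ)
IsComplete κ U = ∀ F → F ⊆ U → F ≺ κ → ⋂[ κ ] F ∈ U

IsNonprincipal : (κ U : V ℓ) → Set (suc ℓ)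
IsNonprincipal κ U = ∀ ξ → ξ ∈ κ → ¬ (singleton ξ ∈ U)

IsMeasurable : V ℓ → Set (suc ℓ)
IsMeasurable κ =
  IsCardinal κ × ω ∈ κ ×
  ∃ λ U → IsUltrafilter κ U × IsNonprincipal κ U × IsComplete κ U

{-# OPTIONS --safe #-}
module Submission where

open import Level using (Level; Lift; lift; lower; suc)
open import Axiom.ExcludedMiddle using (ExcludedMiddle)
open import Data.Bool.Base using (Bool; true; false)
open import Data.Empty using (⊥; ⊥-elim)
open import Data.Fin.Base using (Fin) renaming (zero to fzero; suc to fsuc)
open import Data.List.Base using (List; []) renaming (_∷_ to _∷ₗ_)
open import Data.Maybe.Base using (Maybe; just; nothing; maybe′)
open import Data.Nat.Base using (ℕ; zero; _+_; _<_; z≤n; s≤s) renaming (suc to 1+_)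
open import Data.Nat.Induction using (<-wellFounded)
import Data.Nat.Properties as ℕ
open import Data.Product using (Σ; ∃; ∃₂; _×_; _,_; proj₁; proj₂)
open import Data.Sum using (_⊎_; inj₁; inj₂; [_,_]′)
open import Data.Vec.Functional using (Vector; _∷_) renaming ([] to []ᵥ)
open import Function.Base using (_∘_; id; case_of_)
open import Function.Bundles using (mk⇔; Equivalence)
open import Induction.WellFounded using (Acc; acc; module All)
open import Relation.Binary.Definitions using (tri<; tri≈; tri>)
open import Relation.Binary.PropositionalEquality using (_≡_; refl; sym; trans; cong; subst)
open import Relation.Nullary using (Dec; yes; no; ¬_; True; toWitness; fromWitness)
open import Relation.Nullary.Decidable using (isYes)
open import Defs

-- Let M be an ℵ₁-guessing model of size ℵ₁. Since U is indecomposable, every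
-- map from κ to a set smaller than κ has countable image on a set of U. For
-- countable a ∈ M this applies to x ↦ { A ∈ a ∣ x ∈ A }, which takes at most
-- 2^ℵ₀ values. As M is internally unbounded, ω₁ many such a suffice to see that
-- for U-almost all x the family { A ⊆ κ ∣ x ∈ A } is approximated by M, hence
-- guessed by some W(x) ∈ M, which by elementarity is a countably complete
-- ultrafilter on κ. Applied to x ↦ W(x) ∈ M, indecomposability yields countably
-- many countably complete ultrafilters Wₙ, without loss of generality
-- nonprincipal, such that each set of U belongs to some Wₙ. The completeness δₙ
-- of Wₙ is measurable and at most κ. If all δₙ were bounded by some β < κ, maps
-- κ → δₙ with Wₙ-null fibres could be glued to a single map κ → β. This map would
-- have countable image on a set of U, hence on a set of some Wₙ, contradicting
-- the countable completeness of Wₙ.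

-- Elementarity is used mainly through Skolem functions. Before M is chosen, choice functions for
-- the witnesses needed later (enumerations, typical traces, counterexamples) are fixed as sets and
-- put into M as parameters. M then only has to be closed under intersection, adjoining one element
-- and applying a function, so few formulas are ever evaluated. The hypothesis 2^ℵ₀ < κ is what
-- allows indecomposability to act on traces; it also yields ω₁ < κ, needed for maps into M and into
-- ω₁. Countable completeness is phrased as agreement with a point on each countable family, because
-- this is what a guess delivers: W(x) agrees with x on all sets in M. The completeness of an
-- ultrafilter is the least ordinal receiving a map with null fibres. The same maps push the
-- ultrafilter forward to a measure and are glued at the end.

module SetTheory {ℓ : Level} (em : ExcludedMiddle (suc ℓ)) (ac : Choice ℓ) where

  -- Classical logic, extensional equality and foundation

  𝕍 : Set (suc ℓ)
  𝕍 = V ℓ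

  by-contradiction : {P : Set (suc ℓ)} → ¬ ¬ P → P
  by-contradiction {P} h with em {P}
  ... | yes p = p
  ... | no ¬p = ⊥-elim (h ¬p)

  ¬∀⇒∃¬ : {A : Set (suc ℓ)} {P : A → Set (suc ℓ)} → ¬ (∀ x → P x) → ∃ λ x → ¬ P x
  ¬∀⇒∃¬ h = by-contradiction λ ¬∃ → h λ x → by-contradiction λ ¬p → ¬∃ (x , ¬p)

  -- _≈_ and _∈_ compute by recursion, which defeats the inference of implicit
  -- arguments; these wrappers do not, and they live in the universe of em.
  infix 4 _≋_ _∊_ _⊑_

  record _≋_ (x y : 𝕍) : Set (suc ℓ) where
    constructor ≈⇒≋
    field ≋⇒≈ : x ≈ y

  record _∊_ (x y : 𝕍) : Set (suc ℓ) where
    constructor ∈⇒∊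
    field ∊⇒∈ : x ∈ y

  open _≋_ public
  open _∊_ public

  _⊑_ : 𝕍 → 𝕍 → Set (suc ℓ)
  x ⊑ y = ∀ z → z ∊ x → z ∊ y

  ≈-refl : (x : 𝕍) → x ≈ x
  ≈-refl (sup I f) = (λ i → i , ≈-refl (f i)) , (λ i → i , ≈-refl (f i))

  ≈-sym : (x y : 𝕍) → x ≈ y → y ≈ x
  ≈-sym (sup I f) (sup J g) (p , q) =
    (λ j → proj₁ (q j) , ≈-sym (f _) (g j) (proj₂ (q j))) ,
    (λ i → proj₁ (p i) , ≈-sym (f i) (g _) (proj₂ (p i)))

  ≈-trans : (x y z : 𝕍) → x ≈ y → y ≈ z → x ≈ z
  ≈-trans (sup I f) (sup J g) (sup K h) (p , q) (p′ , q′) =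
    (λ i → let j , e = p i; k , e′ = p′ j in k , ≈-trans (f i) (g j) (h k) e e′) ,
    (λ k → let j , e′ = q′ k; i , e = q j in i , ≈-trans (f i) (g j) (h k) e e′)

  ∈-respˡ : (x y z : 𝕍) → x ≈ y → x ∈ z → y ∈ z
  ∈-respˡ x y (sup I f) e (i , e′) = i , ≈-trans y x (f i) (≈-sym x y e) e′

  ∈-respʳ : (x y z : 𝕍) → x ≈ y → z ∈ x → z ∈ y
  ∈-respʳ (sup I f) (sup J g) z (p , q) (i , e) = let j , e′ = p i in j , ≈-trans z (f i) (g j) e e′

  ≋-refl : ∀ {x} → x ≋ x
  ≋-refl = ≈⇒≋ (≈-refl _)

  ≋-sym : ∀ {x y} → x ≋ y → y ≋ x
  ≋-sym (≈⇒≋ e) = ≈⇒≋ (≈-sym _ _ e)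

  infixr 5 _∙_

  _∙_ : ∀ {x y z} → x ≋ y → y ≋ z → x ≋ z
  ≈⇒≋ e ∙ ≈⇒≋ e′ = ≈⇒≋ (≈-trans _ _ _ e e′)

  ∊-≋ˡ : ∀ {x y z} → x ≋ y → x ∊ z → y ∊ z
  ∊-≋ˡ (≈⇒≋ e) (∈⇒∊ p) = ∈⇒∊ (∈-respˡ _ _ _ e p)

  ∊-≋ʳ : ∀ {x y z} → x ≋ y → z ∊ x → z ∊ y
  ∊-≋ʳ (≈⇒≋ e) (∈⇒∊ p) = ∈⇒∊ (∈-respʳ _ _ _ e p)

  sup-∊⁺ : ∀ {I : Set ℓ} {f : I → 𝕍} i {z} → z ≋ f i → z ∊ sup I f
  sup-∊⁺ i (≈⇒≋ e) = ∈⇒∊ (i , e)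

  sup-∊⁻ : ∀ {I : Set ℓ} {f : I → 𝕍} {z} → z ∊ sup I f → ∃ λ i → z ≋ f i
  sup-∊⁻ (∈⇒∊ (i , e)) = i , ≈⇒≋ e

  elem-∊ : (x : 𝕍) (i : Index x) → elem x i ∊ x
  elem-∊ (sup I f) i = sup-∊⁺ i ≋-refl

  ∊⇒elem : ∀ {x z} → z ∊ x → ∃ λ i → z ≋ elem x i
  ∊⇒elem {sup I f} p = sup-∊⁻ p

  ≋-ext : ∀ {x y} → x ⊑ y → y ⊑ x → x ≋ y
  ≋-ext {sup I f} {sup J g} p q = ≈⇒≋
    ((λ i → ∊⇒∈ (p (f i) (sup-∊⁺ i ≋-refl))) ,
     (λ j → let i , e = sup-∊⁻ (q (g j) (sup-∊⁺ j ≋-refl)) in i , ≋⇒≈ (≋-sym e)))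

  ≋⇒⊑ : ∀ {x y} → x ≋ y → x ⊑ y
  ≋⇒⊑ e z = ∊-≋ʳ e

  ≋⇒⊒ : ∀ {x y} → x ≋ y → y ⊑ x
  ≋⇒⊒ e = ≋⇒⊑ (≋-sym e)

  ⊑⇒⊆ : ∀ {x y} → x ⊑ y → x ⊆ y
  ⊑⇒⊆ h z p = ∊⇒∈ (h z (∈⇒∊ p))

  ⊆⇒⊑ : ∀ {x y} → x ⊆ y → x ⊑ y
  ⊆⇒⊑ h z p = ∈⇒∊ (h z (∊⇒∈ p))

  ∊-accessible : (x y : 𝕍) → y ≋ x → Acc _∊_ y
  ∊-accessible (sup I f) y e = acc λ {z} z∊y →
    let i , e′ = sup-∊⁻ (∊-≋ʳ e z∊y) in ∊-accessible (f i) z e′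

  ∊-induction : ∀ {p} (P : 𝕍 → Set p) → (∀ x → (∀ y → y ∊ x → P y) → P x) → ∀ x → P x
  ∊-induction P step = All.wfRec (λ x → ∊-accessible x x ≋-refl) _ P (λ x rec → step x (λ y → rec {y}))

  -- A cycle through `x` can be read as starting at its member `z`, so the induction hypothesis at
  -- `z` refutes it.
  ∊-acyclic₃ : (x y z : 𝕍) → x ∊ y → y ∊ z → z ∊ x → ⊥
  ∊-acyclic₃ = ∊-induction _ λ x rec y z p q r → rec z r x y r p q

  ∊-asym : (x y : 𝕍) → x ∊ y → y ∊ x → ⊥
  ∊-asym = ∊-induction _ λ x rec y p q → rec y q x q p

  ∊-irrefl : (x : 𝕍) → x ∊ x → ⊥
  ∊-irrefl x p = ∊-asym x x p p

  -- Set constructions for arbitrary classes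

  Class : Set (suc (suc ℓ))
  Class = 𝕍 → Set (suc ℓ)

  Resp : Class → Set (suc ℓ)
  Resp P = ∀ {x y} → x ≋ y → P x → P y

  Congruent : (𝕍 → 𝕍) → Set (suc ℓ)
  Congruent F = ∀ {x y} → x ≋ y → F x ≋ F y

  ¬-resp : {P : Class} → Resp P → Resp (λ x → ¬ P x)
  ¬-resp resp e ¬p p = ¬p (resp (≋-sym e) p)

  -- Excluded middle replaces each proposition by a decided one at level ℓ, so that separation is
  -- available for predicates that quantify over the whole universe.
  small : Set (suc ℓ) → Set ℓ
  small P = Lift ℓ (True (em {P}))

  to-small : {P : Set (suc ℓ)} → P → small P
  to-small {P} p = lift (fromWitness {a? = em {P}} p)

  from-small : {P : Set (suc ℓ)} → small P → P
  from-small {P} (lift p) = toWitness {a? = em {P}} p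

  sep-∊⁺ : ∀ x (P : 𝕍 → Set ℓ) → (∀ {y z} → y ≋ z → P y → P z) → ∀ {z} → z ∊ x → P z → z ∊ sep x P
  sep-∊⁺ (sup I f) P resp z∊x p = let i , e = sup-∊⁻ z∊x in sup-∊⁺ (i , resp e p) e

  sep-∊⁻ : ∀ x (P : 𝕍 → Set ℓ) → (∀ {y z} → y ≋ z → P y → P z) → ∀ {z} → z ∊ sep x P → z ∊ x × P z
  sep-∊⁻ (sup I f) P resp z∊ = let (i , p) , e = sup-∊⁻ z∊ in sup-∊⁺ i e , resp (≋-sym e) p

  isYes-true : {P : Set (suc ℓ)} (d : Dec P) → P → isYes d ≡ true
  isYes-true (yes _) _ = refl
  isYes-true (no ¬p) p = ⊥-elim (¬p p)

  true-isYes : {P : Set (suc ℓ)} (d : Dec P) → isYes d ≡ true → P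
  true-isYes (yes p) _ = p

  subset : (x : 𝕍) → (Index x → Bool) → 𝕍
  subset x χ = sup (Σ (Index x) λ i → χ i ≡ true) (elem x ∘ proj₁)

  abstract
    Sep : 𝕍 → Class → 𝕍
    Sep x P = sep x (λ z → small (P z))

    ∊-Sep⁺ : ∀ {x} (P : Class) → Resp P → ∀ {z} → z ∊ x → P z → z ∊ Sep x P
    ∊-Sep⁺ {x} P resp z∊x p = sep-∊⁺ x _ (λ e q → to-small (resp e (from-small q))) z∊x (to-small p)

    ∊-Sep⁻ : ∀ {x} (P : Class) → Resp P → ∀ {z} → z ∊ Sep x P → z ∊ x × P z
    ∊-Sep⁻ {x} P resp z∊ =
      let z∊x , p = sep-∊⁻ x _ (λ e q → to-small (resp e (from-small q))) z∊ in z∊x , from-small p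

    -- Boolean characteristic functions keep the index type at level ℓ; excluded middle makes them
    -- reach every subset.
    𝒫 : 𝕍 → 𝕍
    𝒫 x = sup (Index x → Bool) (subset x)

    ∊-𝒫⁺ : ∀ {x y} → y ⊑ x → y ∊ 𝒫 x
    ∊-𝒫⁺ {x} {y} y⊑x = sup-∊⁺ χ (≋-ext left right)
      where
      χ : Index x → Bool
      χ i = isYes (em {elem x i ∊ y})
      left : y ⊑ subset x χ
      left z z∊y = let i , e = ∊⇒elem (y⊑x z z∊y) in sup-∊⁺ (i , isYes-true em (∊-≋ˡ e z∊y)) e
      right : subset x χ ⊑ y
      right z z∊ = let (i , p) , e = sup-∊⁻ z∊ in ∊-≋ˡ (≋-sym e) (true-isYes em p)

    ∊-𝒫⁻ : ∀ {x y} → y ∊ 𝒫 x → y ⊑ x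
    ∊-𝒫⁻ {x} y∊ z z∊y =
      let χ , e = sup-∊⁻ y∊
          (i , _) , e′ = sup-∊⁻ (∊-≋ʳ e z∊y)
      in ∊-≋ˡ (≋-sym e′) (elem-∊ x i)

    ⋃ : 𝕍 → 𝕍
    ⋃ x = sup (Σ (Index x) λ i → Index (elem x i)) λ (i , j) → elem (elem x i) j

    ∊-⋃⁺ : ∀ {x y z} → z ∊ y → y ∊ x → z ∊ ⋃ x
    ∊-⋃⁺ z∊y y∊x = let i , e = ∊⇒elem y∊x; j , e′ = ∊⇒elem (∊-≋ʳ e z∊y) in sup-∊⁺ (i , j) e′

    ∊-⋃⁻ : ∀ {x z} → z ∊ ⋃ x → ∃ λ y → z ∊ y × y ∊ x
    ∊-⋃⁻ {x} z∊ = let (i , j) , e = sup-∊⁻ z∊ in elem x i , ∊-≋ˡ (≋-sym e) (elem-∊ (elem x i) j) , elem-∊ x i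

    Image : (𝕍 → 𝕍) → 𝕍 → 𝕍
    Image F x = sup (Index x) (F ∘ elem x)

    ∊-Image⁺ : ∀ {F} → Congruent F → ∀ {x y z} → y ∊ x → z ≋ F y → z ∊ Image F x
    ∊-Image⁺ F-cong y∊x e = let i , e′ = ∊⇒elem y∊x in sup-∊⁺ i (e ∙ F-cong e′)

    ∊-Image⁻ : ∀ {F x z} → z ∊ Image F x → ∃ λ y → y ∊ x × z ≋ F y
    ∊-Image⁻ {F} {x} z∊ = let i , e = sup-∊⁻ z∊ in elem x i , elem-∊ x i , e

    Range : (ℕ → 𝕍) → 𝕍
    Range e = sup (Lift ℓ ℕ) (e ∘ lower)

    ∊-Range⁺ : ∀ {e z} n → z ≋ e n → z ∊ Range e
    ∊-Range⁺ n p = sup-∊⁺ (lift n) p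

    ∊-Range⁻ : ∀ {e z} → z ∊ Range e → ∃ λ n → z ≋ e n
    ∊-Range⁻ z∊ = let lift n , p = sup-∊⁻ z∊ in n , p

  -- Pairs and functions

  ∊-pairˡ : ∀ {x y z} → z ≋ x → z ∊ pair x y
  ∊-pairˡ e = sup-∊⁺ (lift true) e

  ∊-pairʳ : ∀ {x y z} → z ≋ y → z ∊ pair x y
  ∊-pairʳ e = sup-∊⁺ (lift false) e

  ∊-pair⁻ : ∀ {x y z} → z ∊ pair x y → z ≋ x ⊎ z ≋ y
  ∊-pair⁻ (∈⇒∊ (lift true , e)) = inj₁ (≈⇒≋ e)
  ∊-pair⁻ (∈⇒∊ (lift false , e)) = inj₂ (≈⇒≋ e)

  ∊-singleton⁻ : ∀ {x z} → z ∊ singleton x → z ≋ x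
  ∊-singleton⁻ p = [ id , id ]′ (∊-pair⁻ p)

  infixr 6 _∪_

  abstract
    _∪_ : 𝕍 → 𝕍 → 𝕍
    x ∪ y = ⋃ (pair x y)

    ∊-∪ˡ : ∀ {x y z} → z ∊ x → z ∊ x ∪ y
    ∊-∪ˡ p = ∊-⋃⁺ p (∊-pairˡ ≋-refl)

    ∊-∪ʳ : ∀ {x y z} → z ∊ y → z ∊ x ∪ y
    ∊-∪ʳ p = ∊-⋃⁺ p (∊-pairʳ ≋-refl)

    ∊-∪⁻ : ∀ {x y z} → z ∊ x ∪ y → z ∊ x ⊎ z ∊ y
    ∊-∪⁻ p with ∊-⋃⁻ p
    ... | w , q , r with ∊-pair⁻ r
    ... | inj₁ e = inj₁ (∊-≋ʳ e q)
    ... | inj₂ e = inj₂ (∊-≋ʳ e q)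

  pair-cong : ∀ {x y x′ y′} → x ≋ x′ → y ≋ y′ → pair x y ≋ pair x′ y′
  pair-cong (≈⇒≋ e) (≈⇒≋ e′) = ≈⇒≋
    ((λ { (lift true) → lift true , e; (lift false) → lift false , e′ }) ,
     (λ { (lift true) → lift true , e; (lift false) → lift false , e′ }))

  abstract
    ⟨_,_⟩ : 𝕍 → 𝕍 → 𝕍
    ⟨ x , y ⟩ = ⟪ x , y ⟫

    ⟨⟩-cong : ∀ {x y x′ y′} → x ≋ x′ → y ≋ y′ → ⟨ x , y ⟩ ≋ ⟨ x′ , y′ ⟩
    ⟨⟩-cong e e′ = pair-cong (pair-cong e e) (pair-cong e e′)

    ⟨⟩-injectiveˡ : ∀ {x y x′ y′} → ⟨ x , y ⟩ ≋ ⟨ x′ , y′ ⟩ → x ≋ x′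
    ⟨⟩-injectiveˡ {x} {y} {x′} {y′} e with ∊-pair⁻ (∊-≋ʳ (≋-sym e) (∊-pairˡ {singleton x′} {pair x′ y′} ≋-refl))
    ... | inj₁ p = ∊-singleton⁻ (∊-≋ʳ (≋-sym p) (∊-pairˡ ≋-refl))
    ... | inj₂ p = ∊-singleton⁻ (∊-≋ʳ (≋-sym p) (∊-pairˡ ≋-refl))

    ⟨⟩-injectiveʳ : ∀ {x y x′ y′} → ⟨ x , y ⟩ ≋ ⟨ x′ , y′ ⟩ → y ≋ y′
    ⟨⟩-injectiveʳ {x} {y} {x′} {y′} e = go (⟨⟩-injectiveˡ e) (second e) (second (≋-sym e))
      where
      second : ∀ {x y x′ y′} → ⟨ x , y ⟩ ≋ ⟨ x′ , y′ ⟩ → y ≋ x′ ⊎ y ≋ y′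
      second {x} {y} {x′} {y′} e with ∊-pair⁻ (∊-≋ʳ e (∊-pairʳ {singleton x} {pair x y} ≋-refl))
      ... | inj₁ p = inj₁ (∊-singleton⁻ (∊-≋ʳ p (∊-pairʳ ≋-refl)))
      ... | inj₂ p = ∊-pair⁻ (∊-≋ʳ p (∊-pairʳ ≋-refl))
      go : x ≋ x′ → y ≋ x′ ⊎ y ≋ y′ → y′ ≋ x ⊎ y′ ≋ y → y ≋ y′
      go _ (inj₂ p) _ = p
      go _ (inj₁ _) (inj₂ q) = ≋-sym q
      go e (inj₁ p) (inj₁ q) = p ∙ ≋-sym e ∙ ≋-sym q

    ∊-⟨⟩⁺ˡ : ∀ {x y} → singleton x ∊ ⟨ x , y ⟩
    ∊-⟨⟩⁺ˡ = ∊-pairˡ ≋-refl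

    ∊-⟨⟩⁺ʳ : ∀ {x y} → pair x y ∊ ⟨ x , y ⟩
    ∊-⟨⟩⁺ʳ = ∊-pairʳ ≋-refl

    ∊-⟨⟩⁻ : ∀ {x y z} → z ∊ ⟨ x , y ⟩ → z ≋ singleton x ⊎ z ≋ pair x y
    ∊-⟨⟩⁻ = ∊-pair⁻

    ⟨⟩≋⟪⟫ : ∀ {x y} → ⟨ x , y ⟩ ≋ ⟪ x , y ⟫
    ⟨⟩≋⟪⟫ = ≋-refl

    ⟨⟩∊⇒⟪⟫∈ : ∀ {x y f} → ⟨ x , y ⟩ ∊ f → ⟪ x , y ⟫ ∈ f
    ⟨⟩∊⇒⟪⟫∈ = ∊⇒∈

    ⟪⟫∈⇒⟨⟩∊ : ∀ {x y f} → ⟪ x , y ⟫ ∈ f → ⟨ x , y ⟩ ∊ f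
    ⟪⟫∈⇒⟨⟩∊ = ∈⇒∊

  abstract
    Graph : (𝕍 → 𝕍) → 𝕍 → 𝕍
    Graph F A = sup (Index A) λ i → ⟨ elem A i , F (elem A i) ⟩

    ∊-Graph⁺ : ∀ {F} → Congruent F → ∀ {A x y} → x ∊ A → y ≋ F x → ⟨ x , y ⟩ ∊ Graph F A
    ∊-Graph⁺ F-cong x∊A e = let i , e′ = ∊⇒elem x∊A in sup-∊⁺ i (⟨⟩-cong e′ (e ∙ F-cong e′))

    ∊-Graph⁻ : ∀ {F A p} → p ∊ Graph F A → ∃ λ x → x ∊ A × p ≋ ⟨ x , F x ⟩
    ∊-Graph⁻ {F} {A} p∊ = let i , e = sup-∊⁻ p∊ in elem A i , elem-∊ A i , e

  ⟨⟩∊Graph⁻ : ∀ {F} → Congruent F → ∀ {A x y} → ⟨ x , y ⟩ ∊ Graph F A → x ∊ A × y ≋ F x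
  ⟨⟩∊Graph⁻ F-cong p =
    let x′ , x′∊A , e = ∊-Graph⁻ p
        e₁ = ≋-sym (⟨⟩-injectiveˡ e)
    in ∊-≋ˡ e₁ x′∊A , ⟨⟩-injectiveʳ e ∙ F-cong e₁

  Graph-cong : ∀ {F G} → Congruent F → Congruent G → ∀ {A} → (∀ x → x ∊ A → F x ≋ G x) → Graph F A ≋ Graph G A
  Graph-cong F-cong G-cong {A} h = ≋-ext (half F-cong G-cong h) (half G-cong F-cong λ x p → ≋-sym (h x p))
    where
    half : ∀ {F G} → Congruent F → Congruent G → (∀ x → x ∊ A → F x ≋ G x) → Graph F A ⊑ Graph G A
    half F-cong G-cong h p p∊ =
      let x , x∊A , e = ∊-Graph⁻ p∊ in ∊-≋ˡ (≋-sym e) (∊-Graph⁺ G-cong x∊A (h x x∊A))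

  Graph-function : ∀ {F} → Congruent F → ∀ {A B} → (∀ x → x ∊ A → F x ∊ B) → IsFunction (Graph F A) A B
  Graph-function {F} F-cong {A} {B} maps =
    (λ p p∈ → let x , x∊A , e = ∊-Graph⁻ (∈⇒∊ p∈)
              in x , F x , ∊⇒∈ x∊A , ∊⇒∈ (maps x x∊A) , ≋⇒≈ (e ∙ ⟨⟩≋⟪⟫)) ,
    (λ x x∈A → F x , ⟨⟩∊⇒⟪⟫∈ (∊-Graph⁺ F-cong (∈⇒∊ x∈A) ≋-refl) ,
               λ p → ≋⇒≈ (≋-sym (proj₂ (⟨⟩∊Graph⁻ F-cong (⟪⟫∈⇒⟨⟩∊ p)))))

  abstract
    app : 𝕍 → 𝕍 → 𝕍
    app f x with em {∃ λ y → ⟨ x , y ⟩ ∊ f}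
    ... | yes (y , _) = y
    ... | no _ = ∅

    app-spec : ∀ {f x y} → ⟨ x , y ⟩ ∊ f → ⟨ x , app f x ⟩ ∊ f
    app-spec {f} {x} {y} p with em {∃ λ y → ⟨ x , y ⟩ ∊ f}
    ... | yes (y , q) = q
    ... | no ¬q = ⊥-elim (¬q (y , p))

    app-∅ : ∀ {f x} → ¬ (∃ λ y → ⟨ x , y ⟩ ∊ f) → app f x ≋ ∅
    app-∅ {f} {x} h with em {∃ λ y → ⟨ x , y ⟩ ∊ f}
    ... | yes q = ⊥-elim (h q)
    ... | no ¬q = ≋-refl

  module Function {f A B : 𝕍} (isFun : IsFunction f A B) where

    private
      entry : ∀ {x y} → ⟨ x , y ⟩ ∊ f → x ∊ A × y ∊ B
      entry p = let x′ , y′ , x′∈A , y′∈B , e = proj₁ isFun _ (∊⇒∈ p)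
                    e′ = ≈⇒≋ e ∙ ≋-sym ⟨⟩≋⟪⟫
                in ∊-≋ˡ (≋-sym (⟨⟩-injectiveˡ e′)) (∈⇒∊ x′∈A) , ∊-≋ˡ (≋-sym (⟨⟩-injectiveʳ e′)) (∈⇒∊ y′∈B)

    domain : ∀ {x y} → ⟨ x , y ⟩ ∊ f → x ∊ A
    domain p = proj₁ (entry p)

    codomain : ∀ {x y} → ⟨ x , y ⟩ ∊ f → y ∊ B
    codomain p = proj₂ (entry p)

    functional : ∀ {x y y′} → ⟨ x , y ⟩ ∊ f → ⟨ x , y′ ⟩ ∊ f → y ≋ y′
    functional {x} p p′ =
      let y₀ , _ , u = proj₂ isFun x (∊⇒∈ (domain p))
      in ≋-sym (≈⇒≋ (u (⟨⟩∊⇒⟪⟫∈ p))) ∙ ≈⇒≋ (u (⟨⟩∊⇒⟪⟫∈ p′))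

    app-graph : ∀ {x} → x ∊ A → ⟨ x , app f x ⟩ ∊ f
    app-graph {x} x∊A = let y , p , _ = proj₂ isFun x (∊⇒∈ x∊A) in app-spec (⟪⟫∈⇒⟨⟩∊ p)

    app-maps : ∀ x → x ∊ A → app f x ∊ B
    app-maps x x∊A = codomain (app-graph x∊A)

    app-unique : ∀ {x y} → ⟨ x , y ⟩ ∊ f → y ≋ app f x
    app-unique p = functional p (app-spec p)

    app-cong : Congruent (app f)
    app-cong {x} {x′} e with em {∃ λ y → ⟨ x , y ⟩ ∊ f}
    ... | yes (y , p) = functional (app-spec p)
          (∊-≋ˡ (⟨⟩-cong (≋-sym e) ≋-refl) (app-spec (∊-≋ˡ (⟨⟩-cong e ≋-refl) p)))
    ... | no ¬p = app-∅ ¬p ∙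
          ≋-sym (app-∅ λ (y , p) → ¬p (y , ∊-≋ˡ (⟨⟩-cong (≋-sym e) ≋-refl) p))

  abstract
    cases : Class → (𝕍 → 𝕍) → (𝕍 → 𝕍) → 𝕍 → 𝕍
    cases P F G x with em {P x}
    ... | yes _ = F x
    ... | no _ = G x

    cases-yes : ∀ P F G {x} → P x → cases P F G x ≋ F x
    cases-yes P F G {x} p with em {P x}
    ... | yes _ = ≋-refl
    ... | no ¬p = ⊥-elim (¬p p)

    cases-no : ∀ P F G {x} → ¬ P x → cases P F G x ≋ G x
    cases-no P F G {x} ¬p with em {P x}
    ... | yes p = ⊥-elim (¬p p)
    ... | no _ = ≋-refl

    cases-cong : ∀ P F G → Resp P → (∀ {x y} → P x → x ≋ y → F x ≋ F y) → (∀ {x y} → ¬ P x → x ≋ y → G x ≋ G y) →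
      Congruent (cases P F G)
    cases-cong P F G resp F-cong G-cong {x} {y} e with em {P x} | em {P y}
    ... | yes p | yes q = F-cong p e
    ... | no ¬p | no ¬q = G-cong ¬p e
    ... | yes p | no ¬q = ⊥-elim (¬q (resp e p))
    ... | no ¬p | yes q = ⊥-elim (¬p (resp (≋-sym e) q))

  -- Choice is applied to the set of fibres `Fib x` and not to the points: equal points have equal
  -- fibres, so the resulting map is congruent. `B` gathers one value per index and only serves to
  -- bound the fibres.
  unfolded-choose : (A : 𝕍) (P : 𝕍 → Class) → (∀ {x x′ y y′} → x ≋ x′ → y ≋ y′ → P x y → P x′ y′) →
    (∀ x → x ∊ A → ∃ (P x)) → Σ (𝕍 → 𝕍) λ g → Congruent g × (∀ x → x ∊ A → P x (g x))
  unfolded-choose A P resp h = (λ x → app f (Fib x)) , (λ e → app-cong (Fib-cong e)) , spec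
    where
    B : 𝕍
    B = sup (Index A) λ i → proj₁ (h (elem A i) (elem-∊ A i))
    respʳ : ∀ x → Resp (P x)
    respʳ x = resp ≋-refl
    Fib : 𝕍 → 𝕍
    Fib x = Sep B (P x)
    Fib-cong : Congruent Fib
    Fib-cong e = ≋-ext (half e) (half (≋-sym e))
      where
      half : ∀ {x x′} → x ≋ x′ → Fib x ⊑ Fib x′
      half {x} {x′} e z p = let z∊B , q = ∊-Sep⁻ (P x) (respʳ x) p
                            in ∊-Sep⁺ (P x′) (respʳ x′) z∊B (resp e ≋-refl q)
    F : 𝕍
    F = Image Fib A
    nonempty : ∀ x → x ∊ A → ∃ λ y → y ∊ Fib x
    nonempty x x∊A =
      let i , e = ∊⇒elem x∊A
          y , p = h (elem A i) (elem-∊ A i)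
      in y , ∊-Sep⁺ (P x) (respʳ x) (sup-∊⁺ i ≋-refl) (resp (≋-sym e) ≋-refl p)
    choice : ∃₂ λ f C → IsFunction f F C × (∀ x y → ⟪ x , y ⟫ ∈ f → y ∈ x)
    choice = ac F λ u u∈F → let x , x∊A , e = ∊-Image⁻ (∈⇒∊ u∈F); y , p = nonempty x x∊A
                            in y , ∊⇒∈ (∊-≋ʳ (≋-sym e) p)
    f : 𝕍
    f = proj₁ choice
    open Function (proj₁ (proj₂ (proj₂ choice)))
    spec : ∀ x → x ∊ A → P x (app f (Fib x))
    spec x x∊A = proj₂ (∊-Sep⁻ (P x) (respʳ x) (∈⇒∊ (proj₂ (proj₂ (proj₂ choice)) (Fib x) _
      (⟨⟩∊⇒⟪⟫∈ (app-graph (∊-Image⁺ Fib-cong x∊A ≋-refl))))))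

  abstract
    choose : (A : 𝕍) (P : 𝕍 → Class) → (∀ {x x′ y y′} → x ≋ x′ → y ≋ y′ → P x y → P x′ y′) →
      (∀ x → x ∊ A → ∃ (P x)) → Σ (𝕍 → 𝕍) λ g → Congruent g × (∀ x → x ∊ A → P x (g x))
    choose = unfolded-choose

  -- Injections and bijections

  -- The map is defined on the whole universe, so injections compose as plain functions; graphs are
  -- formed only to translate to and from `≼`.
  record Inj (A B : 𝕍) : Set (suc ℓ) where
    field
      fn        : 𝕍 → 𝕍
      fn-cong   : Congruent fn
      maps      : ∀ {x} → x ∊ A → fn x ∊ B
      injective : ∀ {x y} → x ∊ A → y ∊ A → fn x ≋ fn y → x ≋ y

  record Bij (A B : 𝕍) : Set (suc ℓ) where
    field
      inj        : Inj A B
      surjective : ∀ {y} → y ∊ B → ∃ λ x → x ∊ A × y ≋ Inj.fn inj x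
    open Inj inj public

  IsInjection⇒Inj : ∀ {f A B} → IsInjection f A B → Inj A B
  IsInjection⇒Inj {f} (f-fun , f-inj) = record
    { fn = app f
    ; fn-cong = app-cong
    ; maps = app-maps _
    ; injective = λ x∊A y∊A e → ≈⇒≋ (f-inj _ _ _
        (⟨⟩∊⇒⟪⟫∈ (∊-≋ˡ (⟨⟩-cong ≋-refl e) (app-graph x∊A))) (⟨⟩∊⇒⟪⟫∈ (app-graph y∊A)))
    }
    where open Function f-fun

  Inj⇒IsInjection : ∀ {A B} (i : Inj A B) → IsInjection (Graph (Inj.fn i) A) A B
  Inj⇒IsInjection i =
    Graph-function fn-cong (λ x → maps) ,
    λ x x′ y p q → let x∊A , e = ⟨⟩∊Graph⁻ fn-cong (⟪⟫∈⇒⟨⟩∊ p)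
                       x′∊A , e′ = ⟨⟩∊Graph⁻ fn-cong (⟪⟫∈⇒⟨⟩∊ q)
                   in ≋⇒≈ (injective x∊A x′∊A (≋-sym e ∙ e′))
    where open Inj i

  ≼⇒Inj : ∀ {A B} → A ≼ B → Inj A B
  ≼⇒Inj (f , p) = IsInjection⇒Inj p

  Inj⇒≼ : ∀ {A B} → Inj A B → A ≼ B
  Inj⇒≼ i = _ , Inj⇒IsInjection i

  ≃⇒Bij : ∀ {A B} → A ≃ B → Bij A B
  ≃⇒Bij (f , p , s) = record
    { inj = IsInjection⇒Inj p
    ; surjective = λ y∊B → let x , q = s _ (∊⇒∈ y∊B)
                           in x , Function.domain (proj₁ p) (⟪⟫∈⇒⟨⟩∊ q) , Function.app-unique (proj₁ p) (⟪⟫∈⇒⟨⟩∊ q)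
    }

  Bij⇒≃ : ∀ {A B} → Bij A B → A ≃ B
  Bij⇒≃ b = _ , Inj⇒IsInjection inj ,
    λ y y∈B → let x , x∊A , e = surjective (∈⇒∊ y∈B) in x , ⟨⟩∊⇒⟪⟫∈ (∊-Graph⁺ fn-cong x∊A e)
    where open Bij b

  Inj-⊑ : ∀ {A B} → A ⊑ B → Inj A B
  Inj-⊑ h = record { fn = id ; fn-cong = id ; maps = h _ ; injective = λ _ _ → id }

  Inj-trans : ∀ {A B C} → Inj A B → Inj B C → Inj A C
  Inj-trans i j = record
    { fn = J.fn ∘ I.fn
    ; fn-cong = λ e → J.fn-cong (I.fn-cong e)
    ; maps = λ p → J.maps (I.maps p)
    ; injective = λ p q e → I.injective p q (J.injective (I.maps p) (I.maps q) e)
    }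
    where module I = Inj i
          module J = Inj j

  Bij-trans : ∀ {A B C} → Bij A B → Bij B C → Bij A C
  Bij-trans i j = record
    { inj = Inj-trans I.inj J.inj
    ; surjective = λ z∊C → let y , y∊B , e = J.surjective z∊C
                               x , x∊A , e′ = I.surjective y∊B
                           in x , x∊A , e ∙ J.fn-cong e′
    }
    where module I = Bij i
          module J = Bij j

  Bij-sym : ∀ {A B} → Bij A B → Bij B A
  Bij-sym {A} {B} b = record
    { inj = record
      { fn = g ; fn-cong = g-cong ; maps = λ p → proj₁ (g-spec _ p)
      ; injective = λ p q e → proj₂ (g-spec _ p) ∙ fn-cong e ∙ ≋-sym (proj₂ (g-spec _ q)) }
    ; surjective = λ {x} p → fn x , maps p ,
        injective p (proj₁ (g-spec _ (maps p))) (proj₂ (g-spec _ (maps p)))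
    }
    where
    open Bij b
    inverse = choose B (λ y x → x ∊ A × y ≋ fn x)
      (λ e e′ (p , q) → ∊-≋ˡ e′ p , ≋-sym e ∙ q ∙ fn-cong e′) (λ _ → surjective)
    g = proj₁ inverse
    g-cong = proj₁ (proj₂ inverse)
    g-spec = proj₂ (proj₂ inverse)

  module CantorBernstein {A B : 𝕍} (i : Inj A B) (j : Inj B A) where
    private
      module f = Inj i
      module g = Inj j

    -- The points of `A` whose backward chain under g and f ends, after `n` rounds, at a point of
    -- `A` outside the range of g. The bijection follows f on these points and the inverse of g
    -- elsewhere.
    Orbit : ℕ → Class
    Orbit zero x = x ∊ A × ¬ (∃ λ y → y ∊ B × x ≋ g.fn y)
    Orbit (1+ n) x = ∃ λ y → Orbit n y × x ≋ g.fn (f.fn y)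

    Orbit-resp : ∀ n → Resp (Orbit n)
    Orbit-resp zero e (p , q) = ∊-≋ˡ e p , λ (z , z∊B , e′) → q (z , z∊B , e ∙ e′)
    Orbit-resp (1+ n) e (z , p , e′) = z , p , ≋-sym e ∙ e′

    Orbit⇒∊ : ∀ n {x} → Orbit n x → x ∊ A
    Orbit⇒∊ zero (p , _) = p
    Orbit⇒∊ (1+ n) (y , p , e) = ∊-≋ˡ (≋-sym e) (g.maps (f.maps (Orbit⇒∊ n p)))

    InOrbit : Class
    InOrbit x = ∃ λ n → Orbit n x

    InOrbit-resp : Resp InOrbit
    InOrbit-resp e (n , p) = n , Orbit-resp n e p

    inverse : Σ (𝕍 → 𝕍) λ g′ → Congruent g′ ×
      (∀ x → x ∊ Sep A (λ x → ¬ InOrbit x) → g′ x ∊ B × x ≋ g.fn (g′ x))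
    inverse = choose (Sep A (λ x → ¬ InOrbit x)) (λ x y → y ∊ B × x ≋ g.fn y)
      (λ e e′ (p , q) → ∊-≋ˡ e′ p , ≋-sym e ∙ q ∙ g.fn-cong e′)
      (λ x x∊ → let x∊A , ¬o = ∊-Sep⁻ _ (¬-resp InOrbit-resp) x∊
                in by-contradiction λ ¬p → ¬o (0 , x∊A , ¬p))

    g⁻¹ : 𝕍 → 𝕍
    g⁻¹ = proj₁ inverse

    g⁻¹-spec : ∀ {x} → x ∊ A → ¬ InOrbit x → g⁻¹ x ∊ B × x ≋ g.fn (g⁻¹ x)
    g⁻¹-spec p ¬o = proj₂ (proj₂ inverse) _ (∊-Sep⁺ _ (¬-resp InOrbit-resp) p ¬o)

    h : 𝕍 → 𝕍
    h = cases InOrbit f.fn g⁻¹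

    h-yes : ∀ {x} → InOrbit x → h x ≋ f.fn x
    h-yes = cases-yes InOrbit f.fn g⁻¹

    h-no : ∀ {x} → ¬ InOrbit x → h x ≋ g⁻¹ x
    h-no = cases-no InOrbit f.fn g⁻¹

    h-maps : ∀ {x} → x ∊ A → h x ∊ B
    h-maps {x} p = case em {InOrbit x} of λ where
      (yes o) → ∊-≋ˡ (≋-sym (h-yes o)) (f.maps p)
      (no ¬o) → ∊-≋ˡ (≋-sym (h-no ¬o)) (proj₁ (g⁻¹-spec p ¬o))

    mixed : ∀ {x y} → y ∊ A → InOrbit x → ¬ InOrbit y → f.fn x ≋ g⁻¹ y → ⊥
    mixed q (n , o) ¬o e = ¬o (1+ n , _ , o , proj₂ (g⁻¹-spec q ¬o) ∙ g.fn-cong (≋-sym e))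

    h-injective : ∀ {x y} → x ∊ A → y ∊ A → h x ≋ h y → x ≋ y
    h-injective {x} {y} p q e = case em {InOrbit x} of λ where
      (yes o) → case em {InOrbit y} of λ where
        (yes o′) → f.injective p q (≋-sym (h-yes o) ∙ e ∙ h-yes o′)
        (no ¬o) → ⊥-elim (mixed q o ¬o (≋-sym (h-yes o) ∙ e ∙ h-no ¬o))
      (no ¬o) → case em {InOrbit y} of λ where
        (yes o) → ⊥-elim (mixed p o ¬o (≋-sym (h-yes o) ∙ ≋-sym e ∙ h-no ¬o))
        (no ¬o′) → proj₂ (g⁻¹-spec p ¬o) ∙ g.fn-cong (≋-sym (h-no ¬o) ∙ e ∙ h-no ¬o′)
                   ∙ ≋-sym (proj₂ (g⁻¹-spec q ¬o′))

    h-surjective : ∀ {b} → b ∊ B → ∃ λ x → x ∊ A × b ≋ h x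
    h-surjective {b} b∊B = case em {InOrbit (g.fn b)} of λ where
      (yes (zero , _ , ¬p)) → ⊥-elim (¬p (b , b∊B , ≋-refl))
      (yes (1+ n , y , o , e)) → y , Orbit⇒∊ n o ,
        g.injective b∊B (f.maps (Orbit⇒∊ n o)) e ∙ ≋-sym (h-yes (n , o))
      (no ¬o) → let q , e = g⁻¹-spec (g.maps b∊B) ¬o
                in g.fn b , g.maps b∊B , g.injective b∊B q e ∙ ≋-sym (h-no ¬o)

    bijection : Bij A B
    bijection = record
      { inj = record
          { fn = h
          ; fn-cong = cases-cong InOrbit f.fn g⁻¹ InOrbit-resp (λ _ → f.fn-cong) (λ _ → proj₁ (proj₂ inverse))
          ; maps = h-maps ; injective = h-injective }
      ; surjective = h-surjective }

  -- Ordinals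

  Trichotomous : 𝕍 → 𝕍 → Set (suc ℓ)
  Trichotomous x y = x ∊ y ⊎ x ≋ y ⊎ y ∊ x

  record Ord (α : 𝕍) : Set (suc ℓ) where
    field
      transitive : ∀ {x y} → x ∊ y → y ∊ α → x ∊ α
      linear     : ∀ {x y} → x ∊ α → y ∊ α → Trichotomous x y

  open Ord

  IsOrdinal⇒Ord : ∀ {α} → IsOrdinal α → Ord α
  IsOrdinal⇒Ord (t , l) = record
    { transitive = λ p q → ∈⇒∊ (t _ (∊⇒∈ q) _ (∊⇒∈ p))
    ; linear = λ p q → case l _ _ (∊⇒∈ p) (∊⇒∈ q) of λ where
        (inj₁ r) → inj₁ (∈⇒∊ r)
        (inj₂ (inj₁ e)) → inj₂ (inj₁ (≈⇒≋ e))
        (inj₂ (inj₂ r)) → inj₂ (inj₂ (∈⇒∊ r)) }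

  Ord⇒IsOrdinal : ∀ {α} → Ord α → IsOrdinal α
  Ord⇒IsOrdinal o =
    (λ y p z q → ∊⇒∈ (transitive o (∈⇒∊ q) (∈⇒∊ p))) ,
    (λ x y p q → case linear o (∈⇒∊ p) (∈⇒∊ q) of λ where
        (inj₁ r) → inj₁ (∊⇒∈ r)
        (inj₂ (inj₁ e)) → inj₂ (inj₁ (≋⇒≈ e))
        (inj₂ (inj₂ r)) → inj₂ (inj₂ (∊⇒∈ r)))

  Ord-resp : Resp Ord
  Ord-resp e o = record
    { transitive = λ p q → ∊-≋ʳ e (transitive o p (≋⇒⊒ e _ q))
    ; linear = λ p q → linear o (≋⇒⊒ e _ p) (≋⇒⊒ e _ q) }

  Ord-∊ : ∀ {α β} → Ord α → β ∊ α → Ord β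
  Ord-∊ {α} {β} o β∊α = record
    { transitive = λ {x} {y} x∊y y∊β → case linear o (transitive o x∊y (transitive o y∊β β∊α)) β∊α of λ where
        (inj₁ p) → p
        (inj₂ (inj₁ e)) → ⊥-elim (∊-asym _ _ (∊-≋ˡ e x∊y) y∊β)
        (inj₂ (inj₂ p)) → ⊥-elim (∊-acyclic₃ _ _ _ p x∊y y∊β)
    ; linear = λ p q → linear o (transitive o p β∊α) (transitive o q β∊α) }

  -- A member γ of α outside β is comparable with β by induction, which forces β ≤ γ < α. The
  -- situation is symmetric, and if neither ordinal has such a member they are equal.
  trichotomy : ∀ {α β} → Ord α → Ord β → Trichotomous α β
  trichotomy {α} {β} = go α β
    where
    go : ∀ α β → Ord α → Ord β → Trichotomous α β
    go = ∊-induction _ λ α recα → ∊-induction _ λ β recβ oα oβ →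
      case em {∃ λ γ → γ ∊ α × ¬ (γ ∊ β)} of λ where
        (yes (γ , p , ¬q)) → case recα γ p β (Ord-∊ oα p) oβ of λ where
          (inj₁ q) → ⊥-elim (¬q q)
          (inj₂ (inj₁ e)) → inj₂ (inj₂ (∊-≋ˡ e p))
          (inj₂ (inj₂ q)) → inj₂ (inj₂ (transitive oα q p))
        (no α⊑β) → case em {∃ λ γ → γ ∊ β × ¬ (γ ∊ α)} of λ where
          (yes (γ , p , ¬q)) → case recβ γ p oα (Ord-∊ oβ p) of λ where
            (inj₁ q) → inj₁ (transitive oβ q p)
            (inj₂ (inj₁ e)) → inj₁ (∊-≋ˡ (≋-sym e) p)
            (inj₂ (inj₂ q)) → ⊥-elim (¬q q)
          (no β⊑α) → inj₂ (inj₁ (≋-ext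
            (λ z p → by-contradiction λ ¬q → α⊑β (z , p , ¬q))
            (λ z p → by-contradiction λ ¬q → β⊑α (z , p , ¬q))))

  ∊⇒⊑ : ∀ {α β} → Ord β → α ∊ β → α ⊑ β
  ∊⇒⊑ o p z q = transitive o q p

  ∊⊎⊒ : ∀ {α β} → Ord α → Ord β → α ∊ β ⊎ β ⊑ α
  ∊⊎⊒ oα oβ with trichotomy oα oβ
  ... | inj₁ p = inj₁ p
  ... | inj₂ (inj₁ e) = inj₂ (≋⇒⊒ e)
  ... | inj₂ (inj₂ p) = inj₂ (∊⇒⊑ oα p)

  ⊑⇒∊⊎≋ : ∀ {α β} → Ord α → Ord β → α ⊑ β → α ∊ β ⊎ α ≋ β
  ⊑⇒∊⊎≋ oα oβ h with trichotomy oα oβ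
  ... | inj₁ p = inj₁ p
  ... | inj₂ (inj₁ e) = inj₂ e
  ... | inj₂ (inj₂ p) = ⊥-elim (∊-irrefl _ (h _ p))

  ⊑-∊-trans : ∀ {α β γ} → Ord α → Ord γ → α ⊑ β → β ∊ γ → α ∊ γ
  ⊑-∊-trans {β = β} oα oγ α⊑β β∊γ with ∊⊎⊒ oα oγ
  ... | inj₁ p = p
  ... | inj₂ γ⊑α = ⊥-elim (∊-irrefl β (α⊑β β (γ⊑α β β∊γ)))

  abstract
    least : (P : Class) → ∀ {α} → Ord α → P α →
      ∃ λ β → Ord β × P β × (∀ γ → γ ∊ β → ¬ P γ)
    least P {α} = go α
      where
      go : ∀ α → Ord α → P α → ∃ λ β → Ord β × P β × (∀ γ → γ ∊ β → ¬ P γ)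
      go = ∊-induction _ λ α rec o p → case em {∃ λ γ → γ ∊ α × P γ} of λ where
        (yes (γ , q , r)) → rec γ q (Ord-∊ o q) r
        (no h) → α , o , p , λ γ q r → h (γ , q , r)

  -- Coding of small transitive sets, and Hartogs numbers

  module _ {I : Set ℓ} (R : I → I → Bool) where
    Below : I → I → Set
    Below j i = R j i ≡ true

    -- The Mostowski collapse of `R` at `i`, by recursion on accessibility.
    decode : (i : I) → Acc Below i → 𝕍
    decode i (acc rs) = sup (Σ I λ j → R j i ≡ true) λ (j , p) → decode j (rs p)

  abstract
    -- Only relations on `Index B` are collapsed, so the family is small, yet it contains all
    -- members of every transitive set that injects into `B`. It bounds both the Hartogs number and
    -- H(θ).
    Codes : 𝕍 → 𝕍
    Codes B = sup (Σ (Index B → Index B → Bool) λ R → Σ (Index B) λ i → Acc (Below R) i)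
                  (λ (R , i , a) → decode R i a)

    ∊-Codes : ∀ {B t} → (∀ {x y} → x ∊ y → y ∊ t → x ∊ t) → Inj t B → ∀ {x} → x ∊ t → x ∊ Codes B
    ∊-Codes {B} {t} t-trans inj x∊t =
      let i , e = ∊⇒elem (maps x∊t)
          a = accessible _ x∊t i e
      in sup-∊⁺ (R , i , a) (≋-sym (decode-≋ _ x∊t i e a))
      where
      open Inj inj
      P : Index B → Index B → Set (suc ℓ)
      P j i = ∃₂ λ u v → u ∊ t × v ∊ t × fn u ≋ elem B j × fn v ≋ elem B i × u ∊ v
      R : Index B → Index B → Bool
      R j i = isYes (em {P j i})
      accessible : ∀ u → u ∊ t → ∀ i → fn u ≋ elem B i → Acc (Below R) i
      accessible = ∊-induction _ λ u rec u∊t i e → acc λ {j} Rji →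
        let u′ , v′ , p , q , e₁ , e₂ , r = true-isYes (em {P j i}) Rji
        in rec u′ (∊-≋ʳ (injective q u∊t (e₂ ∙ ≋-sym e)) r) p j e₁
      decode-≋ : ∀ u → u ∊ t → ∀ i → fn u ≋ elem B i → ∀ a → decode R i a ≋ u
      decode-≋ = ∊-induction _ λ { u rec u∊t i e (acc rs) → ≋-ext
        (λ z z∊ → let (j , Rji) , e′ = sup-∊⁻ z∊
                      u′ , v′ , p , q , e₁ , e₂ , r = true-isYes (em {P j i}) Rji
                      u′∊u = ∊-≋ʳ (injective q u∊t (e₂ ∙ ≋-sym e)) r
                  in ∊-≋ˡ (≋-sym (e′ ∙ rec u′ u′∊u p j e₁ (rs Rji))) u′∊u)
        (λ z z∊u → let z∊t = t-trans z∊u u∊t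
                       j , e′ = ∊⇒elem (maps z∊t)
                       Rji = isYes-true (em {P j i}) (z , u , z∊t , u∊t , e′ , e , z∊u)
                   in sup-∊⁺ (j , Rji) (≋-sym (rec z z∊u z∊t j e′ (rs Rji)))) }

    Hartogs : 𝕍 → 𝕍
    Hartogs A = Sep (𝒫 (Codes A)) (λ α → Ord α × Inj α A)

    private
      Hartogs-resp : ∀ A → Resp (λ α → Ord α × Inj α A)
      Hartogs-resp A e (o , i) = Ord-resp e o , Inj-trans (Inj-⊑ (≋⇒⊒ e)) i

    ∊-Hartogs⁺ : ∀ {A α} → Ord α → Inj α A → α ∊ Hartogs A
    ∊-Hartogs⁺ o i = ∊-Sep⁺ _ (Hartogs-resp _) (∊-𝒫⁺ λ _ → ∊-Codes (transitive o) i) (o , i)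

    ∊-Hartogs⁻ : ∀ {A α} → α ∊ Hartogs A → Ord α × Inj α A
    ∊-Hartogs⁻ p = proj₂ (∊-Sep⁻ _ (Hartogs-resp _) p)

  Hartogs-ordinal : ∀ A → Ord (Hartogs A)
  Hartogs-ordinal A = record
    { transitive = λ q p → let o , i = ∊-Hartogs⁻ p
                           in ∊-Hartogs⁺ (Ord-∊ o q) (Inj-trans (Inj-⊑ (∊⇒⊑ o q)) i)
    ; linear = λ p q → trichotomy (proj₁ (∊-Hartogs⁻ p)) (proj₁ (∊-Hartogs⁻ q)) }

  ¬Inj-Hartogs : ∀ A → ¬ Inj (Hartogs A) A
  ¬Inj-Hartogs A i = ∊-irrefl (Hartogs A) (∊-Hartogs⁺ (Hartogs-ordinal A) i)

  -- Enumeration of a set along the ordinals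

  -- `pick` is left open because the well-ordering theorem needs an arbitrary choice, while the
  -- counting argument for ω₁ picks elements of least rank.
  module Enumerate (A : 𝕍) (pick : 𝕍 → 𝕍) (pick-cong : Congruent pick)
    (pick-∊ : ∀ X → X ⊑ A → (∃ λ z → z ∊ X) → pick X ∊ X) where

    Rest : 𝕍 → 𝕍
    Rest Y = Sep A (λ z → ¬ (z ∊ Y))

    ∊-Rest⁺ : ∀ {Y z} → z ∊ A → ¬ (z ∊ Y) → z ∊ Rest Y
    ∊-Rest⁺ = ∊-Sep⁺ _ (¬-resp ∊-≋ˡ)

    ∊-Rest⁻ : ∀ {Y z} → z ∊ Rest Y → z ∊ A × ¬ (z ∊ Y)
    ∊-Rest⁻ = ∊-Sep⁻ _ (¬-resp ∊-≋ˡ)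

    Rest-anti : ∀ {Y Y′} → Y ⊑ Y′ → Rest Y′ ⊑ Rest Y
    Rest-anti h z p = let z∊A , ¬q = ∊-Rest⁻ p in ∊-Rest⁺ z∊A (λ q → ¬q (h z q))

    Rest-cong : Congruent Rest
    Rest-cong e = ≋-ext (Rest-anti (≋⇒⊒ e)) (Rest-anti (≋⇒⊑ e))

    -- Transfinite recursion by structural recursion on sets: `G x` picks from what the values at
    -- the members of `x` have left over. If something were left at every ordinal, `G` would inject
    -- the Hartogs number of `A` into `A`.
    G : 𝕍 → 𝕍
    G (sup I f) = pick (Rest (sup I λ i → G (f i)))

    G[_] : 𝕍 → 𝕍
    G[ sup I f ] = sup I λ i → G (f i)

    G-eq : ∀ x → G x ≋ pick (Rest G[ x ])
    G-eq (sup I f) = ≋-refl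

    G-cong′ : ∀ x y → x ≈ y → G x ≋ G y
    G-cong′ (sup I f) (sup J g) (p , q) = pick-cong (Rest-cong (≈⇒≋
      ((λ i → let j , e = p i in j , ≋⇒≈ (G-cong′ (f i) (g j) e)) ,
       (λ j → let i , e = q j in i , ≋⇒≈ (G-cong′ (f i) (g j) e)))))

    G-cong : Congruent G
    G-cong (≈⇒≋ e) = G-cong′ _ _ e

    ∊-G[]⁺ : ∀ {x y z} → y ∊ x → z ≋ G y → z ∊ G[ x ]
    ∊-G[]⁺ {sup I f} y∊x e = let i , e′ = sup-∊⁻ y∊x in sup-∊⁺ i (e ∙ G-cong e′)

    ∊-G[]⁻ : ∀ {x z} → z ∊ G[ x ] → ∃ λ y → y ∊ x × z ≋ G y
    ∊-G[]⁻ {sup I f} z∊ = let i , e = sup-∊⁻ z∊ in f i , sup-∊⁺ i ≋-refl , e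

    G[]-mono : ∀ {x y} → x ⊑ y → G[ x ] ⊑ G[ y ]
    G[]-mono h z p = let w , q , e = ∊-G[]⁻ p in ∊-G[]⁺ (h w q) e

    Fresh : Class
    Fresh x = ∃ λ z → z ∊ Rest G[ x ]

    G-∊-Rest : ∀ {x} → Fresh x → G x ∊ Rest G[ x ]
    G-∊-Rest {x} fr = ∊-≋ˡ (≋-sym (G-eq x)) (pick-∊ _ (λ z p → proj₁ (∊-Rest⁻ p)) fr)

    G-inj : ∀ {α} → Ord α → (∀ ξ → ξ ∊ α → Fresh ξ) → Inj α A
    G-inj o fr = record
      { fn = G ; fn-cong = G-cong ; maps = λ p → proj₁ (∊-Rest⁻ (G-∊-Rest (fr _ p)))
      ; injective = λ p q e → case trichotomy (Ord-∊ o p) (Ord-∊ o q) of λ where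
          (inj₁ r) → ⊥-elim (proj₂ (∊-Rest⁻ (G-∊-Rest (fr _ q))) (∊-G[]⁺ r (≋-sym e)))
          (inj₂ (inj₁ e′)) → e′
          (inj₂ (inj₂ r)) → ⊥-elim (proj₂ (∊-Rest⁻ (G-∊-Rest (fr _ p))) (∊-G[]⁺ r e)) }

    private
      stops : ∃ λ γ → Ord γ × ¬ Fresh γ
      stops = by-contradiction λ h → ¬Inj-Hartogs A (G-inj (Hartogs-ordinal A)
        λ ξ p → by-contradiction λ ¬fr → h (ξ , proj₁ (∊-Hartogs⁻ p) , ¬fr))

      least-stop : ∃ λ γ → Ord γ × ¬ Fresh γ × (∀ ξ → ξ ∊ γ → ¬ ¬ Fresh ξ)
      least-stop = let γ , o , ¬fr = stops in least (λ ξ → ¬ Fresh ξ) o ¬fr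

    abstract
      length : 𝕍
      length = proj₁ least-stop

      length-ordinal : Ord length
      length-ordinal = proj₁ (proj₂ least-stop)

      fresh : ∀ ξ → ξ ∊ length → Fresh ξ
      fresh ξ p = by-contradiction (proj₂ (proj₂ (proj₂ least-stop)) ξ p)

      exhausted : ∀ {z} → z ∊ A → z ∊ G[ length ]
      exhausted z∊A = by-contradiction λ ¬p → proj₁ (proj₂ (proj₂ least-stop)) (_ , ∊-Rest⁺ z∊A ¬p)

    enumeration : Bij length A
    enumeration = record
      { inj = G-inj length-ordinal fresh ; surjective = λ z∊A → ∊-G[]⁻ (exhausted z∊A) }

  Nonempty : Class
  Nonempty X = ∃ λ z → z ∊ X

  Nonempty-resp : Resp Nonempty
  Nonempty-resp e (z , p) = z , ∊-≋ʳ e p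

  abstract
    zermelo : ∀ A → ∃ λ γ → Ord γ × Bij γ A
    zermelo A = E.length , E.length-ordinal , E.enumeration
      where
      choice : Σ (𝕍 → 𝕍) λ g → Congruent g × (∀ X → X ∊ Sep (𝒫 A) Nonempty → g X ∊ X)
      choice = choose (Sep (𝒫 A) Nonempty) (λ X z → z ∊ X)
        (λ e e′ p → ∊-≋ˡ e′ (∊-≋ʳ e p)) (λ X p → proj₂ (∊-Sep⁻ Nonempty Nonempty-resp p))
      module E = Enumerate A (proj₁ choice) (proj₁ (proj₂ choice))
        (λ X X⊑A ne → proj₂ (proj₂ choice) X (∊-Sep⁺ Nonempty Nonempty-resp (∊-𝒫⁺ X⊑A) ne))

  -- Cardinals

  Card : Class
  Card κ = Ord κ × (∀ α → α ∊ κ → ¬ Bij α κ)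

  IsCardinal⇒Card : ∀ {κ} → IsCardinal κ → Card κ
  IsCardinal⇒Card (o , h) = IsOrdinal⇒Ord o , λ α p b → h α (∊⇒∈ p) (Bij⇒≃ b)

  Card⇒IsCardinal : ∀ {κ} → Card κ → IsCardinal κ
  Card⇒IsCardinal (o , h) = Ord⇒IsOrdinal o , λ α p b → h α (∈⇒∊ p) (≃⇒Bij b)

  abstract
    cardinality : ∀ A → ∃ λ γ → Card γ × Bij γ A
    cardinality A =
      let γ , o , b = zermelo A
          κ , oκ , bκ , min = least (λ α → Bij α A) o b
      in κ , (oκ , λ α p e → min α p (Bij-trans e bκ)) , bκ

  Card-¬Inj : ∀ {κ α} → Card κ → α ∊ κ → ¬ Inj κ α
  Card-¬Inj (o , h) p i = h _ p (CantorBernstein.bijection (Inj-⊑ (∊⇒⊑ o p)) i)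

  small-cardinality : ∀ {κ A} → Ord κ → ¬ Inj κ A → ∃ λ α → α ∊ κ × Card α × Bij α A
  small-cardinality {κ} {A} o h with cardinality A
  ... | α , c , b with ∊⊎⊒ (proj₁ c) o
  ... | inj₁ p = α , p , c , b
  ... | inj₂ κ⊑α = ⊥-elim (h (Inj-trans (Inj-⊑ κ⊑α) (Bij.inj b)))

  -- ω and countable sets

  least-ℕ : (P : ℕ → Set (suc ℓ)) → ∃ P → ∃ λ n → P n × (∀ m → m < n → ¬ P m)
  least-ℕ P (n , p) = go n p (<-wellFounded n)
    where
    go : ∀ n → P n → Acc _<_ n → ∃ λ n → P n × (∀ m → m < n → ¬ P m)
    go n p (acc rs) = case em {∃ λ m → m < n × P m} of λ where
      (yes (m , q , r)) → go m r (rs q)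
      (no h) → n , p , λ m q r → h (m , q , r)

  next-pair : ℕ × ℕ → ℕ × ℕ
  next-pair (zero , y) = 1+ y , 0
  next-pair (1+ x , y) = x , 1+ y

  unpair : ℕ → ℕ × ℕ
  unpair zero = 0 , 0
  unpair (1+ n) = next-pair (unpair n)

  -- Induction along the antidiagonals: within one the predecessor has a smaller second coordinate,
  -- and at its start the predecessor is the end of the previous one.
  unpair-surjective : ∀ x y → ∃ λ n → unpair n ≡ (x , y)
  unpair-surjective x y = go (x + y) y x refl
    where
    go : ∀ s y x → x + y ≡ s → ∃ λ n → unpair n ≡ (x , y)
    go zero zero zero e = 0 , refl
    go (1+ s) zero (1+ x) e =
      let n , e′ = go s x zero (trans (sym (ℕ.+-identityʳ x)) (ℕ.suc-injective e)) in 1+ n , cong next-pair e′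
    go s (1+ y) x e =
      let n , e′ = go s y (1+ x) (trans (sym (ℕ.+-suc x y)) e) in 1+ n , cong next-pair e′

  ∊-succ⁻ : ∀ {x z} → z ∊ succ x → z ∊ x ⊎ z ≋ x
  ∊-succ⁻ {x} p with sup-∊⁻ p
  ... | just i , e = inj₁ (∊-≋ˡ (≋-sym e) (elem-∊ x i))
  ... | nothing , e = inj₂ e

  ∊-succˡ : ∀ {x z} → z ∊ x → z ∊ succ x
  ∊-succˡ p = let i , e = ∊⇒elem p in sup-∊⁺ (just i) e

  ∊-succʳ : ∀ {x} → x ∊ succ x
  ∊-succʳ = sup-∊⁺ nothing ≋-refl

  ∊-nat⁺ : ∀ {m n} → m < n → nat m ∊ nat n
  ∊-nat⁺ {m} {1+ n} (s≤s m≤n) with ℕ.m≤n⇒m<n∨m≡n m≤n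
  ... | inj₁ m<n = ∊-succˡ (∊-nat⁺ m<n)
  ... | inj₂ refl = ∊-succʳ

  ∊-nat⁻ : ∀ n {z} → z ∊ nat n → ∃ λ m → m < n × z ≋ nat m
  ∊-nat⁻ zero (∈⇒∊ ())
  ∊-nat⁻ (1+ n) p with ∊-succ⁻ p
  ... | inj₁ q = let m , m<n , e = ∊-nat⁻ n q in m , ℕ.m<n⇒m<1+n m<n , e
  ... | inj₂ e = n , ℕ.n<1+n n , e

  nat-injective : ∀ {m n} → nat m ≋ nat n → m ≡ n
  nat-injective {m} {n} e with ℕ.<-cmp m n
  ... | tri< m<n _ _ = ⊥-elim (∊-irrefl _ (∊-≋ʳ (≋-sym e) (∊-nat⁺ m<n)))
  ... | tri≈ _ m≡n _ = m≡n
  ... | tri> _ _ n<m = ⊥-elim (∊-irrefl _ (∊-≋ʳ e (∊-nat⁺ n<m)))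

  ∊-ω⁺ : ∀ n {z} → z ≋ nat n → z ∊ ω
  ∊-ω⁺ n e = sup-∊⁺ (lift n) e

  ∊-ω⁻ : ∀ {z} → z ∊ ω → ∃ λ n → z ≋ nat n
  ∊-ω⁻ p = let lift n , e = sup-∊⁻ p in n , e

  ω-ordinal : Ord ω
  ω-ordinal = record
    { transitive = λ p q → let n , e = ∊-ω⁻ q; m , _ , e′ = ∊-nat⁻ n (∊-≋ʳ e p) in ∊-ω⁺ m e′
    ; linear = λ p q → linear′ (∊-ω⁻ p) (∊-ω⁻ q) }
    where
    linear′ : ∀ {x y} → ∃ (λ n → x ≋ nat n) → ∃ (λ n → y ≋ nat n) → Trichotomous x y
    linear′ (m , e) (n , e′) with ℕ.<-cmp m n
    ... | tri< m<n _ _ = inj₁ (∊-≋ˡ (≋-sym e) (∊-≋ʳ (≋-sym e′) (∊-nat⁺ m<n)))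
    ... | tri≈ _ refl _ = inj₂ (inj₁ (e ∙ ≋-sym e′))
    ... | tri> _ _ n<m = inj₂ (inj₂ (∊-≋ˡ (≋-sym e′) (∊-≋ʳ (≋-sym e) (∊-nat⁺ n<m))))

  -- The enumeration may repeat values and leave `A`, so empty and finite sets need no separate
  -- treatment.
  Cnt : Class
  Cnt A = ∃ λ (e : ℕ → 𝕍) → ∀ z → z ∊ A → ∃ λ n → z ≋ e n

  Cnt-⊑ : ∀ {A B} → A ⊑ B → Cnt B → Cnt A
  Cnt-⊑ h (e , c) = e , λ z p → c z (h z p)

  Cnt-Range : ∀ e → Cnt (Range e)
  Cnt-Range e = e , λ z → ∊-Range⁻

  Cnt-by-pairs : ∀ {A} (e : ℕ → ℕ → 𝕍) → (∀ z → z ∊ A → ∃₂ λ i j → z ≋ e i j) → Cnt A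
  Cnt-by-pairs e c = (λ n → e (proj₁ (unpair n)) (proj₂ (unpair n))) , λ z p →
    let i , j , q = c z p
        n , r = unpair-surjective i j
    in n , subst (λ (i , j) → z ≋ e i j) (sym r) q

  Cnt-succ : ∀ {A B x} → Cnt A → (∀ z → z ∊ B → z ∊ A ⊎ z ≋ x) → Cnt B
  Cnt-succ {A} {B} {x} (e , c) h = e′ , λ z p → [ (λ q → let n , r = c z q in 1+ n , r) , (λ r → 0 , r) ]′ (h z p)
    where
    e′ : ℕ → 𝕍
    e′ zero = x
    e′ (1+ n) = e n

  abstract
    Cnt⇒Inj : ∀ {A} → Cnt A → Inj A ω
    Cnt⇒Inj {A} (e , c) =
      let g , g-cong , g-spec = choose A (λ x y → ∃ λ n → y ≋ nat n × x ≋ e n)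
            (λ p q (n , r , s) → n , ≋-sym q ∙ r , ≋-sym p ∙ s)
            (λ x p → let n , q = c x p in nat n , n , ≋-refl , q)
      in record
        { fn = g ; fn-cong = g-cong
        ; maps = λ p → let n , r , _ = g-spec _ p in ∊-ω⁺ n r
        ; injective = λ p q r →
            let n , e₁ , e₂ = g-spec _ p
                m , e₃ , e₄ = g-spec _ q
            in e₂ ∙ subst (λ k → e n ≋ e k) (nat-injective (≋-sym e₁ ∙ r ∙ e₃)) ≋-refl ∙ ≋-sym e₄ }

    Inj⇒Cnt : ∀ {A} → Inj A ω → Cnt A
    Inj⇒Cnt {A} i = (λ n → e n em) , λ z p →
        let n , q = ∊-ω⁻ (maps p) in n , e-spec n z p q em
      where
      open Inj i
      P : ℕ → Set (suc ℓ)
      P n = ∃ λ x → x ∊ A × fn x ≋ nat n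
      e : ∀ n → Dec (P n) → 𝕍
      e n (yes (x , _)) = x
      e n (no _) = ∅
      e-spec : ∀ n z → z ∊ A → fn z ≋ nat n → (d : Dec (P n)) → z ≋ e n d
      e-spec n z p q (yes (x , r , s)) = injective p r (q ∙ ≋-sym s)
      e-spec n z p q (no h) = ⊥-elim (h (z , p , q))

  Cnt-Inj : ∀ {A B} → Inj A B → Cnt B → Cnt A
  Cnt-Inj i c = Inj⇒Cnt (Inj-trans i (Cnt⇒Inj c))

  -- Successor cardinals and ω₁

  SuccCard : 𝕍 → 𝕍 → Set (suc ℓ)
  SuccCard μ ν = Card ν × μ ∊ ν × (∀ {γ} → Card γ → μ ∊ γ → ν ⊑ γ)

  IsSuccessorCardinal⇒SuccCard : ∀ {μ ν} → IsSuccessorCardinal μ ν → SuccCard μ ν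
  IsSuccessorCardinal⇒SuccCard (c , p , m) =
    IsCardinal⇒Card c , ∈⇒∊ p , λ c′ q → ⊆⇒⊑ (m _ (Card⇒IsCardinal c′) (∊⇒∈ q))

  IsAleph⇒SuccCard : ∀ {ω₁} → IsAleph 1 ω₁ → SuccCard ω ω₁
  IsAleph⇒SuccCard (y , lift e , s) =
    let c , p , m = IsSuccessorCardinal⇒SuccCard s
    in c , ∊-≋ˡ (≈⇒≋ e) p , λ c′ q → m c′ (∊-≋ˡ (≋-sym (≈⇒≋ e)) q)

  module _ {μ ν : 𝕍} (μ-ord : Ord μ) (s : SuccCard μ ν) where
    private
      ν-card = proj₁ s
      ν-ord = proj₁ (proj₁ s)
      μ∊ν = proj₁ (proj₂ s)

    below-succ : ∀ {α} → α ∊ ν → Inj α μ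
    below-succ {α} p = let γ , c , b = cardinality α in case ∊⊎⊒ μ-ord (proj₁ c) of λ where
      (inj₁ q) → ⊥-elim (Card-¬Inj ν-card p (Inj-trans (Inj-⊑ (proj₂ (proj₂ s) c q)) (Bij.inj b)))
      (inj₂ q) → Inj-trans (Bij.inj (Bij-sym b)) (Inj-⊑ q)

    ¬Inj⇒Inj-below : ∀ {A} → ¬ Inj ν A → Inj A μ
    ¬Inj⇒Inj-below h = let α , p , _ , b = small-cardinality ν-ord h
                       in Inj-trans (Bij.inj (Bij-sym b)) (below-succ p)

    Inj-below⇒¬Inj : ∀ {A} → Inj A μ → ¬ Inj ν A
    Inj-below⇒¬Inj i j = Card-¬Inj ν-card μ∊ν (Inj-trans j i)

  module FirstUncountable {ω₁ : 𝕍} (s : SuccCard ω ω₁) where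

    ω₁-card : Card ω₁
    ω₁-card = proj₁ s

    ω₁-ord : Ord ω₁
    ω₁-ord = proj₁ ω₁-card

    ω∊ω₁ : ω ∊ ω₁
    ω∊ω₁ = proj₁ (proj₂ s)

    ¬Cnt-ω₁ : ¬ Cnt ω₁
    ¬Cnt-ω₁ c = Card-¬Inj ω₁-card ω∊ω₁ (Cnt⇒Inj c)

    Cnt-below : ∀ {α} → α ∊ ω₁ → Cnt α
    Cnt-below p = Inj⇒Cnt (below-succ ω-ordinal s p)

    ¬Cnt⇒Inj : ∀ {A} → ¬ Cnt A → Inj ω₁ A
    ¬Cnt⇒Inj h = by-contradiction λ ¬i → h (Inj⇒Cnt (¬Inj⇒Inj-below ω-ordinal s ¬i))

    -- Regularity of ω₁: were `X` cofinal, the points of `X` together with their members would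
    -- exhaust ω₁, a countable union of countable sets. Position 0 of `cover n` holds the point
    -- `e n` itself.
    Cnt-bounded : ∀ {X} → X ⊑ ω₁ → Cnt X → ∃ λ β → β ∊ ω₁ × X ⊑ β
    Cnt-bounded {X} X⊑ω₁ (e , c) = by-contradiction λ ¬bounded →
      ¬Cnt-ω₁ (Cnt-by-pairs (λ n → cover n em) λ z p → covered z p ¬bounded)
      where
      cover : ∀ n → Dec (e n ∊ ω₁) → ℕ → 𝕍
      cover n _ zero = e n
      cover n (yes p) (1+ k) = proj₁ (Cnt-below p) k
      cover n (no _) (1+ k) = ∅
      covers : ∀ n z → z ∊ e n ⊎ z ≋ e n → e n ∊ ω₁ → (d : Dec (e n ∊ ω₁)) → ∃ λ k → z ≋ cover n d k
      covers n z (inj₂ q) _ _ = 0 , q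
      covers n z (inj₁ q) _ (yes p) = let k , r = proj₂ (Cnt-below p) z q in 1+ k , r
      covers n z (inj₁ q) p (no ¬p) = ⊥-elim (¬p p)
      covered : ∀ z → z ∊ ω₁ → ¬ (∃ λ β → β ∊ ω₁ × X ⊑ β) → ∃₂ λ n k → z ≋ cover n em k
      covered z p ¬bounded =
        let x , h = ¬∀⇒∃¬ λ h → ¬bounded (z , p , h)
            x∊X : x ∊ X
            x∊X = by-contradiction λ q → h λ r → ⊥-elim (q r)
            z⊑x : z ⊑ x
            z⊑x = [ (λ q → ⊥-elim (h λ _ → q)) , id ]′ (∊⊎⊒ (Ord-∊ ω₁-ord (X⊑ω₁ x x∊X)) (Ord-∊ ω₁-ord p))
            n , q = c x x∊X
            k , r = covers n z ([ (λ t → inj₁ (∊-≋ʳ q t)) , (λ t → inj₂ (t ∙ q)) ]′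
                      (⊑⇒∊⊎≋ (Ord-∊ ω₁-ord p) (Ord-∊ ω₁-ord (X⊑ω₁ x x∊X)) z⊑x)) (∊-≋ˡ q (X⊑ω₁ x x∊X)) em
        in n , k , r

    -- Enumerating A by always picking an element of least rank reaches every
    -- element before stage ω₁.
    module Ranked {A : 𝕍} (ρ : 𝕍 → 𝕍) (ρ-cong : Congruent ρ) (ρ-maps : ∀ z → z ∊ A → ρ z ∊ ω₁)
      (ρ-small : ∀ m → m ∊ ω₁ → Cnt (Sep A (λ z → ρ z ⊑ m))) where
      private
        choice : Σ (𝕍 → 𝕍) λ g → Congruent g ×
          (∀ X → X ∊ Sep (𝒫 A) Nonempty → g X ∊ X × (∀ z → z ∊ X → ρ (g X) ⊑ ρ z))
        choice = choose (Sep (𝒫 A) Nonempty) (λ X x → x ∊ X × (∀ z → z ∊ X → ρ x ⊑ ρ z))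
          (λ e e′ (p , h) → ∊-≋ˡ e′ (∊-≋ʳ e p) , λ z q w r → h z (≋⇒⊒ e z q) w (≋⇒⊒ (ρ-cong e′) w r))
          (λ X p →
            let X∊ , x , x∊X = ∊-Sep⁻ Nonempty Nonempty-resp p
                X⊑A = ∊-𝒫⁻ X∊
                o = λ z z∊X → Ord-∊ ω₁-ord (ρ-maps z (X⊑A z z∊X))
                β , oβ , (y , y∊X , e) , min = least (λ α → ∃ λ y → y ∊ X × α ≋ ρ y) (o x x∊X) (x , x∊X , ≋-refl)
            in y , y∊X , λ z z∊X w q → [ (λ r → ⊥-elim (min (ρ z) (∊-≋ʳ (≋-sym e) r) (z , z∊X , ≋-refl))) ,
                 (λ h → h w q) ]′ (∊⊎⊒ (o z z∊X) (o y y∊X)))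

        open Enumerate A (proj₁ choice) (proj₁ (proj₂ choice))
          (λ X X⊑A ne → proj₁ (proj₂ (proj₂ choice) X (∊-Sep⁺ Nonempty Nonempty-resp (∊-𝒫⁺ X⊑A) ne)))

        ρ-min : ∀ {ξ z} → z ∊ Rest G[ ξ ] → ρ (G ξ) ⊑ ρ z
        ρ-min {ξ} {z} p w q = proj₂ (proj₂ (proj₂ choice) (Rest G[ ξ ])
          (∊-Sep⁺ Nonempty Nonempty-resp (∊-𝒫⁺ λ _ r → proj₁ (∊-Rest⁻ r)) (z , p))) z p w (≋⇒⊑ (ρ-cong (G-eq ξ)) w q)

        -- `G ω₁` is still available at every stage ξ < ω₁, so `G ξ` has at most its rank; but only
        -- countably many elements have such a rank.
        absurd : ω₁ ∊ length → ⊥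
        absurd p = ¬Cnt-ω₁ (Cnt-Inj i (ρ-small (ρ (G ω₁)) (ρ-maps _ (proj₁ (∊-Rest⁻ top)))))
          where
          top : G ω₁ ∊ Rest G[ ω₁ ]
          top = G-∊-Rest (fresh ω₁ p)
          fr : ∀ ξ → ξ ∊ ω₁ → Fresh ξ
          fr ξ q = fresh ξ (Ord.transitive length-ordinal q p)
          i : Inj ω₁ (Sep A (λ z → ρ z ⊑ ρ (G ω₁)))
          i = record { Inj (G-inj ω₁-ord fr)
            ; maps = λ {ξ} q → ∊-Sep⁺ _ (λ e h w r → h w (≋⇒⊒ (ρ-cong e) w r)) (proj₁ (∊-Rest⁻ (G-∊-Rest (fr ξ q))))
                (ρ-min (Rest-anti (G[]-mono (∊⇒⊑ ω₁-ord q)) _ top)) }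

      ranked : Inj A ω₁
      ranked = Inj-trans (Bij.inj (Bij-sym enumeration))
        (Inj-⊑ ([ (λ p → ⊥-elim (absurd p)) , id ]′ (∊⊎⊒ ω₁-ord length-ordinal)))

    -- This avoids a bijection between ω₁ × ω₁ and ω₁. The rank of `z` is the maximum of the code of
    -- an index ξ with `z ∊ s ξ` and the code of `z` inside `s ξ`. Rank at most `m` leaves countably
    -- many pairs of codes, so `Ranked` applies.
    module Union (I : 𝕍) (s : 𝕍 → 𝕍) (s-cong : Congruent s) (I-small : Inj I ω₁)
      (s-small : ∀ ξ → ξ ∊ I → Inj (s ξ) ω₁) (u : 𝕍) (u⊑ : ∀ z → z ∊ u → ∃ λ ξ → ξ ∊ I × z ∊ s ξ) where
      private
        module d = Inj I-small

        Codes-of : 𝕍 → Class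
        Codes-of ξ g = (∀ z → z ∊ s ξ → ∃ λ y → y ∊ ω₁ × ⟨ z , y ⟩ ∊ g) ×
                      (∀ z z′ y → ⟨ z , y ⟩ ∊ g → ⟨ z′ , y ⟩ ∊ g → z ≋ z′)

        coding : Σ (𝕍 → 𝕍) λ E → Congruent E × (∀ ξ → ξ ∊ I → Codes-of ξ (E ξ))
        coding = choose I Codes-of
          (λ e e′ (h , h′) → (λ z p → let y , q , r = h z (≋⇒⊒ (s-cong e) z p) in y , q , ∊-≋ʳ e′ r) ,
                             (λ z z′ y p q → h′ z z′ y (≋⇒⊒ e′ _ p) (≋⇒⊒ e′ _ q)))
          (λ ξ p → let module i = Inj (s-small ξ p) in Graph i.fn (s ξ) ,
            (λ z q → i.fn z , i.maps q , ∊-Graph⁺ i.fn-cong q ≋-refl) ,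
            (λ z z′ y q r → let q₁ , e = ⟨⟩∊Graph⁻ i.fn-cong q
                                r₁ , e′ = ⟨⟩∊Graph⁻ i.fn-cong r
                            in i.injective q₁ r₁ (≋-sym e ∙ e′)))

        E : 𝕍 → 𝕍
        E = proj₁ coding

        Bounded-by : 𝕍 → Class
        Bounded-by z m = m ∊ ω₁ × ∃₂ λ ξ y → ξ ∊ I × z ∊ s ξ × y ∊ ω₁ × ⟨ z , y ⟩ ∊ E ξ × d.fn ξ ⊑ m × y ⊑ m

        bounding : Σ (𝕍 → 𝕍) λ ρ → Congruent ρ × (∀ z → z ∊ u → Bounded-by z (ρ z))
        bounding = choose u Bounded-by
          (λ e e′ (p , ξ , y , q , r , t , v , h , h′) → ∊-≋ˡ e′ p , ξ , y , q , ∊-≋ˡ e r , t ,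
             ∊-≋ˡ (⟨⟩-cong e ≋-refl) v , (λ w x → ≋⇒⊑ e′ w (h w x)) , (λ w x → ≋⇒⊑ e′ w (h′ w x)))
          (λ z p → let ξ , q , r = u⊑ z p
                       y , t , v = proj₁ (proj₂ (proj₂ coding) ξ q) z r
                   in case ∊⊎⊒ (Ord-∊ ω₁-ord t) (Ord-∊ ω₁-ord (d.maps q)) of λ where
                     (inj₁ y∊d) → d.fn ξ , d.maps q , ξ , y , q , r , t , v , (λ _ → id) , ∊⇒⊑ (Ord-∊ ω₁-ord (d.maps q)) y∊d
                     (inj₂ d⊑y) → y , t , ξ , y , q , r , t , v , d⊑y , (λ _ → id))

        ρ : 𝕍 → 𝕍
        ρ = proj₁ bounding

        ρ-small : ∀ m → m ∊ ω₁ → Cnt (Sep u (λ z → ρ z ⊑ m))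
        ρ-small m m∊ω₁ = Cnt-by-pairs (λ i j → at i j em) covered
          where
          initial : Cnt (Sep ω₁ (λ δ → δ ⊑ m))
          initial = Cnt-succ (Cnt-below m∊ω₁) λ δ p →
            let q , h = ∊-Sep⁻ _ (λ e h w r → h w (≋⇒⊒ e w r)) p
            in ⊑⇒∊⊎≋ (Ord-∊ ω₁-ord q) (Ord-∊ ω₁-ord m∊ω₁) h
          c : ℕ → 𝕍
          c = proj₁ initial
          index : ∀ {δ} → δ ∊ ω₁ → δ ⊑ m → ∃ λ n → δ ≋ c n
          index p h = proj₂ initial _ (∊-Sep⁺ _ (λ e h w r → h w (≋⇒⊒ e w r)) p h)
          Coded : ℕ → ℕ → Class
          Coded i j z = ∃ λ ξ → ξ ∊ I × d.fn ξ ≋ c i × ⟨ z , c j ⟩ ∊ E ξ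
          at : ∀ i j → Dec (∃ (Coded i j)) → 𝕍
          at i j (yes (z , _)) = z
          at i j (no _) = ∅
          unique : ∀ i j z → Coded i j z → ∀ d → z ≋ at i j d
          unique i j z p (no ¬p) = ⊥-elim (¬p (z , p))
          unique i j z (ξ , q , e , t) (yes (z′ , ξ′ , q′ , e′ , t′)) =
            let ξ≋ξ′ = d.injective q q′ (e ∙ ≋-sym e′)
            in proj₂ (proj₂ (proj₂ coding) ξ′ q′) z z′ (c j) (∊-≋ʳ (proj₁ (proj₂ coding) ξ≋ξ′) t) t′
          covered : ∀ z → z ∊ Sep u (λ z → ρ z ⊑ m) → ∃₂ λ i j → z ≋ at i j em
          covered z p =
            let z∊u , h = ∊-Sep⁻ _ (λ e h w r → h w (≋⇒⊒ (proj₁ (proj₂ bounding) e) w r)) p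
                _ , ξ , y , q , r , t , v , h₁ , h₂ = proj₂ (proj₂ bounding) z z∊u
                i , e = index (d.maps q) (λ w x → h w (h₁ w x))
                j , e′ = index t (λ w x → h w (h₂ w x))
            in i , j , unique i j z (ξ , q , e , ∊-≋ˡ (⟨⟩-cong ≋-refl e′) v) em

      union-small : Inj u ω₁
      union-small = Ranked.ranked ρ (proj₁ (proj₂ bounding)) (λ z p → proj₁ (proj₂ (proj₂ bounding) z p)) ρ-small

    Cnt⇒Inj-ω₁ : ∀ {A} → Cnt A → Inj A ω₁
    Cnt⇒Inj-ω₁ c = Inj-trans (Cnt⇒Inj c) (Inj-⊑ (∊⇒⊑ ω₁-ord ω∊ω₁))

    ∪-small : ∀ {A B} → Inj A ω₁ → Inj B ω₁ → Inj (A ∪ B) ω₁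
    ∪-small {A} {B} i j = Union.union-small (pair A B) id id
      (Cnt⇒Inj-ω₁ (Cnt-succ {A = singleton A} ((λ _ → A) , λ z p → 0 , ∊-singleton⁻ p)
        λ z p → [ (λ e → inj₁ (∊-pairˡ e)) , inj₂ ]′ (∊-pair⁻ p)))
      (λ ξ p → [ (λ e → Inj-trans (Inj-⊑ (≋⇒⊑ e)) i) , (λ e → Inj-trans (Inj-⊑ (≋⇒⊑ e)) j) ]′ (∊-pair⁻ p))
      (A ∪ B) (λ z p → [ (λ q → A , ∊-pairˡ ≋-refl , q) , (λ q → B , ∊-pairʳ ≋-refl , q) ]′ (∊-∪⁻ p))

  -- A large regular cardinal θ and H(θ)

  Trans : Class
  Trans t = ∀ {x y} → x ∊ y → y ∊ t → x ∊ t

  trcl : 𝕍 → 𝕍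
  trcl (sup I f) = sup (Σ I λ i → Maybe (Index (trcl (f i)))) λ (i , m) → maybe′ (elem (trcl (f i))) (f i) m

  ⊑-trcl : ∀ {x} → x ⊑ trcl x
  ⊑-trcl {sup I f} z p = let i , e = sup-∊⁻ p in sup-∊⁺ (i , nothing) e

  trcl-transitive : ∀ {x} → Trans (trcl x)
  trcl-transitive {sup I f} {x} {y} p q = let (i , m) , e = sup-∊⁻ q in go i m e
    where
    go : ∀ i m → y ≋ maybe′ (elem (trcl (f i))) (f i) m → x ∊ trcl (sup I f)
    go i nothing e = let j , e′ = ∊⇒elem (⊑-trcl _ (∊-≋ʳ e p)) in sup-∊⁺ (i , just j) e′
    go i (just j) e = let k , e′ = ∊⇒elem (trcl-transitive {f i} (∊-≋ʳ e p) (elem-∊ (trcl (f i)) j))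
                      in sup-∊⁺ (i , just k) e′

  module Large (T₀ : 𝕍) (succω⊑T₀ : succ ω ⊑ T₀) where

    abstract
      tag : Bool → 𝕍
      tag false = nat 0
      tag true = nat 1

      tag-injective : ∀ {b b′} → tag b ≋ tag b′ → b ≡ b′
      tag-injective {false} {false} e = refl
      tag-injective {true} {true} e = refl
      tag-injective {false} {true} e with () ← nat-injective {0} {1} e
      tag-injective {true} {false} e with () ← nat-injective {1} {0} e

    wrap : List Bool → 𝕍 → 𝕍
    wrap [] x = x
    wrap (b ∷ₗ bs) x = ⟨ tag b , wrap bs x ⟩

    abstract
      -- Closing `T₀` under two tags lets `T` contain two disjoint copies of itself. Hence `code`
      -- turns a pair of subsets of `T` into one subset of `T`, and `𝒫 T` absorbs its square without
      -- cardinal arithmetic.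
      T : 𝕍
      T = sup (List Bool × Index T₀) λ (bs , i) → wrap bs (elem T₀ i)

      T₀⊑T : T₀ ⊑ T
      T₀⊑T z p = let i , e = ∊⇒elem p in sup-∊⁺ ([] , i) e

      T-closed : ∀ b {t} → t ∊ T → ⟨ tag b , t ⟩ ∊ T
      T-closed b p = let (bs , i) , e = sup-∊⁻ p in sup-∊⁺ (b ∷ₗ bs , i) (⟨⟩-cong ≋-refl e)

    S : 𝕍
    S = 𝒫 T

    ∅∊S : ∅ ∊ S
    ∅∊S = ∊-𝒫⁺ λ { _ (∈⇒∊ ()) }

    T∊S : T ∊ S
    T∊S = ∊-𝒫⁺ λ _ p → p

    T≉∅ : ¬ (∅ ≋ T)
    T≉∅ e with ∊-≋ʳ (≋-sym e) (T₀⊑T _ (succω⊑T₀ _ ∊-succʳ))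
    ... | ∈⇒∊ ()

    code : 𝕍 → 𝕍 → 𝕍
    code X Y = Image ⟨ tag false ,_⟩ X ∪ Image ⟨ tag true ,_⟩ Y

    tagged : ∀ {b} → Congruent ⟨ tag b ,_⟩
    tagged = ⟨⟩-cong ≋-refl

    code-cong : ∀ {X X′ Y Y′} → X ≋ X′ → Y ≋ Y′ → code X Y ≋ code X′ Y′
    code-cong e e′ = ≋-ext (half e e′) (half (≋-sym e) (≋-sym e′))
      where
      half : ∀ {X X′ Y Y′} → X ≋ X′ → Y ≋ Y′ → code X Y ⊑ code X′ Y′
      half e e′ z p = case ∊-∪⁻ p of λ where
        (inj₁ q) → let x , r , e₁ = ∊-Image⁻ q in ∊-∪ˡ (∊-Image⁺ tagged (∊-≋ʳ e r) e₁)
        (inj₂ q) → let x , r , e₁ = ∊-Image⁻ q in ∊-∪ʳ (∊-Image⁺ tagged (∊-≋ʳ e′ r) e₁)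

    code-∊ : ∀ {X Y} → X ∊ S → Y ∊ S → code X Y ∊ S
    code-∊ p q = ∊-𝒫⁺ λ z r → case ∊-∪⁻ r of λ where
      (inj₁ t) → let x , u , e = ∊-Image⁻ t in ∊-≋ˡ (≋-sym e) (T-closed false (∊-𝒫⁻ p x u))
      (inj₂ t) → let x , u , e = ∊-Image⁻ t in ∊-≋ˡ (≋-sym e) (T-closed true (∊-𝒫⁻ q x u))

    code-injectiveˡ : ∀ {X X′ Y Y′} → code X Y ≋ code X′ Y′ → X ≋ X′
    code-injectiveˡ e = ≋-ext (half e) (half (≋-sym e))
      where
      half : ∀ {X X′ Y Y′} → code X Y ≋ code X′ Y′ → X ⊑ X′
      half e z p = case ∊-∪⁻ (∊-≋ʳ e (∊-∪ˡ (∊-Image⁺ tagged p ≋-refl))) of λ where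
        (inj₁ q) → let x , r , e′ = ∊-Image⁻ q in ∊-≋ˡ (≋-sym (⟨⟩-injectiveʳ e′)) r
        (inj₂ q) → let x , r , e′ = ∊-Image⁻ q in case tag-injective (⟨⟩-injectiveˡ e′) of λ ()

    code-injectiveʳ : ∀ {X X′ Y Y′} → code X Y ≋ code X′ Y′ → Y ≋ Y′
    code-injectiveʳ e = ≋-ext (half e) (half (≋-sym e))
      where
      half : ∀ {X X′ Y Y′} → code X Y ≋ code X′ Y′ → Y ⊑ Y′
      half e z p = case ∊-∪⁻ (∊-≋ʳ e (∊-∪ʳ (∊-Image⁺ tagged p ≋-refl))) of λ where
        (inj₁ q) → let x , r , e′ = ∊-Image⁻ q in case tag-injective (⟨⟩-injectiveˡ e′) of λ ()
        (inj₂ q) → let x , r , e′ = ∊-Image⁻ q in ∊-≋ˡ (≋-sym (⟨⟩-injectiveʳ e′)) r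

    T₀-small : Inj T₀ S
    T₀-small = record
      { fn = singleton ; fn-cong = λ e → pair-cong e e
      ; maps = λ p → ∊-𝒫⁺ λ z q → ∊-≋ˡ (≋-sym (∊-singleton⁻ q)) (T₀⊑T _ p)
      ; injective = λ _ _ e → ∊-singleton⁻ (∊-≋ʳ e (∊-pairˡ ≋-refl)) }

    -- The successor cardinal of |S|; its regularity rests on the embedding `code` of pairs from `S`
    -- into `S`.
    θ : 𝕍
    θ = Hartogs S

    θ-ord : Ord θ
    θ-ord = Hartogs-ordinal S

    -- For η in θ this is η + 1.
    upto : 𝕍 → 𝕍
    upto η = Sep θ (λ δ → δ ⊑ η)

    ∊-upto⁻ : ∀ {η δ} → δ ∊ upto η → δ ∊ θ × δ ⊑ η
    ∊-upto⁻ = ∊-Sep⁻ _ λ e h w r → h w (≋⇒⊒ e w r)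

    ∊-upto⁺ : ∀ {η δ} → δ ∊ θ → δ ⊑ η → δ ∊ upto η
    ∊-upto⁺ = ∊-Sep⁺ _ λ e h w r → h w (≋⇒⊒ e w r)

    -- Points of η keep their code, with second component ∅; the one new point η receives
    -- `code ∅ T`, which differs from all of these because `T` is nonempty.
    upto-small : ∀ {η} → η ∊ θ → Inj (upto η) S
    upto-small {η} η∊θ = record
      { fn = h
      ; fn-cong = cases-cong (_∊ η) F G ∊-≋ˡ (λ _ e → code-cong (fn-cong e) ≋-refl) (λ _ _ → ≋-refl)
      ; maps = λ {x} p → case em {x ∊ η} of λ where
          (yes q) → ∊-≋ˡ (≋-sym (h-yes q)) (code-∊ (maps q) ∅∊S)
          (no q) → ∊-≋ˡ (≋-sym (h-no q)) (code-∊ ∅∊S T∊S)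
      ; injective = λ {x} {y} p q e → case em {x ∊ η} of λ where
          (yes r) → case em {y ∊ η} of λ where
            (yes t) → injective r t (code-injectiveˡ (≋-sym (h-yes r) ∙ e ∙ h-yes t))
            (no t) → ⊥-elim (T≉∅ (code-injectiveʳ (≋-sym (h-yes r) ∙ e ∙ h-no t)))
          (no r) → case em {y ∊ η} of λ where
            (yes t) → ⊥-elim (T≉∅ (code-injectiveʳ (≋-sym (h-yes t) ∙ ≋-sym e ∙ h-no r)))
            (no t) → top p r ∙ ≋-sym (top q t) }
      where
      open Inj (proj₂ (∊-Hartogs⁻ η∊θ))
      F G h : 𝕍 → 𝕍
      F x = code (fn x) ∅
      G x = code ∅ T
      h = cases (_∊ η) F G
      h-yes : ∀ {x} → x ∊ η → h x ≋ F x
      h-yes = cases-yes (_∊ η) F G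
      h-no : ∀ {x} → ¬ x ∊ η → h x ≋ G x
      h-no = cases-no (_∊ η) F G
      top : ∀ {x} → x ∊ upto η → ¬ x ∊ η → x ≋ η
      top p ¬q = let x∊θ , x⊑η = ∊-upto⁻ p in
        [ (λ q → ⊥-elim (¬q q)) , id ]′ (⊑⇒∊⊎≋ (Ord-∊ θ-ord x∊θ) (Ord-∊ θ-ord η∊θ) x⊑η)

    -- β is the supremum of the ordinals `g ξ + 1`. An element δ of β is coded by a pair: the code
    -- of some ξ with `δ ≤ g ξ`, and the code of δ within `g ξ + 1`. So β injects into `S` and lies
    -- below θ.
    bounded : ∀ {α} (g : 𝕍 → 𝕍) → Congruent g → α ∊ θ → (∀ ξ → ξ ∊ α → g ξ ∊ θ) →
      ∃ λ β → β ∊ θ × (∀ ξ → ξ ∊ α → g ξ ∊ β)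
    bounded {α} g g-cong α∊θ g-maps = β , ∊-Hartogs⁺ β-ord β-small ,
        λ ξ p → ∊-Sep⁺ _ β-resp (g-maps ξ p) (ξ , p , λ _ q → q)
      where
      Below-some : Class
      Below-some δ = ∃ λ ξ → ξ ∊ α × δ ⊑ g ξ
      β-resp : Resp Below-some
      β-resp e (ξ , p , h) = ξ , p , λ w q → h w (≋⇒⊒ e w q)
      β : 𝕍
      β = Sep θ Below-some
      β-ord : Ord β
      β-ord = record
        { transitive = λ p q →
            let y∊θ , ξ , r , h = ∊-Sep⁻ _ β-resp q
            in ∊-Sep⁺ _ β-resp (Ord.transitive θ-ord p y∊θ) (ξ , r , λ w t → h w (Ord.transitive (Ord-∊ θ-ord y∊θ) t p))
        ; linear = λ p q → Ord.linear θ-ord (proj₁ (∊-Sep⁻ _ β-resp p)) (proj₁ (∊-Sep⁻ _ β-resp q)) }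
      Codes-of : 𝕍 → Class
      Codes-of ξ h = (∀ δ → δ ∊ upto (g ξ) → ∃ λ y → y ∊ S × ⟨ δ , y ⟩ ∊ h) ×
                     (∀ δ δ′ y → ⟨ δ , y ⟩ ∊ h → ⟨ δ′ , y ⟩ ∊ h → δ ≋ δ′)
      coding : Σ (𝕍 → 𝕍) λ E → Congruent E × (∀ ξ → ξ ∊ α → Codes-of ξ (E ξ))
      coding = choose α Codes-of
        (λ e e′ (h , h′) →
          (λ δ p → let q , r = ∊-upto⁻ p
                       y , t , v = h δ (∊-upto⁺ q (λ w x → ≋⇒⊒ (g-cong e) w (r w x)))
                   in y , t , ∊-≋ʳ e′ v) ,
          (λ δ δ′ y p q → h′ δ δ′ y (≋⇒⊒ e′ _ p) (≋⇒⊒ e′ _ q)))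
        (λ ξ p → let module i = Inj (upto-small (g-maps ξ p)) in Graph i.fn (upto (g ξ)) ,
          (λ z q → i.fn z , i.maps q , ∊-Graph⁺ i.fn-cong q ≋-refl) ,
          (λ z z′ y q r → let q₁ , e = ⟨⟩∊Graph⁻ i.fn-cong q
                              r₁ , e′ = ⟨⟩∊Graph⁻ i.fn-cong r
                          in i.injective q₁ r₁ (≋-sym e ∙ e′)))
      E : 𝕍 → 𝕍
      E = proj₁ coding
      module d = Inj (proj₂ (∊-Hartogs⁻ α∊θ))
      Code : 𝕍 → Class
      Code δ c = ∃₂ λ ξ y → ξ ∊ α × y ∊ S × ⟨ δ , y ⟩ ∊ E ξ × c ≋ code (d.fn ξ) y
      encode : Σ (𝕍 → 𝕍) λ c → Congruent c × (∀ δ → δ ∊ β → Code δ (c δ))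
      encode = choose β Code
        (λ e e′ (ξ , y , p , q , r , t) → ξ , y , p , q , ∊-≋ˡ (⟨⟩-cong e ≋-refl) r , ≋-sym e′ ∙ t)
        (λ δ p → let δ∊θ , ξ , q , h = ∊-Sep⁻ _ β-resp p
                     y , r , t = proj₁ (proj₂ (proj₂ coding) ξ q) δ (∊-upto⁺ δ∊θ h)
                 in code (d.fn ξ) y , ξ , y , q , r , t , ≋-refl)
      β-small : Inj β S
      β-small = record
        { fn = proj₁ encode ; fn-cong = proj₁ (proj₂ encode)
        ; maps = λ p → let ξ , y , q , r , _ , e = proj₂ (proj₂ encode) _ p in ∊-≋ˡ (≋-sym e) (code-∊ (d.maps q) r)
        ; injective = λ p q e →
            let ξ , y , p₁ , _ , p₂ , e₁ = proj₂ (proj₂ encode) _ p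
                ξ′ , y′ , q₁ , _ , q₂ , e₂ = proj₂ (proj₂ encode) _ q
                e₃ = ≋-sym e₁ ∙ e ∙ e₂
                ξ≋ξ′ = d.injective p₁ q₁ (code-injectiveˡ e₃)
            in proj₂ (proj₂ (proj₂ coding) ξ′ q₁) _ _ y′
                 (∊-≋ʳ (proj₁ (proj₂ coding) ξ≋ξ′) (∊-≋ˡ (⟨⟩-cong ≋-refl (code-injectiveʳ e₃)) p₂)) q₂ }

    θ-regular : IsRegular θ
    θ-regular =
      Card⇒IsCardinal (θ-ord , λ α p b → ¬Inj-Hartogs S (Inj-trans (Bij.inj (Bij-sym b)) (proj₂ (∊-Hartogs⁻ p)))) ,
      (λ z p → ∊⇒∈ (∊-Hartogs⁺ (Ord-∊ ω-ordinal (∈⇒∊ p))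
        (Inj-trans (Inj-⊑ (λ w q → succω⊑T₀ w (∊-succˡ (Ord.transitive ω-ordinal q (∈⇒∊ p))))) T₀-small))) ,
      λ α f p f-fun → let module f = Function f-fun
                          β , q , h = bounded (app f) f.app-cong (∈⇒∊ p) f.app-maps
                      in β , ∊⇒∈ q , λ ξ η r → ∊⇒∈ (∊-≋ˡ (≋-sym (f.app-unique (⟪⟫∈⇒⟨⟩∊ r))) (h ξ (f.domain (⟪⟫∈⇒⟨⟩∊ r))))

    Inj⇒≺θ : ∀ {t} → Inj t S → t ≺ θ
    Inj⇒≺θ i =
      let γ , o , b = zermelo S
          γ∊θ = ∊-Hartogs⁺ o (Bij.inj b)
      in Inj⇒≼ (Inj-trans i (Inj-trans (Bij.inj (Bij-sym b)) (Inj-⊑ (∊⇒⊑ θ-ord γ∊θ)))) ,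
         λ j → ¬Inj-Hartogs S (Inj-trans (≼⇒Inj j) i)

    HasSmallClosure : Class
    HasSmallClosure x = ∃ λ t → IsTransitiveClosure x t × t ≺ θ

    HasSmallClosure-resp : Resp HasSmallClosure
    HasSmallClosure-resp e (t , (h₁ , h₂ , h₃) , s) = t ,
      (⊑⇒⊆ (λ w p → ⊆⇒⊑ h₁ w (≋⇒⊒ e w p)) , h₂ , λ s h → h₃ s (⊑⇒⊆ λ w p → ⊆⇒⊑ h w (≋⇒⊑ e w p))) , s

    abstract
      H : 𝕍
      H = Sep (𝒫 (Codes θ)) HasSmallClosure

      ∊-H⁻ : ∀ {x} → x ∊ H → HasSmallClosure x
      ∊-H⁻ p = proj₂ (∊-Sep⁻ _ HasSmallClosure-resp p)

      ∊-H⁺ : ∀ {x} → HasSmallClosure x → x ∊ H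
      ∊-H⁺ h@(t , (h₁ , h₂ , h₃) , s) = ∊-Sep⁺ _ HasSmallClosure-resp
        (∊-𝒫⁺ λ z p → ∊-Codes (λ q r → ∈⇒∊ (h₂ _ (∊⇒∈ r) _ (∊⇒∈ q))) (≼⇒Inj (proj₁ s)) (⊆⇒⊑ h₁ z p)) h

    isH : IsH θ H
    isH x = mk⇔ (λ p → ∊-H⁻ (∈⇒∊ p)) (λ h → ∊⇒∈ (∊-H⁺ h))

    ⊑⇒HasSmallClosure : ∀ {x t} → Trans t → t ≺ θ → x ⊑ t → HasSmallClosure x
    ⊑⇒HasSmallClosure {x} {t} t-trans s x⊑t = t′ ,
        (⊑⇒⊆ (λ z p → ∊-Sep⁺ P P-resp (x⊑t z p) λ s _ h → h z p) ,
         (λ y p z q → let p₁ , p₂ = ∊-Sep⁻ P P-resp (∈⇒∊ p)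
                      in ∊⇒∈ (∊-Sep⁺ P P-resp (t-trans (∈⇒∊ q) p₁) λ s tr h → tr (∈⇒∊ q) (p₂ s tr h))) ,
         λ s h tr z p → ∊⇒∈ (proj₂ (∊-Sep⁻ P P-resp (∈⇒∊ p)) s (λ q r → ∈⇒∊ (tr _ (∊⇒∈ r) _ (∊⇒∈ q))) (⊆⇒⊑ h))) ,
        Inj⇒≼ (Inj-trans t′⊑t (≼⇒Inj (proj₁ s))) ,
        λ i → proj₂ s (Inj⇒≼ (Inj-trans (≼⇒Inj i) t′⊑t))
      where
      P : Class
      P z = ∀ s → Trans s → x ⊑ s → z ∊ s
      P-resp : Resp P
      P-resp e h s tr q = ∊-≋ˡ e (h s tr q)
      t′ : 𝕍
      t′ = Sep t P
      t′⊑t : Inj t′ t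
      t′⊑t = Inj-⊑ λ z p → proj₁ (∊-Sep⁻ P P-resp p)

    private
      closure-trans : ∀ {t} → Transitive t → Trans t
      closure-trans h p q = ∈⇒∊ (h _ (∊⇒∈ q) _ (∊⇒∈ p))

    H-transitive : Trans H
    H-transitive p q = let t , (h₁ , h₂ , _) , s = ∊-H⁻ q
                       in ∊-H⁺ (⊑⇒HasSmallClosure (closure-trans h₂) s λ z r → closure-trans h₂ r (⊆⇒⊑ h₁ _ p))

    H-⊑ : ∀ {x y} → x ⊑ y → y ∊ H → x ∊ H
    H-⊑ h q = let t , (h₁ , h₂ , _) , s = ∊-H⁻ q
              in ∊-H⁺ (⊑⇒HasSmallClosure (closure-trans h₂) s λ z r → ⊆⇒⊑ h₁ z (h z r))

    H-⊒ : ∀ {t} → Trans t → t ⊑ T₀ → t ⊑ H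
    H-⊒ t-trans h z p = ∊-H⁺ (⊑⇒HasSmallClosure t-trans (Inj⇒≺θ (Inj-trans (Inj-⊑ h) T₀-small)) λ w q → t-trans q p)

  -- Elementary submodels

  ∃′_ : ∀ {n} → Formula (1+ n) → Formula n
  ∃′ φ = ¬′ (∀′ (¬′ φ))

  infixr 5 _∷ᵥ_

  _∷ᵥ_ : ∀ {n} → 𝕍 → Vector 𝕍 n → Vector 𝕍 (1+ n)
  _∷ᵥ_ = _∷_

  All∊ : ∀ {n} → 𝕍 → Vector 𝕍 n → Set ℓ
  All∊ M ρ = ∀ i → ρ i ∈ M

  []∊ : ∀ {M} → All∊ M []ᵥ
  []∊ ()

  _∷∊_ : ∀ {M n x} {ρ : Vector 𝕍 n} → x ∊ M → All∊ M ρ → All∊ M (x ∷ᵥ ρ)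
  (p ∷∊ ps) fzero = ∊⇒∈ p
  (p ∷∊ ps) (fsuc i) = ps i

  infixr 5 _∷∊_

  module Elementary {M H : 𝕍} (M≺H : IsElementarySubmodel M H) (H-transitive : Trans H) where

    M⊑H : M ⊑ H
    M⊑H = ⊆⇒⊑ (proj₁ M≺H)

    -- Elementarity is used twice: downwards for the existential statement, then upwards for `φ` at
    -- the witness found in `M`.
    tarski-vaught : ∀ {n} (φ : Formula (1+ n)) {ρ : Vector 𝕍 n} {x} → All∊ M ρ → x ∊ H →
      Satisfies H φ (x ∷ᵥ ρ) → ∃ λ y → y ∊ M × Satisfies H φ (y ∷ᵥ ρ)
    tarski-vaught φ {ρ} ρ∊M x∊H sat =
      let inM = Equivalence.from (proj₂ M≺H (∃′ φ) ρ ρ∊M) (λ h → h _ (∊⇒∈ x∊H) sat)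
          y , h = ¬∀⇒∃¬ inM
          y∊M = by-contradiction λ y∉M → h λ y∈M _ → y∉M (∈⇒∊ y∈M)
          satM = by-contradiction λ ¬sat → h λ _ s → ¬sat s
      in y , y∊M , Equivalence.to (proj₂ M≺H φ (y ∷ᵥ ρ) (y∊M ∷∊ ρ∊M)) satM

    definable : ∀ {n} (φ : Formula (1+ n)) {ρ : Vector 𝕍 n} {x} → All∊ M ρ → x ∊ H → Satisfies H φ (x ∷ᵥ ρ) →
      (∀ {y} → y ∊ H → Satisfies H φ (y ∷ᵥ ρ) → y ≋ x) → x ∊ M
    definable φ ρ∊M x∊H sat unique =
      let y , y∊M , s = tarski-vaught φ ρ∊M x∊H sat in ∊-≋ˡ (unique (M⊑H y y∊M) s) y∊M

    private
      v₀ : ∀ {n} → Fin (1+ n)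
      v₀ = fzero
      v₁ : ∀ {n} → Fin (2 + n)
      v₁ = fsuc fzero
      v₂ : ∀ {n} → Fin (3 + n)
      v₂ = fsuc (fsuc fzero)
      v₃ : ∀ {n} → Fin (4 + n)
      v₃ = fsuc (fsuc (fsuc fzero))

    ∩-closed : ∀ {x y z} → x ∊ M → y ∊ M → z ∊ H → (∀ w → w ∊ z → w ∊ x × w ∊ y) →
      (∀ w → w ∊ x → w ∊ y → w ∊ z) → z ∊ M
    ∩-closed p q r h h′ = definable
      -- Implication is spelled as `¬′ (a ∧′ ¬′ b)`. Under the quantifier `v₀` is the bound element,
      -- `v₁` the set being defined, and `v₂`, `v₃` are the parameters. As `H` is transitive, its
      -- quantifiers see all members.
      ((∀′ (¬′ ((v₀ ∈′ v₁) ∧′ (¬′ ((v₀ ∈′ v₂) ∧′ (v₀ ∈′ v₃)))))) ∧′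
       (∀′ (¬′ (((v₀ ∈′ v₂) ∧′ (v₀ ∈′ v₃)) ∧′ (¬′ (v₀ ∈′ v₁))))))
      (p ∷∊ q ∷∊ []∊) r
      ((λ w _ (lift w∈z , n) → let a , b = h w (∈⇒∊ w∈z) in n (lift (∊⇒∈ a) , lift (∊⇒∈ b))) ,
       (λ w _ ((lift a , lift b) , n) → n (lift (∊⇒∈ (h′ w (∈⇒∊ a) (∈⇒∊ b))))))
      (λ y∊H (s , s′) → ≋-ext
        (λ w w∊y → by-contradiction λ w∉z → s w (∊⇒∈ (H-transitive w∊y y∊H))
          (lift (∊⇒∈ w∊y) , λ (lift a , lift b) → w∉z (h′ w (∈⇒∊ a) (∈⇒∊ b))))
        (λ w w∊z → by-contradiction λ w∉y → let a , b = h w w∊z in s′ w (∊⇒∈ (H-transitive w∊z r))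
          ((lift (∊⇒∈ a) , lift (∊⇒∈ b)) , λ (lift c) → w∉y (∈⇒∊ c))))

    adjoin-closed : ∀ {x y z} → x ∊ M → y ∊ M → z ∊ H → (∀ w → w ∊ z → w ∊ x ⊎ w ≋ y) →
      x ⊑ z → y ∊ z → z ∊ M
    adjoin-closed p q r h x⊑z y∊z = definable
      -- The first clause is a disjunction written by De Morgan. The last conjunct stands outside
      -- the quantifiers, so there `v₀` is the candidate set and `v₂` the adjoined element.
      ((∀′ (¬′ ((v₀ ∈′ v₁) ∧′ ((¬′ (v₀ ∈′ v₂)) ∧′ (¬′ (v₀ ≈′ v₃)))))) ∧′
       ((∀′ (¬′ ((v₀ ∈′ v₂) ∧′ (¬′ (v₀ ∈′ v₁))))) ∧′ (v₂ ∈′ v₀)))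
      (p ∷∊ q ∷∊ []∊) r
      ((λ w _ (lift w∈z , n , n′) → [ (λ a → n (lift (∊⇒∈ a))) , (λ e → n′ (lift (≋⇒≈ e))) ]′ (h w (∈⇒∊ w∈z))) ,
       (λ w _ (lift a , n) → n (lift (∊⇒∈ (x⊑z w (∈⇒∊ a))))) , lift (∊⇒∈ y∊z))
      (λ {u} u∊H (s , s′ , lift y∈u) → ≋-ext
        (λ w w∊u → by-contradiction λ w∉z → s w (∊⇒∈ (H-transitive w∊u u∊H))
          (lift (∊⇒∈ w∊u) , (λ (lift a) → w∉z (x⊑z w (∈⇒∊ a))) , λ (lift e) → w∉z (∊-≋ˡ (≋-sym (≈⇒≋ e)) y∊z)))
        (λ w w∊z → by-contradiction λ w∉u → [
            (λ a → s′ w (∊⇒∈ (H-transitive w∊z r)) (lift (∊⇒∈ a) , λ (lift c) → w∉u (∈⇒∊ c))) ,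
            (λ e → w∉u (∊-≋ˡ (≋-sym e) (∈⇒∊ y∈u))) ]′ (h w w∊z)))

    -- The pair ⟨ x , F x ⟩ is the only member of the graph all of whose
    -- members contain x; unless F x ≋ x, F x is the only other member of a
    -- member of that pair.
    apply : ∀ {F} → Congruent F → ∀ {A x} → Graph F A ∊ M → x ∊ M → x ∊ A → F x ∊ M
    apply {F} F-cong {A} {x} g p x∊A = case em {F x ≋ x} of λ where
        (yes e) → ∊-≋ˡ (≋-sym e) p
        (no Fx≉x) → definable
          ((∃′ ((v₀ ∈′ v₂) ∧′ (v₁ ∈′ v₀))) ∧′ (¬′ (v₀ ≈′ v₂)))
          (pair∊M ∷∊ p ∷∊ []∊) (H-transitive (∊-pairʳ ≋-refl) (H-transitive ∊-⟨⟩⁺ʳ pair∊H))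
          ((λ h → h (pair x (F x)) (∊⇒∈ (H-transitive ∊-⟨⟩⁺ʳ pair∊H))
              (lift (∊⇒∈ (∊-⟨⟩⁺ʳ {x} {F x})) , lift (∊⇒∈ (∊-pairʳ {x} {F x} ≋-refl)))) ,
           λ (lift e) → Fx≉x (≈⇒≋ e))
          (λ {y} y∊H (s , s′) → let v , h = ¬∀⇒∃¬ s in by-contradiction λ y≉Fx → h λ v∈H (lift a , lift b) →
            case ∊-⟨⟩⁻ (∈⇒∊ a) of λ where
              (inj₁ e) → s′ (lift (≋⇒≈ (∊-singleton⁻ (∊-≋ʳ e (∈⇒∊ b)))))
              (inj₂ e) → [ (λ e′ → s′ (lift (≋⇒≈ e′))) , y≉Fx ]′ (∊-pair⁻ (∊-≋ʳ e (∈⇒∊ b))))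
      where
      pair∊Graph : ⟨ x , F x ⟩ ∊ Graph F A
      pair∊Graph = ∊-Graph⁺ F-cong x∊A ≋-refl
      pair∊H : ⟨ x , F x ⟩ ∊ H
      pair∊H = H-transitive pair∊Graph (M⊑H _ g)
      pair∊M : ⟨ x , F x ⟩ ∊ M
      pair∊M = definable
        ((v₀ ∈′ v₁) ∧′ (∀′ (¬′ ((v₀ ∈′ v₁) ∧′ (¬′ (v₃ ∈′ v₀))))))
        (g ∷∊ p ∷∊ []∊) pair∊H
        (lift (∊⇒∈ pair∊Graph) , λ v _ (lift a , n) → n (lift (∊⇒∈ (case ∊-⟨⟩⁻ (∈⇒∊ a) of λ where
          (inj₁ e) → ∊-≋ʳ (≋-sym e) (∊-pairˡ ≋-refl)
          (inj₂ e) → ∊-≋ʳ (≋-sym e) (∊-pairˡ ≋-refl)))))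
        (λ {q} q∊H (lift q∈ , s) →
          let x′ , _ , e = ∊-Graph⁻ (∈⇒∊ q∈)
              x∊ : x ∊ singleton x′
              x∊ = by-contradiction λ n → s (singleton x′)
                (∊⇒∈ (H-transitive (∊-≋ʳ (≋-sym e) ∊-⟨⟩⁺ˡ) q∊H))
                (lift (∊⇒∈ (∊-≋ʳ (≋-sym e) (∊-⟨⟩⁺ˡ {x′} {F x′}))) , λ (lift c) → n (∈⇒∊ c))
              x′≋x = ≋-sym (∊-singleton⁻ x∊)
          in e ∙ ⟨⟩-cong x′≋x (F-cong x′≋x))

  -- Guessing models

  -- The interface through which the rest of the proof sees M, with H(θ) eliminated. In
  -- `adjoin-closed`, the bound `D` replaces the requirement that `z` be in H(θ), which follows by
  -- transitivity from `z ∊ D` and `D ∊ M`.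
  record GuessingModel (ω₁ M : 𝕍) : Set (suc ℓ) where
    field
      M-small       : Inj M ω₁
      ∩-closed      : ∀ {x y z} → x ∊ M → y ∊ M → (∀ w → w ∊ z → w ∊ x × w ∊ y) →
                      (∀ w → w ∊ x → w ∊ y → w ∊ z) → z ∊ M
      adjoin-closed : ∀ {x y z D} → x ∊ M → y ∊ M → D ∊ M → z ∊ D → (∀ w → w ∊ z → w ∊ x ⊎ w ≋ y) →
                      x ⊑ z → y ∊ z → z ∊ M
      apply         : ∀ {F} → Congruent F → ∀ {A x} → Graph F A ∊ M → x ∊ M → x ∊ A → F x ∊ M
      guess         : ∀ {z b} → z ∊ M → b ⊑ z →
                      (∀ a → a ∊ M → Cnt a → ∃ λ v → v ∊ M × (∀ w → w ∊ v → w ∊ b × w ∊ a) × (∀ w → w ∊ b → w ∊ a → w ∊ v)) →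
                      ∃ λ b′ → b′ ∊ M × (∀ w → w ∊ M → w ∊ b′ → w ∊ b) × (∀ w → w ∊ M → w ∊ b → w ∊ b′)

  ∊-∩⁺ : ∀ {x y z} → z ∊ x → z ∊ y → z ∊ x ∩ y
  ∊-∩⁺ {x} {y} p q = sep-∊⁺ x (_∈ y) (λ e r → ∊⇒∈ (∊-≋ˡ e (∈⇒∊ r))) p (∊⇒∈ q)

  ∊-∩⁻ : ∀ {x y z} → z ∊ x ∩ y → z ∊ x × z ∊ y
  ∊-∩⁻ {x} {y} p = let q , r = sep-∊⁻ x (_∈ y) (λ e r → ∊⇒∈ (∊-≋ˡ e (∈⇒∊ r))) p in q , ∈⇒∊ r

  -- A guessing model of size ℵ₁ containing prescribed parameters

  module ModelExistence {ω₁ ω₂ : 𝕍} (s₁ : SuccCard ω ω₁) (s₂ : SuccCard ω₁ ω₂) (isp : ISP ω₂)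
    (W : 𝕍) (W-small : Inj W ω₁) where

    open FirstUncountable s₁
    private
      θ₀ = proj₁ isp
      -- The closure of `W` places `W` inside H(θ), θ₀ makes θ large enough for `isp`, and ω + 1 is
      -- required by the construction of θ.
      T₀ : 𝕍
      T₀ = trcl W ∪ (θ₀ ∪ succ ω)
      open Large T₀ (λ _ p → ∊-∪ʳ (∊-∪ʳ p))

      W⊑H : W ⊑ H
      W⊑H z p = H-⊒ trcl-transitive (λ _ → ∊-∪ˡ) z (⊑-trcl z p)

      Member : Class
      Member x = W ⊑ x × Inj x ω₁

      Member-resp : Resp Member
      Member-resp e (h , i) = (λ w p → ≋⇒⊑ e w (h w p)) , Inj-trans (Inj-⊑ (≋⇒⊒ e)) i

      C : 𝕍
      C = Sep (𝒫 H) Member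

      ∊-C⁻ : ∀ {x} → x ∊ C → x ⊑ H × W ⊑ x × Inj x ω₁
      ∊-C⁻ p = let q , h = ∊-Sep⁻ Member Member-resp p in ∊-𝒫⁻ q , h

      ∊-C⁺ : ∀ {x} → x ⊑ H → W ⊑ x → Inj x ω₁ → x ∊ C
      ∊-C⁺ h h′ i = ∊-Sep⁺ Member Member-resp (∊-𝒫⁺ h) (h′ , i)

      ω₁⊑ω₂ : ω₁ ⊑ ω₂
      ω₁⊑ω₂ = ∊⇒⊑ (proj₁ (proj₁ s₂)) (proj₁ (proj₂ s₂))

      ≺ω₂⇒Inj : ∀ {x} → x ≺ ω₂ → Inj x ω₁
      ≺ω₂⇒Inj (_ , n) = ¬Inj⇒Inj-below ω₁-ord s₂ λ i → n (Inj⇒≼ i)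

      C-club : IsClub ω₂ H C
      C-club =
        (λ x p → let h , _ , i = ∊-C⁻ (∈⇒∊ p)
                 in ⊑⇒⊆ h , Inj⇒≼ (Inj-trans i (Inj-⊑ ω₁⊑ω₂)) , λ j → Inj-below⇒¬Inj ω₁-ord s₂ i (≼⇒Inj j)) ,
        (λ x (h , x≺) → x ∪ W , ∊⇒∈ (∊-C⁺
            (λ z p → [ ⊆⇒⊑ h z , W⊑H z ]′ (∊-∪⁻ p)) (λ _ → ∊-∪ʳ)
            (∪-small (≺ω₂⇒Inj x≺) W-small)) ,
          ⊑⇒⊆ (λ _ → ∊-∪ˡ)) ,
        λ α s u α∈ω₂ ∅∈α s-fun _ u-union →
          let module s = Function s-fun
              s∊C = λ ξ p → ∊-C⁻ (s.app-maps ξ p)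
              u-elim : ∀ z → z ∊ u → ∃ λ ξ → ξ ∊ α × z ∊ app s ξ
              u-elim z p = let ξ , x , q , r = Equivalence.to (u-union z) (∊⇒∈ p)
                           in ξ , s.domain (⟪⟫∈⇒⟨⟩∊ q) , ∊-≋ʳ (s.app-unique (⟪⟫∈⇒⟨⟩∊ q)) (∈⇒∊ r)
          in ∊⇒∈ (∊-C⁺
            (λ z p → let ξ , q , r = u-elim z p in proj₁ (s∊C ξ q) z r)
            -- `W` is contained in the union because it is contained in the stage at ∅; here the
            -- nonzero length of the sequence is used.
            (λ z p → ∈⇒∊ (Equivalence.from (u-union z) (∅ , app s ∅ , ⟨⟩∊⇒⟪⟫∈ (s.app-graph (∈⇒∊ ∅∈α)) ,
              ∊⇒∈ (proj₁ (proj₂ (s∊C ∅ (∈⇒∊ ∅∈α))) z p))))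
            (Union.union-small α (app s) s.app-cong (below-succ ω₁-ord s₂ (∈⇒∊ α∈ω₂))
              (λ ξ p → proj₂ (proj₂ (s∊C ξ p))) u u-elim))

    model : ∃ λ M → W ⊑ M × GuessingModel ω₁ M
    model =
      let θ₀∊θ = ∊-Hartogs⁺ (IsOrdinal⇒Ord (proj₁ (proj₂ isp))) (Inj-trans (Inj-⊑ λ _ p → ∊-∪ʳ (∊-∪ˡ p)) T₀-small)
          M , M∈C , _ , M≺H , g = proj₂ (proj₂ isp) θ H θ-regular (∊⇒∈ θ₀∊θ) isH C C-club
          _ , W⊑M , i = ∊-C⁻ (∈⇒∊ M∈C)
          module E = Elementary M≺H H-transitive
      in M , W⊑M , record
        { M-small = i
        ; ∩-closed = λ p q h h′ → E.∩-closed p q (H-⊑ (λ w r → proj₁ (h w r)) (E.M⊑H _ p)) h h′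
        ; adjoin-closed = λ p q d r → E.adjoin-closed p q (H-transitive r (E.M⊑H _ d))
        ; apply = E.apply
        ; guess = λ {z} {b} p h approx →
            let b′ , b′∈M , e = g z b (∊⇒∈ p) (⊑⇒⊆ h) (λ a q c →
                  let v , v∊M , h₁ , h₂ = approx a (∈⇒∊ q) (Inj⇒Cnt (≼⇒Inj c))
                  in ∊⇒∈ (∊-≋ˡ (≋-ext (λ w r → let r₁ , r₂ = h₁ w r in ∊-∩⁺ r₁ r₂)
                                      (λ w r → let r₁ , r₂ = ∊-∩⁻ r in h₂ w r₁ r₂)) v∊M))
            in b′ , ∈⇒∊ b′∈M ,
               (λ w q r → proj₁ (∊-∩⁻ (∊-≋ʳ (≈⇒≋ e) (∊-∩⁺ r q)))) ,
               (λ w q r → proj₁ (∊-∩⁻ (∊-≋ʳ (≋-sym (≈⇒≋ e)) (∊-∩⁺ r q)))) }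

  -- The continuum

  cantor : ∀ {A} → ¬ Inj (𝒫 A) A
  cantor {A} i = D∌ (∊-Sep⁺ Diagonal resp (maps D∊) (D , D∊ , ≋-refl , D∌))
    where
    open Inj i
    Diagonal : Class
    Diagonal x = ∃ λ y → y ∊ 𝒫 A × x ≋ fn y × ¬ (x ∊ y)
    resp : Resp Diagonal
    resp e (y , p , e′ , h) = y , p , ≋-sym e ∙ e′ , λ q → h (∊-≋ˡ (≋-sym e) q)
    D : 𝕍
    D = Sep A Diagonal
    D∊ : D ∊ 𝒫 A
    D∊ = ∊-𝒫⁺ λ z p → proj₁ (∊-Sep⁻ Diagonal resp p)
    D∌ : ¬ (fn D ∊ D)
    D∌ p = let _ , y , q , e , h = ∊-Sep⁻ Diagonal resp p in h (∊-≋ʳ (injective D∊ q e) p)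

  module Continuum {𝔠 : 𝕍} (power : IsCardinalPower (nat 2) ω 𝔠) where
    private
      F = proj₁ (proj₂ power)
      F-spec = proj₁ (proj₂ (proj₂ power))

    𝔠-card : Card 𝔠
    𝔠-card = IsCardinal⇒Card (proj₁ power)

    -- A subset `y` of `A` is recovered from the characteristic function of the set of all n with
    -- `e n ∊ y`.
    𝒫-small : ∀ {A} → Cnt A → Inj (𝒫 A) 𝔠
    𝒫-small {A} (e , c) = Inj-trans
      (record { fn = λ y → Graph (χ y) ω
              ; fn-cong = λ {y} {y′} q → Graph-cong (χ-cong y) (χ-cong y′) (λ v _ → χ-congʸ q v)
              ; maps = λ {y} _ → ∈⇒∊ (Equivalence.from (F-spec _) (Graph-function (χ-cong y) λ v _ → χ-maps y v))
              ; injective = λ p q r → ≋-ext (half p r) (half q (≋-sym r)) })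
      (Bij.inj (≃⇒Bij (proj₂ (proj₂ (proj₂ power)))))
      where
      Hit : 𝕍 → Class
      Hit y v = ∃ λ n → v ≋ nat n × e n ∊ y
      Hit-resp : ∀ y → Resp (Hit y)
      Hit-resp y q (n , r , s) = n , ≋-sym q ∙ r , s
      χ : 𝕍 → 𝕍 → 𝕍
      χ y = cases (Hit y) (λ _ → nat 1) (λ _ → nat 0)
      χ-yes : ∀ {y v} → Hit y v → χ y v ≋ nat 1
      χ-yes {y} = cases-yes (Hit y) _ _
      χ-no : ∀ {y v} → ¬ Hit y v → χ y v ≋ nat 0
      χ-no {y} = cases-no (Hit y) _ _
      χ-cong : ∀ y → Congruent (χ y)
      χ-cong y = cases-cong (Hit y) _ _ (Hit-resp y) (λ _ _ → ≋-refl) (λ _ _ → ≋-refl)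
      χ-congʸ : ∀ {y y′} → y ≋ y′ → ∀ v → χ y v ≋ χ y′ v
      χ-congʸ {y} q v = case em {Hit y v} of λ where
        (yes (n , r , s)) → χ-yes (n , r , s) ∙ ≋-sym (χ-yes (n , r , ∊-≋ʳ q s))
        (no h) → χ-no h ∙ ≋-sym (χ-no λ (n , r , s) → h (n , r , ∊-≋ʳ (≋-sym q) s))
      χ-maps : ∀ y v → χ y v ∊ nat 2
      χ-maps y v = case em {Hit y v} of λ where
        (yes h) → ∊-≋ˡ (≋-sym (χ-yes h)) (∊-nat⁺ {1} {2} (s≤s (s≤s z≤n)))
        (no h) → ∊-≋ˡ (≋-sym (χ-no h)) (∊-nat⁺ {0} {2} (s≤s z≤n))
      half : ∀ {y y′} → y ∊ 𝒫 A → Graph (χ y) ω ≋ Graph (χ y′) ω → y ⊑ y′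
      half {y} {y′} p r z z∊y =
        let n , q = c z (∊-𝒫⁻ p z z∊y)
            _ , s = ⟨⟩∊Graph⁻ (χ-cong y′) (∊-≋ʳ r (∊-Graph⁺ (χ-cong y) (∊-ω⁺ n ≋-refl)
              (≋-sym (χ-yes (n , ≋-refl , ∊-≋ˡ q z∊y)))))
        in case em {Hit y′ (nat n)} of λ where
          (yes (m , t , v)) → ∊-≋ˡ (≋-sym q) (subst (λ k → e k ∊ y′) (sym (nat-injective t)) v)
          (no h) → case nat-injective {1} {0} (s ∙ χ-no h) of λ ()

    ω∊𝔠 : ω ∊ 𝔠
    ω∊𝔠 = [ id , (λ h → ⊥-elim (cantor (Inj-trans (𝒫-small ω-countable) (Inj-⊑ h)))) ]′ (∊⊎⊒ ω-ordinal (proj₁ 𝔠-card))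
      where
      ω-countable : Cnt ω
      ω-countable = nat , λ z → ∊-ω⁻

  -- Ultrafilters

  record Ultrafilter (κ U : 𝕍) : Set (suc ℓ) where
    field
      members : ∀ {X} → X ∊ U → X ⊑ κ
      full    : κ ∊ U
      proper  : ∀ {X} → X ∊ U → ∃ λ x → x ∊ X
      up      : ∀ {X Y} → X ∊ U → X ⊑ Y → Y ⊑ κ → Y ∊ U
      meet    : ∀ {X Y Z} → X ∊ U → Y ∊ U → (∀ w → w ∊ X → w ∊ Y → w ∊ Z) → Z ⊑ κ → Z ∊ U
      ultra   : ∀ {X Y} → X ⊑ κ → ¬ (X ∊ U) → (∀ w → w ∊ κ → ¬ (w ∊ X) → w ∊ Y) → Y ⊑ κ → Y ∊ U

  ∊-∖⁺ : ∀ {x y z} → z ∊ x → ¬ (z ∊ y) → z ∊ x ∖ y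
  ∊-∖⁺ {x} {y} p q = sep-∊⁺ x _ (λ e r s → r (∊⇒∈ (∊-≋ˡ (≋-sym e) (∈⇒∊ s)))) p (λ s → q (∈⇒∊ s))

  ∊-∖⁻ : ∀ {x y z} → z ∊ x ∖ y → z ∊ x × ¬ (z ∊ y)
  ∊-∖⁻ {x} {y} p = let q , r = sep-∊⁻ x (λ z → ¬ z ∈ y) (λ e r s → r (∊⇒∈ (∊-≋ˡ (≋-sym e) (∈⇒∊ s)))) p
                   in q , λ s → r (∊⇒∈ s)

  IsUltrafilter⇒Ultrafilter : ∀ {κ U} → IsUltrafilter κ U → Ultrafilter κ U
  IsUltrafilter⇒Ultrafilter {κ} {U} (sub , full , ∅∉ , up , int , ult) = record
    { members = λ p → ⊆⇒⊑ (sub _ (∊⇒∈ p))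
    ; full = ∈⇒∊ full
    ; proper = λ {X} p → by-contradiction λ h → ∅∉ (∊⇒∈ (∊-≋ˡ
        (≋-ext {X} {∅} (λ z q → ⊥-elim (h (z , q))) (λ { _ (∈⇒∊ ()) })) p))
    ; up = up′
    ; meet = λ {X} {Y} p q h → up′ (∈⇒∊ (int X Y (∊⇒∈ p) (∊⇒∈ q))) (λ w r → let r₁ , r₂ = ∊-∩⁻ r in h w r₁ r₂)
    ; ultra = λ {X} h n h′ k → case ult X (⊑⇒⊆ h) of λ where
        (inj₁ p) → ⊥-elim (n (∈⇒∊ p))
        (inj₂ p) → up′ (∈⇒∊ p) (λ w r → let r₁ , r₂ = ∊-∖⁻ r in h′ w r₁ r₂) k }
    where
    up′ : ∀ {X Y} → X ∊ U → X ⊑ Y → Y ⊑ κ → Y ∊ U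
    up′ p h k = ∈⇒∊ (up _ _ (∊⇒∈ p) (⊑⇒⊆ h) (⊑⇒⊆ k))

  Pre : 𝕍 → (𝕍 → 𝕍) → 𝕍 → 𝕍
  Pre κ g R = Sep κ (λ x → g x ∊ R)

  ∊-Pre⁺ : ∀ {κ g R x} → Congruent g → x ∊ κ → g x ∊ R → x ∊ Pre κ g R
  ∊-Pre⁺ {g = g} {R} g-cong = ∊-Sep⁺ (λ x → g x ∊ R) λ e → ∊-≋ˡ (g-cong e)

  ∊-Pre⁻ : ∀ {κ g R x} → Congruent g → x ∊ Pre κ g R → x ∊ κ × g x ∊ R
  ∊-Pre⁻ {g = g} {R} g-cong = ∊-Sep⁻ (λ x → g x ∊ R) λ e → ∊-≋ˡ (g-cong e)

  IndecomposableAt : 𝕍 → 𝕍 → 𝕍 → Set (suc ℓ)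
  IndecomposableAt μ κ U = ∀ g → Congruent g → (∀ x → x ∊ κ → g x ∊ μ) →
    ∃ λ R → R ⊑ μ × ¬ Inj μ R × Pre κ g R ∊ U

  IsIndecomposableAt⇒IndecomposableAt : ∀ {μ κ U} → Ultrafilter κ U → IsIndecomposableAt μ κ U → IndecomposableAt μ κ U
  IsIndecomposableAt⇒IndecomposableAt {μ} {κ} u h g g-cong g-maps =
    let R , R⊆ , (_ , n) , p = h (Graph g κ) (Graph-function g-cong g-maps)
    in R , ⊆⇒⊑ R⊆ , (λ i → n (Inj⇒≼ i)) , Ultrafilter.up u (∈⇒∊ p)
         (λ x q → let x∊κ , j , r = sep-∊⁻ κ _ (λ e (j , r) → j , ⟨⟩∊⇒⟪⟫∈ (∊-≋ˡ (⟨⟩-cong e ≋-refl) (⟪⟫∈⇒⟨⟩∊ r))) q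
                      _ , e = ⟨⟩∊Graph⁻ g-cong (⟪⟫∈⇒⟨⟩∊ r)
                  in ∊-Pre⁺ g-cong x∊κ (∊-≋ˡ e (elem-∊ R j)))
         (λ x q → proj₁ (∊-Pre⁻ g-cong q))

  module CountableImage {ω₁ κ U : 𝕍} (s₁ : SuccCard ω ω₁) (κ-card : Card κ) (u : Ultrafilter κ U)
    (indecomposable : ∀ {μ} → Card μ → ω₁ ⊑ μ → μ ∊ κ → IndecomposableAt μ κ U) where

    open FirstUncountable s₁
    open Ultrafilter u
    private
      κ-ord = proj₁ κ-card

    -- A set R of least cardinality β with g⁻¹[R] ∈ U is countable, since
    -- otherwise U is β-indecomposable.
    countable-image : ∀ {α B X} → α ∊ κ → Inj B α → X ∊ U → (g : 𝕍 → 𝕍) → Congruent g → (∀ x → x ∊ X → g x ∊ B) →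
      ∃ λ R → R ⊑ B × Cnt R × Pre κ g R ∊ U
    countable-image {α} {B} {X} α∊κ i X∊U g g-cong g-maps =
      let β₀ , β₀∊κ , (β₀-ord , _) , b₀ = small-cardinality κ-ord (λ j → Card-¬Inj κ-card α∊κ (Inj-trans j i))
          β , β-ord , (β∊κ , R , R⊑B , b , p) , min = least P β₀-ord
            (β₀∊κ , B , (λ _ → id) , Bij-sym b₀ , up X∊U (λ x q → ∊-Pre⁺ g-cong (members X∊U x q) (g-maps x q)) Pre⊑κ)
          β-card : Card β
          β-card = β-ord , λ γ q b′ → min γ q
            (Ord.transitive κ-ord q β∊κ , R , R⊑B , Bij-trans b (Bij-sym b′) , p)
      in R , R⊑B , Cnt-Inj (Bij.inj b) (case ∊⊎⊒ β-ord ω₁-ord of λ where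
           (inj₁ q) → Cnt-below q
           (inj₂ q) → ⊥-elim (descend β β-card β∊κ q R R⊑B b p min)) , p
      where
      P : Class
      P β = β ∊ κ × ∃ λ R → R ⊑ B × Bij R β × Pre κ g R ∊ U
      Pre⊑κ : ∀ {R} → Pre κ g R ⊑ κ
      Pre⊑κ x q = proj₁ (∊-Pre⁻ g-cong q)
      -- Indecomposability at β, applied to the code of `g x` in β, gives a set `H` of fewer than β
      -- codes. The part `R′` of `R` with codes in `H` still has its preimage in `U`, against the
      -- minimality of β.
      descend : ∀ β → Card β → β ∊ κ → ω₁ ⊑ β → ∀ R → R ⊑ B → Bij R β → Pre κ g R ∊ U → (∀ γ → γ ∊ β → ¬ P γ) → ⊥
      descend β c β∊κ ω₁⊑β R R⊑B b p min =
        let H , H⊑β , ¬i , q = indecomposable c ω₁⊑β β∊κ f f-cong f-maps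
            R′ = Sep R (λ r → b.fn r ∊ H)
            R′⁻ = λ {r} → ∊-Sep⁻ {R} (λ r → b.fn r ∊ H) (λ e → ∊-≋ˡ (b.fn-cong e)) {r}
            γ , γ∊β , _ , b′ = small-cardinality {A = R′} (proj₁ c) (λ j → ¬i (Inj-trans j (record
              { fn = b.fn ; fn-cong = b.fn-cong ; maps = λ r → proj₂ (R′⁻ r)
              ; injective = λ r r′ → b.injective (proj₁ (R′⁻ r)) (proj₁ (R′⁻ r′)) })))
        in min γ γ∊β (Ord.transitive κ-ord γ∊β β∊κ , R′ , (λ r t → R⊑B r (proj₁ (R′⁻ t))) , Bij-sym b′ ,
             meet q p (λ x t v →
               let x∊κ , fx∊H = ∊-Pre⁻ f-cong t
                   _ , gx∊R = ∊-Pre⁻ g-cong v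
               in ∊-Pre⁺ g-cong x∊κ (∊-Sep⁺ _ (λ e → ∊-≋ˡ (b.fn-cong e)) gx∊R (∊-≋ˡ (f-yes gx∊R) fx∊H))) Pre⊑κ)
        where
        module b = Bij b
        f : 𝕍 → 𝕍
        -- Off the preimage of `R` any value in β would do; ω is one, since ω < ω₁ ≤ β.
        f = cases (λ x → g x ∊ R) (λ x → b.fn (g x)) (λ _ → ω)
        f-yes : ∀ {x} → g x ∊ R → f x ≋ b.fn (g x)
        f-yes = cases-yes (λ x → g x ∊ R) _ _
        f-cong : Congruent f
        f-cong = cases-cong _ _ _ (λ e → ∊-≋ˡ (g-cong e)) (λ _ e → b.fn-cong (g-cong e)) (λ _ _ → ≋-refl)
        f-maps : ∀ x → x ∊ κ → f x ∊ β
        f-maps x _ = case em {g x ∊ R} of λ where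
          (yes q) → ∊-≋ˡ (≋-sym (f-yes q)) (b.maps q)
          (no q) → ∊-≋ˡ (≋-sym (cases-no (λ x → g x ∊ R) _ _ q)) (ω₁⊑β ω ω∊ω₁)

  -- Approximating U by countably many countably complete ultrafilters

  -- W is countably principal: on every countable family of subsets of κ it
  -- agrees with a principal ultrafilter. This is countable completeness.
  Good : 𝕍 → Class
  Good κ W = ∀ a → Cnt a → a ⊑ 𝒫 κ → ∃ λ x → x ∊ κ × (∀ A → A ∊ a → A ∊ W → x ∊ A) × (∀ A → A ∊ a → x ∊ A → A ∊ W)

  Good-resp : ∀ {κ} → Resp (Good κ)
  Good-resp e h a c a⊑ = let x , p , q , r = h a c a⊑
                         in x , p , (λ A t v → q A t (≋⇒⊒ e A v)) , (λ A t v → ≋⇒⊑ e A (r A t v))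

  Cnt-resp : Resp Cnt
  Cnt-resp e c = Cnt-⊑ (≋⇒⊒ e) c

  Cnt-⋃ : ∀ {a} → Cnt a → (∀ x → x ∊ a → Cnt x) → Cnt (⋃ a)
  Cnt-⋃ {a} (e , c) h = Cnt-by-pairs (λ i j → at i em j) λ z p →
      let x , z∊x , x∊a = ∊-⋃⁻ p
          i , q = c x x∊a
          j , r = covers i (∊-≋ˡ q x∊a) (∊-≋ʳ q z∊x) em
      in i , j , r
    where
    at : ∀ i → Dec (e i ∊ a) → ℕ → 𝕍
    at i (yes p) j = proj₁ (h (e i) p) j
    at i (no _) j = ∅
    covers : ∀ i {z} → e i ∊ a → z ∊ e i → (d : Dec (e i ∊ a)) → ∃ λ j → z ≋ at i d j
    covers i p q (yes p′) = proj₂ (h (e i) p′) _ q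
    covers i p q (no n) = ⊥-elim (n p)

  ⋃-cong : Congruent ⋃
  ⋃-cong e = ≋-ext (half e) (half (≋-sym e))
    where
    half : ∀ {x y} → x ≋ y → ⋃ x ⊑ ⋃ y
    half e z p = let w , q , r = ∊-⋃⁻ p in ∊-⋃⁺ q (∊-≋ʳ e r)

  -- An enumeration as a set, so that it can itself belong to a model; its values at the natural
  -- numbers then belong to the model too.
  Lists : 𝕍 → 𝕍 → Set (suc ℓ)
  Lists X j = ∃ λ F → Congruent F × (∀ z → z ∊ X → ∃ λ n → z ≋ F (nat n)) × j ≋ Graph F ω

  Cnt⇒Lists : ∀ {X} → Cnt X → ∃ (Lists X)
  Cnt⇒Lists (e , c) =
    let F , F-cong , F-spec = choose ω (λ v y → ∃ λ n → v ≋ nat n × y ≋ e n)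
          (λ p q (n , r , t) → n , ≋-sym p ∙ r , ≋-sym q ∙ t)
          (λ v p → let n , q = ∊-ω⁻ p in e n , n , q , ≋-refl)
    in Graph F ω , F , F-cong , (λ z p → let n , q = c z p
                                             m , r , t = F-spec (nat n) (∊-ω⁺ n ≋-refl)
                                         in n , q ∙ subst (λ k → e k ≋ F (nat n)) (sym (nat-injective r)) (≋-sym t)) , ≋-refl

  module Approximation {ω₁ κ 𝔠 U : 𝕍} (s₁ : SuccCard ω ω₁) (κ-card : Card κ) (power : IsCardinalPower (nat 2) ω 𝔠)
    (𝔠∊κ : 𝔠 ∊ κ) (u : Ultrafilter κ U)
    (indecomposable : ∀ {μ} → Card μ → ω₁ ⊑ μ → μ ∊ κ → IndecomposableAt μ κ U) where

    open FirstUncountable s₁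
    open Continuum power
    open Ultrafilter u
    open CountableImage s₁ κ-card u indecomposable

    ω₁∊κ : ω₁ ∊ κ
    ω₁∊κ = ⊑-∊-trans ω₁-ord (proj₁ κ-card) (proj₂ (proj₂ s₁) 𝔠-card ω∊𝔠) 𝔠∊κ

    -- `Q` contains both the subsets of κ and the families of such subsets, so one covering argument
    -- serves for sets `A` and for guessed ultrafilters.
    P Q CQ : 𝕍
    P = 𝒫 κ
    Q = P ∪ 𝒫 P
    CQ = Sep (𝒫 Q) Cnt

    ∊-CQ⁺ : ∀ {a} → a ⊑ Q → Cnt a → a ∊ CQ
    ∊-CQ⁺ h c = ∊-Sep⁺ Cnt Cnt-resp (∊-𝒫⁺ h) c

    ∊-CQ⁻ : ∀ {a} → a ∊ CQ → a ⊑ Q × Cnt a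
    ∊-CQ⁻ p = let q , c = ∊-Sep⁻ Cnt Cnt-resp p in ∊-𝒫⁻ q , c

    Trace : 𝕍 → Class
    Trace x A = A ∊ P × x ∊ A

    Trace-resp : ∀ x → Resp (Trace x)
    Trace-resp x e (p , q) = ∊-≋ˡ e p , ∊-≋ʳ e q

    -- The restriction to `a` of the principal ultrafilter at `x`.
    trace : 𝕍 → 𝕍 → 𝕍
    trace a x = Sep a (Trace x)

    ∊-trace⁺ : ∀ {a x A} → A ∊ a → A ∊ P → x ∊ A → A ∊ trace a x
    ∊-trace⁺ {x = x} p q r = ∊-Sep⁺ (Trace x) (Trace-resp x) p (q , r)

    ∊-trace⁻ : ∀ {a x A} → A ∊ trace a x → A ∊ a × A ∊ P × x ∊ A
    ∊-trace⁻ {x = x} = ∊-Sep⁻ (Trace x) (Trace-resp x)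

    trace-cong : ∀ {a a′ x x′} → a ≋ a′ → x ≋ x′ → trace a x ≋ trace a′ x′
    trace-cong e e′ = ≋-ext (half e e′) (half (≋-sym e) (≋-sym e′))
      where
      half : ∀ {a a′ x x′} → a ≋ a′ → x ≋ x′ → trace a x ⊑ trace a′ x′
      half e e′ A p = let q , r , t = ∊-trace⁻ p in ∊-trace⁺ (∊-≋ʳ e q) r (∊-≋ˡ e′ t)

    -- If such an `R` lies in M it is a subset of M, being countable; then almost every `x` has its
    -- trace on `a` in M.
    Traces : 𝕍 → Class
    Traces a R = R ∊ CQ × Pre κ (trace a) R ∊ U

    traces-exist : ∀ a → a ∊ CQ → ∃ (Traces a)
    traces-exist a p =
      let R , h , c , q = countable-image 𝔠∊κ (𝒫-small (proj₂ (∊-CQ⁻ p))) full (trace a) (trace-cong ≋-refl)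
            (λ x _ → ∊-𝒫⁺ λ A r → proj₁ (∊-trace⁻ r))
          R′ = Sep R (_∊ Q)
      in R′ , ∊-CQ⁺ (λ _ r → proj₂ (∊-Sep⁻ (_∊ Q) ∊-≋ˡ r)) (Cnt-⊑ (λ _ r → proj₁ (∊-Sep⁻ (_∊ Q) ∊-≋ˡ r)) c) ,
         up q (λ x r → let x∊κ , t = ∊-Pre⁻ (trace-cong ≋-refl) r
                       in ∊-Pre⁺ (trace-cong ≋-refl) x∊κ (∊-Sep⁺ (_∊ Q) ∊-≋ˡ t
                            (∊-∪ʳ (∊-𝒫⁺ λ A v → proj₁ (proj₂ (∊-trace⁻ v))))))
           (λ x r → proj₁ (∊-Pre⁻ (trace-cong ≋-refl) r))

    InjectsInto : 𝕍 → Class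
    InjectsInto X j = ∃ λ (i : Inj ω₁ X) → j ≋ Graph (Inj.fn i) ω₁

    BadAt : 𝕍 → Class
    BadAt W a = a ∊ CQ × a ⊑ P × ¬ (∃ λ x → x ∊ κ × (∀ A → A ∊ a → A ∊ W → x ∊ A) × (∀ A → A ∊ a → x ∊ A → A ∊ W))

    UncoveredAt : 𝕍 → Class
    UncoveredAt Y A = A ∊ U × (∀ W → W ∊ Y → W ∊ 𝒫 P → Good κ W → ¬ (A ∊ W))

    abstract
      -- Produces Skolem functions: a witness wherever one exists and ∅ elsewhere. With the graph in
      -- M, a failure at a point of M is witnessed in M, without evaluating the formula that
      -- describes the failure.
      choose-if : (D : 𝕍) (R : 𝕍 → Class) → (∀ {x x′ y y′} → x ≋ x′ → y ≋ y′ → R x y → R x′ y′) →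
        Σ (𝕍 → 𝕍) λ g → Congruent g × (∀ x → x ∊ D → ∃ (R x) → R x (g x))
      choose-if D R resp =
        let g , g-cong , g-spec = choose D (λ x y → ∃ (R x) → R x y)
              (λ e e′ h (y , r) → resp e e′ (h (y , resp (≋-sym e) ≋-refl r)))
              (λ x _ → case em {∃ (R x)} of λ where
                (yes (y , r)) → y , λ _ → r
                (no n) → ∅ , λ q → ⊥-elim (n q))
        in g , g-cong , g-spec

      injecting : Σ (𝕍 → 𝕍) λ g → Congruent g × (∀ x → x ∊ 𝒫 CQ → ∃ (InjectsInto x) → InjectsInto x (g x))
      injecting = choose-if (𝒫 CQ) InjectsInto
        (λ e e′ (i , q) → Inj-trans i (Inj-⊑ (≋⇒⊑ e)) , ≋-sym e′ ∙ q)

      listing : Σ (𝕍 → 𝕍) λ g → Congruent g × (∀ x → x ∊ CQ → ∃ (Lists x) → Lists x (g x))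
      listing = choose-if CQ Lists
        (λ e e′ (F , F-cong , h , q) → F , F-cong , (λ z p → h z (≋⇒⊒ e z p)) , ≋-sym e′ ∙ q)

      tracing : Σ (𝕍 → 𝕍) λ g → Congruent g × (∀ x → x ∊ CQ → ∃ (Traces x) → Traces x (g x))
      tracing = choose-if CQ Traces
        (λ e e′ (p , q) → ∊-≋ˡ e′ p , up q
          (λ x r → let x∊κ , t = ∊-Pre⁻ (trace-cong ≋-refl) r
                   in ∊-Pre⁺ (trace-cong ≋-refl) x∊κ (∊-≋ʳ e′ (∊-≋ˡ (trace-cong e ≋-refl) t)))
          (λ x r → proj₁ (∊-Pre⁻ (trace-cong ≋-refl) r)))

      refuting-good : Σ (𝕍 → 𝕍) λ g → Congruent g × (∀ x → x ∊ 𝒫 P → ∃ (BadAt x) → BadAt x (g x))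
      refuting-good = choose-if (𝒫 P) BadAt
        (λ e e′ (p , h , n) → ∊-≋ˡ e′ p , (λ A q → h A (≋⇒⊒ e′ A q)) ,
          λ (x , x∊κ , q , r) → n (x , x∊κ ,
            (λ A t v → q A (≋⇒⊑ e′ A t) (≋⇒⊑ e A v)) , (λ A t v → ≋⇒⊒ e A (r A (≋⇒⊑ e′ A t) v))))

      refuting-cover : Σ (𝕍 → 𝕍) λ g → Congruent g × (∀ x → x ∊ CQ → ∃ (UncoveredAt x) → UncoveredAt x (g x))
      refuting-cover = choose-if CQ UncoveredAt
        (λ e e′ (p , h) → ∊-≋ˡ e′ p , λ W q r g t → h W (≋⇒⊒ e W q) r g (∊-≋ˡ (≋-sym e′) t))

    private
      parameter : ℕ → 𝕍
      parameter 0 = P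
      parameter 1 = CQ
      parameter 2 = 𝒫 CQ
      parameter 3 = Graph ⋃ (𝒫 CQ)
      parameter 4 = Graph (proj₁ injecting) (𝒫 CQ)
      parameter 5 = Graph (proj₁ listing) CQ
      parameter 6 = Graph (proj₁ tracing) CQ
      parameter 7 = Graph (proj₁ refuting-good) (𝒫 P)
      parameter 8 = Graph (proj₁ refuting-cover) CQ
      parameter _ = ∅

    parameters : 𝕍
    parameters = ω₁ ∪ Range parameter

    parameters-small : Inj parameters ω₁
    parameters-small = ∪-small (Inj-⊑ λ _ p → p) (Cnt⇒Inj-ω₁ (Cnt-Range parameter))

    -- Covering and guessing inside the model

    module _ {M : 𝕍} (params⊑M : parameters ⊑ M) (model : GuessingModel ω₁ M) where

      open GuessingModel model

      private
        param : ∀ n → parameter n ∊ M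
        param n = params⊑M _ (∊-∪ʳ (∊-Range⁺ n ≋-refl))

        ω₁⊑M : ω₁ ⊑ M
        ω₁⊑M z p = params⊑M z (∊-∪ˡ p)

        nat∊M : ∀ n → nat n ∊ M
        nat∊M n = ω₁⊑M _ (Ord.transitive ω₁-ord (∊-ω⁺ n ≋-refl) ω∊ω₁)

        ∅∊M : ∅ ∊ M
        ∅∊M = nat∊M 0

        _∩CQ : 𝕍 → 𝕍
        x ∩CQ = Sep x (_∊ CQ)

        restrict : ∀ x Y → Y ∊ M → x ∊ M → Sep x (_∊ Y) ∊ M
        restrict x Y q p = ∩-closed p q (λ w → ∊-Sep⁻ (_∊ Y) ∊-≋ˡ) (λ w → ∊-Sep⁺ (_∊ Y) ∊-≋ˡ)

        ∊-restrict⁻ : ∀ {x Y z} → z ∊ Sep x (_∊ Y) → z ∊ x × z ∊ Y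
        ∊-restrict⁻ = ∊-Sep⁻ (_∊ _) ∊-≋ˡ

        ∊-restrict⁺ : ∀ {x Y z} → z ∊ x → z ∊ Y → z ∊ Sep x (_∊ Y)
        ∊-restrict⁺ = ∊-Sep⁺ (_∊ _) ∊-≋ˡ

        -- An enumeration of `a` lies in M by `listing`, and so do all natural numbers; hence so do
        -- its values.
        countable-⊑M : ∀ {a} → a ∊ M → a ∊ CQ → a ⊑ M
        countable-⊑M {a} p q z z∊a =
          let j∊M = apply (proj₁ (proj₂ listing)) (param 5) p q
              F , F-cong , covers , e = proj₂ (proj₂ listing) a q (Cnt⇒Lists (proj₂ (∊-CQ⁻ q)))
              n , r = covers z z∊a
          in ∊-≋ˡ (≋-sym r) (apply F-cong (∊-≋ˡ e j∊M) (nat∊M n) (∊-ω⁺ n ≋-refl))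

        ⋃∊M : ∀ {a} → a ∊ M → a ⊑ CQ → ⋃ a ∊ M
        ⋃∊M p h = apply ⋃-cong (param 3) p (∊-𝒫⁺ h)

        ⋃∊CQ : ∀ {a} → a ⊑ CQ → Cnt a → ⋃ a ∊ CQ
        ⋃∊CQ h c = ∊-CQ⁺ (λ z p → let x , q , r = ∊-⋃⁻ p in proj₁ (∊-CQ⁻ (h x r)) z q)
          (Cnt-⋃ c λ x p → proj₂ (∊-CQ⁻ (h x p)))

        -- If no countable set in M covered all c n, the set of finite initial
        -- segments of c would have finite intersection with every countable
        -- a ∈ M, since the union of a covers c otherwise. Hence it would be
        -- guessed, by a set which must be countable, and whose union covers c.
        cover-sequence : (c : ℕ → 𝕍) → (∀ n → c n ∊ M) → (∀ n → c n ∊ Q) → ∃ λ a → a ∊ M × a ∊ CQ × (∀ n → c n ∊ a)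
        cover-sequence c c∊M c∊Q = by-contradiction λ ¬covered →
          let b′ , b′∊M , b′⇒b , b⇒b′ = guess (param 1) b⊑CQ (approximate ¬covered)
              b″∊M = restrict b′ CQ (param 1) b′∊M
              b″⊑CQ = λ w p → proj₂ (∊-restrict⁻ {b′} {CQ} {w} p)
              b″-countable : Cnt (b′ ∩CQ)
              b″-countable = by-contradiction λ ¬c →
                -- If the guess were uncountable, M would contain an injection of ω₁ into it. Its
                -- values at points of ω₁, a subset of M, lie in M and so are true segments, of
                -- which there are only countably many.
                let i , e = proj₂ (proj₂ injecting) (b′ ∩CQ) (∊-𝒫⁺ b″⊑CQ) (_ , ¬Cnt⇒Inj ¬c , ≋-refl)
                    module i = Inj i
                    j∊M = apply (proj₁ (proj₂ injecting)) (param 4) b″∊M (∊-𝒫⁺ b″⊑CQ)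
                in ¬Cnt-ω₁ (Cnt-Inj (record
                     { fn = i.fn ; fn-cong = i.fn-cong ; injective = i.injective
                     ; maps = λ p → b′⇒b _ (apply i.fn-cong (∊-≋ˡ e j∊M) (ω₁⊑M _ p) p) (proj₁ (∊-restrict⁻ (i.maps p))) })
                     (Cnt-Range segment))
          in ¬covered (⋃ (b′ ∩CQ) , ⋃∊M b″∊M b″⊑CQ , ⋃∊CQ b″⊑CQ b″-countable , λ n →
               ∊-⋃⁺ (∊-segment (ℕ.n<1+n n)) (∊-restrict⁺ (b⇒b′ _ (segment∊M (1+ n)) (∊-Range⁺ (1+ n) ≋-refl)) (segment∊CQ (1+ n))))
          where
          segment : ℕ → 𝕍
          segment zero = ∅
          segment (1+ n) = segment n ∪ singleton (c n)

          ∊-segment : ∀ {m n} → m < n → c m ∊ segment n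
          ∊-segment {m} {1+ n} (s≤s m≤n) with ℕ.m≤n⇒m<n∨m≡n m≤n
          ... | inj₁ m<n = ∊-∪ˡ (∊-segment m<n)
          ... | inj₂ refl = ∊-∪ʳ (∊-pairˡ ≋-refl)

          segment∊CQ : ∀ n → segment n ∊ CQ
          segment∊CQ zero = ∊-CQ⁺ (λ { _ (∈⇒∊ ()) }) ((λ _ → ∅) , λ { _ (∈⇒∊ ()) })
          segment∊CQ (1+ n) = let h , k = ∊-CQ⁻ (segment∊CQ n) in ∊-CQ⁺
            (λ z p → [ h z , (λ q → ∊-≋ˡ (≋-sym (∊-singleton⁻ q)) (c∊Q n)) ]′ (∊-∪⁻ p))
            (Cnt-succ k λ z p → [ inj₁ , (λ q → inj₂ (∊-singleton⁻ q)) ]′ (∊-∪⁻ p))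

          segment∊M : ∀ n → segment n ∊ M
          segment∊M zero = ∅∊M
          segment∊M (1+ n) = adjoin-closed (segment∊M n) (c∊M n) (param 1) (segment∊CQ (1+ n))
            (λ w p → [ inj₁ , (λ q → inj₂ (∊-singleton⁻ q)) ]′ (∊-∪⁻ p)) (λ _ → ∊-∪ˡ) (∊-∪ʳ (∊-pairˡ ≋-refl))

          b : 𝕍
          b = Range segment

          b⊑CQ : b ⊑ CQ
          b⊑CQ w p = let n , e = ∊-Range⁻ p in ∊-≋ˡ (≋-sym e) (segment∊CQ n)

          -- The finite intersection is built inside M one element at a time. That `v` is a subset
          -- of `CQ` is carried along because `𝒫 CQ` is the bound for adjoining.
          initial-part : ∀ a N → ∃ λ v → v ∊ M × v ⊑ CQ ×
            (∀ w → w ∊ v → w ∊ b × w ∊ a) × (∀ n → n < N → segment n ∊ a → segment n ∊ v)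
          initial-part a zero = ∅ , ∅∊M , (λ { _ (∈⇒∊ ()) }) , (λ { _ (∈⇒∊ ()) }) , λ _ ()
          initial-part a (1+ N) = let v , v∊M , v⊑ , h , k = initial-part a N in case em {segment N ∊ a} of λ where
            (yes p) → let new : ∀ w → w ∊ v ∪ singleton (segment N) → w ∊ v ⊎ w ≋ segment N
                          new w q = [ inj₁ , (λ r → inj₂ (∊-singleton⁻ r)) ]′ (∊-∪⁻ q)
                          new⊑CQ : v ∪ singleton (segment N) ⊑ CQ
                          new⊑CQ w q = [ v⊑ w , (λ e → ∊-≋ˡ (≋-sym e) (segment∊CQ N)) ]′ (new w q)
                      in v ∪ singleton (segment N) ,
                         adjoin-closed v∊M (segment∊M N) (param 2) (∊-𝒫⁺ new⊑CQ) new (λ _ → ∊-∪ˡ) (∊-∪ʳ (∊-pairˡ ≋-refl)) ,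
                         new⊑CQ ,
                         (λ w q → [ h w , (λ e → ∊-Range⁺ N e , ∊-≋ˡ (≋-sym e) p) ]′ (new w q)) ,
                         (λ n n<1+N q → [ (λ n<N → ∊-∪ˡ (k n n<N q)) ,
                           (λ n≡N → ∊-∪ʳ (∊-pairˡ (subst (λ j → segment n ≋ segment j) n≡N ≋-refl))) ]′
                           (ℕ.m≤n⇒m<n∨m≡n (ℕ.≤-pred n<1+N)))
            (no ¬p) → v , v∊M , v⊑ , h , λ n n<1+N q → [ (λ n<N → k n n<N q) ,
              (λ n≡N → ⊥-elim (¬p (subst (λ j → segment j ∊ a) n≡N q))) ]′ (ℕ.m≤n⇒m<n∨m≡n (ℕ.≤-pred n<1+N))

          approximate : ¬ (∃ λ a → a ∊ M × a ∊ CQ × (∀ n → c n ∊ a)) → ∀ a → a ∊ M → Cnt a →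
            ∃ λ v → v ∊ M × (∀ w → w ∊ v → w ∊ b × w ∊ a) × (∀ w → w ∊ b → w ∊ a → w ∊ v)
          approximate ¬covered a a∊M a-cnt = case em {Lift (suc ℓ) (∃ λ N → ∀ n → segment n ∊ a → n < N)} of λ where
            (yes (lift (N , bound))) → let v , v∊M , _ , h , k = initial-part a N in v , v∊M , h ,
              λ w p q → let n , e = ∊-Range⁻ p; r = ∊-≋ˡ e q in ∊-≋ˡ (≋-sym e) (k n (bound n r) r)
            (no unbounded) →
              let a⊑CQ = λ w p → proj₂ (∊-restrict⁻ {a} {CQ} {w} p)
                  a-cnt′ = Cnt-⊑ (λ w p → proj₁ (∊-restrict⁻ {a} {CQ} {w} p)) a-cnt
              in ⊥-elim (¬covered (⋃ (a ∩CQ) , ⋃∊M (restrict a CQ (param 1) a∊M) a⊑CQ , ⋃∊CQ a⊑CQ a-cnt′ , λ m →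
                   by-contradiction λ m∉ → unbounded (lift (1+ m , λ n p →
                     ℕ.≰⇒> λ m<n → m∉ (∊-⋃⁺ (∊-segment m<n) (∊-restrict⁺ p (segment∊CQ n)))))))

        cover : ∀ {X} → X ⊑ M → X ⊑ Q → Cnt X → ∃ λ a → a ∊ M × a ∊ CQ × X ⊑ a
        cover {X} X⊑M X⊑Q (e , h) =
          let a , p , q , r = cover-sequence (λ n → c n em) (λ n → c∊M n em) (λ n → c∊Q n em)
          in a , p , q , λ z z∊X → let n , t = h z z∊X in ∊-≋ˡ (hit n z∊X t em) (r n)
          where
          c : ∀ n → Dec (e n ∊ X) → 𝕍
          c n (yes _) = e n
          -- Terms outside `X` become ∅, which belongs to both M and `Q`, as `cover-sequence`
          -- demands of every term.
          c n (no _) = ∅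
          c∊M : ∀ n d → c n d ∊ M
          c∊M n (yes p) = X⊑M _ p
          c∊M n (no _) = ∅∊M
          c∊Q : ∀ n d → c n d ∊ Q
          c∊Q n (yes p) = X⊑Q _ p
          c∊Q n (no _) = ∊-∪ˡ (∊-𝒫⁺ λ { _ (∈⇒∊ ()) })
          hit : ∀ n {z} → z ∊ X → z ≋ e n → ∀ d → c n d ≋ z
          hit n p q (yes _) = ≋-sym q
          hit n p q (no h) = ⊥-elim (h (∊-≋ˡ q p))

        module m = Inj M-small

        -- `m.fn` indexes M by ordinals below ω₁, so each stage β < ω₁ contains only countably many
        -- subsets of κ, and `cover` captures them by one countable set in M.
        Earlier : 𝕍 → Class
        Earlier β A = A ∊ M × A ∊ P × m.fn A ∊ β

        Covers-earlier : 𝕍 → Class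
        Covers-earlier β a = a ∊ M × a ∊ CQ × (∀ A → Earlier β A → A ∊ a)

        abstract
          approximations : Σ (𝕍 → 𝕍) λ g → Congruent g × (∀ β → β ∊ ω₁ → Covers-earlier β (g β))
          approximations = choose ω₁ Covers-earlier
            (λ e e′ (p , q , h) → ∊-≋ˡ e′ p , ∊-≋ˡ e′ q , λ A (r , r′ , t) → ≋⇒⊑ e′ A (h A (r , r′ , ≋⇒⊒ e _ t)))
            (λ β p →
              let resp = λ {x} {y} (e : x ≋ y) ((q , r , t) : Earlier β x) → ∊-≋ˡ e q , ∊-≋ˡ e r , ∊-≋ˡ (m.fn-cong e) t
                  sep⁻ = λ {A} (q : A ∊ Sep M (Earlier β)) → proj₂ (∊-Sep⁻ (Earlier β) resp q)
                  a , q , r , h = cover {Sep M (Earlier β)} (λ A q → proj₁ (sep⁻ q)) (λ A q → ∊-∪ˡ (proj₁ (proj₂ (sep⁻ q))))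
                    (Cnt-Inj {B = β} (record { fn = m.fn ; fn-cong = m.fn-cong ; maps = λ q → proj₂ (proj₂ (sep⁻ q))
                                     ; injective = λ q r → m.injective (proj₁ (sep⁻ q)) (proj₁ (sep⁻ r)) }) (Cnt-below p))
              in a , q , r , λ A t → h A (∊-Sep⁺ (Earlier β) resp (proj₁ t) t))

        approx : 𝕍 → 𝕍
        approx = proj₁ approximations

        approx-cong : Congruent approx
        approx-cong = proj₁ (proj₂ approximations)

        approx-spec : ∀ β → β ∊ ω₁ → Covers-earlier β (approx β)
        approx-spec = proj₂ (proj₂ approximations)

        ResolvedAt : 𝕍 → Class
        ResolvedAt x β = trace (approx β) x ∊ proj₁ tracing (approx β)

        ResolvedAt-resp : ∀ {x x′ β β′} → x ≋ x′ → β ≋ β′ → ResolvedAt x β → ResolvedAt x′ β′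
        ResolvedAt-resp e e′ p = ∊-≋ʳ (proj₁ (proj₂ tracing) (approx-cong e′)) (∊-≋ˡ (trace-cong (approx-cong e′) e) p)

        traces-of : ∀ β → β ∊ ω₁ → Traces (approx β) (proj₁ tracing (approx β))
        traces-of β p = let _ , q , _ = approx-spec β p in proj₂ (proj₂ tracing) (approx β) q (traces-exist _ q)

        -- The set of typical traces on `approx β` is a countable element of M, hence a subset of M.
        resolved-∊M : ∀ {x β} → β ∊ ω₁ → ResolvedAt x β → trace (approx β) x ∊ M
        resolved-∊M p r = let q , q′ , _ = approx-spec _ p in
          countable-⊑M (apply (proj₁ (proj₂ tracing)) (param 6) q q′) (proj₁ (traces-of _ p)) _ r

        Resolved : Class
        Resolved x = ∀ γ → γ ∊ ω₁ → ∃ λ β → β ∊ ω₁ × γ ⊑ β × ResolvedAt x β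

        Resolved-resp : Resp Resolved
        Resolved-resp e h γ p = let β , q , r , t = h γ p in β , q , r , ResolvedAt-resp e ≋-refl t

        Y Yᶜ : 𝕍
        Y = Sep κ Resolved
        Yᶜ = Sep κ (λ x → ¬ Resolved x)

        -- Otherwise each x in a set of U has a bound below ω₁ for the stages
        -- resolving it. By indecomposability a single bound works on a set of
        -- U, contradicting that almost every x is resolved at that stage.
        Y∊U : Y ∊ U
        Y∊U = by-contradiction λ Y∉U →
          let Yᶜ∊U = ultra (λ x p → proj₁ (∊-Sep⁻ Resolved Resolved-resp p)) Y∉U
                (λ x p q → ∊-Sep⁺ _ (¬-resp Resolved-resp) p λ r → q (∊-Sep⁺ Resolved Resolved-resp p r))
                (λ x p → proj₁ (Yᶜ⁻ p))
              R , R⊑ω₁ , R-cnt , p = countable-image ω₁∊κ (Inj-⊑ λ _ p → p) Yᶜ∊U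
                (proj₁ bounding) (proj₁ (proj₂ bounding)) (λ x q → proj₁ (proj₂ (proj₂ bounding) x q))
              β , β∊ω₁ , R⊑β = Cnt-bounded R⊑ω₁ R-cnt
              _ , T∊U = traces-of β β∊ω₁
              x , q = proper (meet Yᶜ∊U (meet p T∊U (λ w → ∊-restrict⁺) (λ x q → proj₁ (∊-Pre⁻ (proj₁ (proj₂ bounding)) (proj₁ (∊-restrict⁻ q)))))
                (λ w → ∊-restrict⁺) (λ x q → proj₁ (Yᶜ⁻ (proj₁ (∊-restrict⁻ q)))))
              q₁ , q₂ = ∊-restrict⁻ q
              q₃ , q₄ = ∊-restrict⁻ q₂
              γ∊ω₁ , h = proj₂ (proj₂ bounding) x q₁
          in h β β∊ω₁ (∊⇒⊑ (Ord-∊ ω₁-ord β∊ω₁) (R⊑β _ (proj₂ (∊-Pre⁻ (proj₁ (proj₂ bounding)) q₃))))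
               (proj₂ (∊-Pre⁻ (trace-cong ≋-refl) q₄))
          where
          Yᶜ⁻ : ∀ {x} → x ∊ Yᶜ → x ∊ κ × ¬ Resolved x
          Yᶜ⁻ = ∊-Sep⁻ _ (¬-resp Resolved-resp)
          Bounds : 𝕍 → Class
          Bounds x γ = γ ∊ ω₁ × (∀ β → β ∊ ω₁ → γ ⊑ β → ¬ ResolvedAt x β)
          bounding : Σ (𝕍 → 𝕍) λ g → Congruent g × (∀ x → x ∊ Yᶜ → Bounds x (g x))
          bounding = choose Yᶜ Bounds
            (λ e e′ (p , h) → ∊-≋ˡ e′ p , λ β q r t → h β q (λ w v → r w (≋⇒⊑ e′ w v)) (ResolvedAt-resp (≋-sym e) ≋-refl t))
            (λ x p → by-contradiction λ n → proj₂ (Yᶜ⁻ p) λ γ γ∊ω₁ → by-contradiction λ n′ →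
              n (γ , γ∊ω₁ , λ β q r t → n′ (β , q , r , t)))

        Guesses : 𝕍 → Class
        Guesses x W = W ∊ M × W ∊ 𝒫 P × (∀ A → A ∊ M → A ∊ W → x ∊ A) × (∀ A → A ∊ M → A ∊ P → x ∊ A → A ∊ W)

        -- For countable `a` in M, the subsets of κ in `a` all have index below some γ < ω₁. At a
        -- stage β ≥ γ resolving `x` they all belong to `approx β`, so the trace on `approx β`, an
        -- element of M, cuts out the right part of `a`.
        guess-point : ∀ x → x ∊ Y → ∃ (Guesses x)
        guess-point x x∊Y =
          let _ , resolved = ∊-Sep⁻ Resolved Resolved-resp x∊Y
              b′ , p , q , r = guess {P} {trace P x} (param 0) (λ A t → proj₁ (∊-trace⁻ t)) (λ a a∊M a-cnt →
                let a′ = Sep a (_∊ P)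
                    a′-cnt = Cnt-⊑ (λ A t → proj₁ (∊-restrict⁻ {a} {P} {A} t)) a-cnt
                    a′⊑M = countable-⊑M (restrict a P (param 0) a∊M) (∊-CQ⁺ (λ A t → ∊-∪ˡ (proj₂ (∊-restrict⁻ {a} {P} {A} t))) a′-cnt)
                    γ , γ∊ω₁ , h = Cnt-bounded {Image m.fn a′}
                      (λ z t → let A , t₁ , e = ∊-Image⁻ t in ∊-≋ˡ (≋-sym e) (m.maps (a′⊑M A t₁)))
                      (let e , k = a′-cnt in (λ n → m.fn (e n)) , λ z t →
                         let A , t₁ , e₁ = ∊-Image⁻ t; n , e₂ = k A t₁ in n , e₁ ∙ m.fn-cong e₂)
                    β , β∊ω₁ , γ⊑β , res = resolved γ γ∊ω₁
                    _ , _ , covers = approx-spec β β∊ω₁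
                in Sep (trace (approx β) x) (_∊ a) , restrict _ a a∊M (resolved-∊M β∊ω₁ res) ,
                   (λ A t → let t₁ , t₂ = ∊-restrict⁻ t; _ , t₃ , t₄ = ∊-trace⁻ t₁ in ∊-trace⁺ t₃ t₃ t₄ , t₂) ,
                   (λ A t t₂ → let _ , t₃ , t₄ = ∊-trace⁻ t
                                   A∊a′ = ∊-restrict⁺ {a} {P} t₂ t₃
                               in ∊-restrict⁺ (∊-trace⁺ (covers A (a′⊑M A A∊a′ , t₃ ,
                                    γ⊑β _ (h _ (∊-Image⁺ m.fn-cong A∊a′ ≋-refl)))) t₃ t₄) t₂))
          in Sep b′ (_∊ P) , restrict b′ P (param 0) p , ∊-𝒫⁺ (λ A t → proj₂ (∊-restrict⁻ t)) ,
             (λ A t v → proj₂ (proj₂ (∊-trace⁻ (q A t (proj₁ (∊-restrict⁻ v)))))) ,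
             (λ A t v w → ∊-restrict⁺ (r A t (∊-trace⁺ v v w)) v)

        abstract
          guessing : Σ (𝕍 → 𝕍) λ g → Congruent g × (∀ x → x ∊ Y → Guesses x (g x))
          guessing = choose Y Guesses
            (λ e e′ (p , q , h , k) → ∊-≋ˡ e′ p , ∊-≋ˡ e′ q ,
              (λ A r t → ∊-≋ˡ e (h A r (≋⇒⊒ e′ A t))) , (λ A r t v → ≋⇒⊑ e′ A (k A r t (∊-≋ˡ (≋-sym e) v))))
            guess-point

        -- A counterexample family for `W` can be taken in M by `refuting-good`. Being countable it
        -- is a subset of M, where `W` agrees with membership of `x`, so `x` itself refutes it.
        guesses-good : ∀ {x W} → x ∊ κ → Guesses x W → Good κ W
        guesses-good {x} {W} x∊κ (W∊M , W∊ , h , k) a c a⊑P = by-contradiction λ bad →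
          let a′∊CQ , a′⊑P , bad′ = proj₂ (proj₂ refuting-good) W W∊ (a , ∊-CQ⁺ (λ A p → ∊-∪ˡ (a⊑P A p)) c , a⊑P , bad)
              a′⊑M = countable-⊑M (apply (proj₁ (proj₂ refuting-good)) (param 7) W∊M W∊) a′∊CQ
          in bad′ (x , x∊κ , (λ A p → h A (a′⊑M A p)) , (λ A p → k A (a′⊑M A p) (a′⊑P A p)))

      -- The countable image `R` of x ↦ W(x) is enlarged to `V` in M, so that a set of `U` left
      -- uncovered by `V` may be taken to be some `B` in M. For almost all `x` in `B`, W(x) is in
      -- `V` and is correct about `B`, a contradiction.
      countable-cover : ∃ λ V → Cnt V × (∀ A → A ∊ U → ∃ λ W → W ∊ V × Good κ W × A ∊ W)
      countable-cover =
        let g , g-cong , g-spec = guessing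
            R , R⊑M , R-cnt , R∊U = countable-image ω₁∊κ M-small Y∊U g g-cong (λ x p → proj₁ (g-spec x p))
            V , V∊M , V∊CQ , R⊑V = cover {Sep R (_∊ 𝒫 P)} (λ W p → R⊑M W (proj₁ (∊-restrict⁻ p)))
              (λ W p → ∊-∪ʳ (proj₂ (∊-restrict⁻ p))) (Cnt-⊑ (λ W p → proj₁ (∊-restrict⁻ p)) R-cnt)
        in V , proj₂ (∊-CQ⁻ V∊CQ) , λ A A∊U → by-contradiction λ uncovered →
          let B∊U , h = proj₂ (proj₂ refuting-cover) V V∊CQ (A , A∊U , λ W p _ good q → uncovered (W , p , good , q))
              B = proj₁ refuting-cover V
              B∊M = apply (proj₁ (proj₂ refuting-cover)) (param 8) V∊M V∊CQ
              x , p = proper (meet B∊U (meet R∊U Y∊U (λ w → ∊-restrict⁺) (λ x p → proj₁ (∊-Pre⁻ g-cong (proj₁ (∊-restrict⁻ p)))))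
                (λ w → ∊-restrict⁺) (λ x p → members B∊U x (proj₁ (∊-restrict⁻ p))))
              x∊B , p′ = ∊-restrict⁻ p
              x∊R , x∊Y = ∊-restrict⁻ p′
              x∊κ , gx∊R = ∊-Pre⁻ g-cong x∊R
              spec = g-spec x x∊Y
              _ , gx∊ , _ , k = spec
          in h (g x) (R⊑V _ (∊-restrict⁺ gx∊R gx∊)) gx∊ (guesses-good x∊κ spec) (k B B∊M (∊-𝒫⁺ (members B∊U)) x∊B)

  -- Measurable cardinals from countably complete ultrafilters

  module GoodUltrafilter {κ W : 𝕍} (good : Good κ W) where

    -- A point that decides countably many sets exactly as `W` does. Each ultrafilter law below is
    -- read off from such a point, where it is trivial.
    resolve : (E : ℕ → ℕ → 𝕍) → (∀ i j → E i j ⊑ κ) →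
      ∃ λ x → x ∊ κ × (∀ i j → E i j ∊ W → x ∊ E i j) × (∀ i j → x ∊ E i j → E i j ∊ W)
    resolve E h =
      let x , x∊κ , p , q = good (Range E′) (Cnt-Range E′) (λ A r → let n , e = ∊-Range⁻ r in ∊-≋ˡ (≋-sym e) (∊-𝒫⁺ (h _ _)))
      in x , x∊κ , (λ i j → p _ (E∊ i j)) , (λ i j → q _ (E∊ i j))
      where
      E′ : ℕ → 𝕍
      E′ n = E (proj₁ (unpair n)) (proj₂ (unpair n))
      E∊ : ∀ i j → E i j ∊ Range E′
      E∊ i j = let n , e = unpair-surjective i j
               in ∊-Range⁺ n (subst (λ (k , l) → E i j ≋ E k l) (sym e) ≋-refl)

    resolve₃ : ∀ {A B C} → A ⊑ κ → B ⊑ κ → C ⊑ κ → ∃ λ x → x ∊ κ ×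
      ((A ∊ W → x ∊ A) × (x ∊ A → A ∊ W)) × ((B ∊ W → x ∊ B) × (x ∊ B → B ∊ W)) × ((C ∊ W → x ∊ C) × (x ∊ C → C ∊ W))
    resolve₃ {A} {B} {C} hA hB hC =
      let x , x∊κ , p , q = resolve E E⊑κ in x , x∊κ , (p 0 0 , q 0 0) , (p 1 0 , q 1 0) , (p 2 0 , q 2 0)
      where
      E : ℕ → ℕ → 𝕍
      E 0 _ = A
      E 1 _ = B
      E _ _ = C
      E⊑κ : ∀ i j → E i j ⊑ κ
      E⊑κ 0 _ = hA
      E⊑κ 1 _ = hB
      E⊑κ (1+ (1+ _)) _ = hC

    full : κ ∊ W
    full = let x , x∊κ , (_ , q) , _ = resolve₃ {κ} {κ} {κ} (λ _ p → p) (λ _ p → p) (λ _ p → p) in q x∊κ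

    meet : ∀ {A B C} → A ∊ W → B ∊ W → A ⊑ κ → B ⊑ κ → C ⊑ κ → (∀ w → w ∊ A → w ∊ B → w ∊ C) → C ∊ W
    meet p q hA hB hC h = let x , _ , (r , _) , (s , _) , (_ , t) = resolve₃ hA hB hC in t (h x (r p) (s q))

    up : ∀ {A B} → A ∊ W → A ⊑ B → B ⊑ κ → B ∊ W
    up p h hB = let hA = λ w q → hB w (h w q) in meet p p hA hA hB (λ w q _ → h w q)

    complement : ∀ {A B} → A ⊑ κ → B ⊑ κ → ¬ (A ∊ W) → (∀ w → w ∊ κ → ¬ (w ∊ A) → w ∊ B) → B ∊ W
    complement hA hB n h = let x , x∊κ , (_ , p) , (_ , q) , _ = resolve₃ hA hB hB in q (h x x∊κ λ r → n (p r))

    disjoint : ∀ {A B} → A ⊑ κ → B ⊑ κ → A ∊ W → B ∊ W → ∃ λ x → x ∊ A × x ∊ B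
    disjoint hA hB p q = let x , _ , (r , _) , (s , _) , _ = resolve₃ hA hB hB in x , r p , s q

  Fiber : 𝕍 → (𝕍 → 𝕍) → 𝕍 → 𝕍
  Fiber κ g β = Pre κ g (singleton β)

  ∊-Fiber⁺ : ∀ {κ g β x} → Congruent g → x ∊ κ → g x ≋ β → x ∊ Fiber κ g β
  ∊-Fiber⁺ g-cong p e = ∊-Pre⁺ g-cong p (∊-pairˡ e)

  ∊-Fiber⁻ : ∀ {κ g β x} → Congruent g → x ∊ Fiber κ g β → x ∊ κ × g x ≋ β
  ∊-Fiber⁻ g-cong p = let q , r = ∊-Pre⁻ g-cong p in q , ∊-singleton⁻ r

  Pre-⊑ : ∀ {κ g R} → Congruent g → Pre κ g R ⊑ κ
  Pre-⊑ g-cong x p = proj₁ (∊-Pre⁻ g-cong p)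

  -- κ splits into α many sets outside `W`, that is, completeness of `W` fails for α many sets.
  NullFibers : 𝕍 → 𝕍 → Class
  NullFibers κ W α = ∃ λ g → Congruent g × (∀ x → x ∊ κ → g x ∊ α) × (∀ β → β ∊ α → ¬ (Fiber κ g β ∊ W))

  NullFibers-resp : ∀ {κ W} → Resp (NullFibers κ W)
  NullFibers-resp e (g , g-cong , h , k) = g , g-cong , (λ x p → ≋⇒⊑ e _ (h x p)) , λ β p → k β (≋⇒⊒ e β p)

  Completeness : 𝕍 → 𝕍 → Class
  Completeness κ W δ = Ord δ × NullFibers κ W δ × (∀ α → α ∊ δ → ¬ NullFibers κ W α)

  Completeness-resp : ∀ {κ W} → Resp (Completeness κ W)
  Completeness-resp e (o , n , m) = Ord-resp e o , NullFibers-resp e n , λ α p → m α (≋⇒⊒ e α p)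

  ∊-⋂⁺ : ∀ {x F z} → z ∊ x → (∀ X → X ∊ F → z ∊ X) → z ∊ ⋂[ x ] F
  ∊-⋂⁺ {x} {F} p h = sep-∊⁺ x _ (λ e k j → ∊⇒∈ (∊-≋ˡ e (∈⇒∊ (k j)))) p (λ j → ∊⇒∈ (h _ (elem-∊ F j)))

  ∊-⋂⁻ : ∀ {x F z} → z ∊ ⋂[ x ] F → z ∊ x × (∀ X → X ∊ F → z ∊ X)
  ∊-⋂⁻ {x} {F} p =
    let q , h = sep-∊⁻ x (λ z → ∀ j → z ∈ elem F j) (λ e k j → ∊⇒∈ (∊-≋ˡ e (∈⇒∊ (k j)))) p
    in q , λ X r → let j , e = ∊⇒elem r in ∊-≋ʳ (≋-sym e) (∈⇒∊ (h j))

  module Measurable {κ W δ : 𝕍} (good : Good κ W) (completeness : Completeness κ W δ) where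

    open GoodUltrafilter good
    private
      δ-ord = proj₁ completeness
      g = proj₁ (proj₁ (proj₂ completeness))
      g-cong : Congruent g
      g-cong = proj₁ (proj₂ (proj₁ (proj₂ completeness)))
      g-maps = proj₁ (proj₂ (proj₂ (proj₁ (proj₂ completeness))))
      g-null = proj₂ (proj₂ (proj₂ (proj₁ (proj₂ completeness))))
      minimal = proj₂ (proj₂ completeness)

    δ-card : Card δ
    δ-card = δ-ord , λ α α∊δ b → let module b = Bij (Bij-sym b) in
      minimal α α∊δ ((λ x → b.fn (g x)) , (λ e → b.fn-cong (g-cong e)) , (λ x p → b.maps (g-maps x p)) , λ β β∊α p →
        let γ , γ∊δ , e = b.surjective β∊α
        in g-null γ γ∊δ (up p
             (λ x q → let x∊κ , e′ = ∊-Fiber⁻ (λ e → b.fn-cong (g-cong e)) q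
                      in ∊-Fiber⁺ g-cong x∊κ (b.injective (g-maps x x∊κ) γ∊δ (e′ ∙ e))) (Pre-⊑ g-cong)))

    -- If δ ≤ ω, a point deciding all fibres of `g` as `W` does lies in one of them, and that fibre
    -- would belong to `W`.
    ω∊δ : ω ∊ δ
    ω∊δ = [ id , (λ δ⊑ω → ⊥-elim (absurd δ⊑ω)) ]′ (∊⊎⊒ ω-ordinal δ-ord)
      where
      absurd : ¬ (δ ⊑ ω)
      absurd δ⊑ω =
        let x , x∊κ , _ , q = resolve (λ n _ → Fiber κ g (nat n)) (λ _ _ → Pre-⊑ g-cong)
            gx∊δ = g-maps x x∊κ
            n , e = ∊-ω⁻ (δ⊑ω _ gx∊δ)
        in g-null (nat n) (∊-≋ˡ e gx∊δ) (q n 0 (∊-Fiber⁺ g-cong x∊κ e))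

    Large-preimage : Class
    Large-preimage X = Pre κ g X ∊ W

    Large-preimage-resp : Resp Large-preimage
    Large-preimage-resp e p = up p
      (λ x q → let r , t = ∊-Pre⁻ g-cong q in ∊-Pre⁺ g-cong r (∊-≋ʳ e t)) (Pre-⊑ g-cong)

    -- The image of `W` under `g`. Null fibres make it nonprincipal, and the minimality of δ makes
    -- it complete.
    D : 𝕍
    D = Sep (𝒫 δ) Large-preimage

    ∊-D⁺ : ∀ {X} → X ⊑ δ → Pre κ g X ∊ W → X ∊ D
    ∊-D⁺ h = ∊-Sep⁺ Large-preimage Large-preimage-resp (∊-𝒫⁺ h)

    ∊-D⁻ : ∀ {X} → X ∊ D → X ⊑ δ × Pre κ g X ∊ W
    ∊-D⁻ p = let q , r = ∊-Sep⁻ Large-preimage Large-preimage-resp p in ∊-𝒫⁻ q , r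

    full∊D : ∀ {X} → X ⊑ δ → δ ⊑ X → X ∊ D
    full∊D h k = ∊-D⁺ h (up full (λ x p → ∊-Pre⁺ g-cong p (k _ (g-maps x p))) (Pre-⊑ g-cong))

    D-ultrafilter : IsUltrafilter δ D
    D-ultrafilter =
      (λ X p → ⊑⇒⊆ (proj₁ (∊-D⁻ (∈⇒∊ p)))) ,
      ∊⇒∈ (full∊D (λ _ p → p) (λ _ p → p)) ,
      (λ p → let _ , q = ∊-D⁻ (∈⇒∊ p)
                 x , r , _ = disjoint (Pre-⊑ g-cong) (Pre-⊑ g-cong) q q
             in case proj₂ (∊-Pre⁻ g-cong r) of λ { (∈⇒∊ ()) }) ,
      (λ X Y p h k → let _ , q = ∊-D⁻ (∈⇒∊ p) in ∊⇒∈ (∊-D⁺ (⊆⇒⊑ k) (up q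
        (λ x r → let r₁ , r₂ = ∊-Pre⁻ g-cong r in ∊-Pre⁺ g-cong r₁ (⊆⇒⊑ h _ r₂)) (Pre-⊑ g-cong)))) ,
      (λ X Y p q → let X⊑δ , p′ = ∊-D⁻ (∈⇒∊ p); _ , q′ = ∊-D⁻ (∈⇒∊ q) in
        ∊⇒∈ (∊-D⁺ (λ w r → X⊑δ w (proj₁ (∊-∩⁻ r)))
          (meet p′ q′ (Pre-⊑ g-cong) (Pre-⊑ g-cong) (Pre-⊑ g-cong) λ w r t →
            let r₁ , r₂ = ∊-Pre⁻ g-cong r in ∊-Pre⁺ g-cong r₁ (∊-∩⁺ r₂ (proj₂ (∊-Pre⁻ g-cong t)))))) ,
      (λ X h → case em {Pre κ g X ∊ W} of λ where
        (yes p) → inj₁ (∊⇒∈ (∊-D⁺ (⊆⇒⊑ h) p))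
        (no n) → inj₂ (∊⇒∈ (∊-D⁺ (λ w r → proj₁ (∊-∖⁻ r)) (complement (Pre-⊑ g-cong) (Pre-⊑ g-cong) n
          λ w p q → ∊-Pre⁺ g-cong p (∊-∖⁺ (g-maps w p) λ r → q (∊-Pre⁺ g-cong p r))))))

    -- If the intersection `I` of `F` is not in `D`, send `x` with `g x` outside `I` to the index of
    -- a member of `F` missing `g x`. Apart from the null preimage of `I`, each fibre avoids a set
    -- of `W`, so a map into α < δ has null fibres, against minimality.
    D-complete : IsComplete δ D
    D-complete F F⊆D (_ , ¬δ≼F) = ∊⇒∈ (by-contradiction λ ⋂∉D →
      let F⊑D = ⊆⇒⊑ F⊆D
          I = ⋂[ δ ] F
          N∉W : ¬ (Pre κ g I ∊ W)
          N∉W p = ⋂∉D (∊-D⁺ (λ w q → proj₁ (∊-⋂⁻ {δ} {F} q)) p)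
          -- The points with `g x ∊ I` also need some value, so `F` must be nonempty; for empty `F`
          -- the intersection is δ itself.
          X₀ , X₀∊F = by-contradiction λ (n : ¬ (∃ λ X → X ∊ F)) →
            ⋂∉D (full∊D (λ w q → proj₁ (∊-⋂⁻ {δ} {F} q)) λ w q → ∊-⋂⁺ {δ} {F} q λ X r → ⊥-elim (n (X , r)))
          α , α∊δ , _ , bij = small-cardinality δ-ord λ i → ¬δ≼F (Inj⇒≼ i)
          module b = Bij bij
          h , h-cong , h-spec = choose κ (λ x ξ → ξ ∊ α × (¬ (g x ∊ I) → ¬ (g x ∊ b.fn ξ)))
            (λ e e′ (p , q) → ∊-≋ˡ e′ p , λ r t → q (λ v → r (∊-≋ˡ (g-cong e) v))
              (∊-≋ʳ (≋-sym (b.fn-cong e′)) (∊-≋ˡ (≋-sym (g-cong e)) t)))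
            (λ x x∊κ → case em {∃ λ X → X ∊ F × ¬ (g x ∊ X)} of λ where
              (yes (X , p , n)) → let ξ , q , e = b.surjective p in ξ , q , λ _ r → n (∊-≋ʳ (≋-sym e) r)
              (no n) → let ξ , q , _ = b.surjective X₀∊F in ξ , q , λ r → ⊥-elim (r (∊-⋂⁺ {δ} {F} (g-maps x x∊κ)
                λ X p → by-contradiction λ t → n (X , p , t))))
      in minimal α α∊δ (h , h-cong , (λ x p → proj₁ (h-spec x p)) , λ ξ ξ∊α p →
           let x , x∊κ , (r , _) , (_ , s) , (t , _) = resolve₃ (Pre-⊑ h-cong) (Pre-⊑ g-cong) (Pre-⊑ g-cong)
               _ , e = ∊-Fiber⁻ h-cong (r p)
               _ , q = ∊-Pre⁻ g-cong (t (proj₂ (∊-D⁻ (F⊑D _ (b.maps ξ∊α)))))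
           in proj₂ (h-spec x x∊κ) (λ v → N∉W (s (∊-Pre⁺ g-cong x∊κ v))) (∊-≋ʳ (b.fn-cong (≋-sym e)) q)))

    measurable : IsMeasurable δ
    measurable = Card⇒IsCardinal δ-card , ∊⇒∈ ω∊δ , D , D-ultrafilter ,
      (λ ξ ξ∈δ p → g-null ξ (∈⇒∊ ξ∈δ) (proj₂ (∊-D⁻ (∈⇒∊ p)))) , D-complete

  -- The dichotomy

  module Dichotomy {ω₁ κ U V : 𝕍} (s₁ : SuccCard ω ω₁) (κ-card : Card κ) (ω₁∊κ : ω₁ ∊ κ) (u : Ultrafilter κ U)
    (uniform : ∀ {X} → X ∊ U → Bij X κ)
    (indecomposable : ∀ {μ} → Card μ → ω₁ ⊑ μ → μ ∊ κ → IndecomposableAt μ κ U)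
    (V-countable : Cnt V) (V-covers : ∀ A → A ∊ U → ∃ λ W → W ∊ V × Good κ W × A ∊ W) where

    open FirstUncountable s₁
    open CountableImage s₁ κ-card u indecomposable
    private
      module U = Ultrafilter u
      κ-ord = proj₁ κ-card
      e : ℕ → 𝕍
      e = proj₁ V-countable

    Nonprincipal : Class
    Nonprincipal W = ∀ ξ → ξ ∊ κ → ¬ (singleton ξ ∊ W)

    Fine : ℕ → Set (suc ℓ)
    Fine n = Good κ (e n) × Nonprincipal (e n)

    singleton-⊑ : ∀ {ξ} → ξ ∊ κ → singleton ξ ⊑ κ
    singleton-⊑ p z q = ∊-≋ˡ (≋-sym (∊-singleton⁻ q)) p

    Principal-point : ℕ → Class
    Principal-point n ξ = ξ ∊ κ × Good κ (e n) × singleton ξ ∊ e n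

    Principal-resp : Resp (λ ξ → ∃ λ n → Principal-point n ξ)
    Principal-resp q (n , p , good , r) = n , ∊-≋ˡ q p , good , ∊-≋ˡ (pair-cong q q) r

    principal-points : 𝕍
    principal-points = Sep κ (λ ξ → ∃ λ n → Principal-point n ξ)

    principal-points-countable : Cnt principal-points
    principal-points-countable = (λ n → at n em) , λ ξ p → let _ , n , q = ∊-Sep⁻ _ Principal-resp p in n , unique n q em
      where
      at : ∀ n → Dec (∃ (Principal-point n)) → 𝕍
      at n (yes (ξ , _)) = ξ
      at n (no _) = ∅
      unique : ∀ n {ξ} → Principal-point n ξ → ∀ d → ξ ≋ at n d
      unique n p (no h) = ⊥-elim (h (_ , p))
      unique n (p , good , q) (yes (ξ′ , p′ , _ , q′)) =
        let x , r , r′ = GoodUltrafilter.disjoint good (singleton-⊑ p) (singleton-⊑ p′) q q′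
        in ≋-sym (∊-singleton⁻ r) ∙ ∊-singleton⁻ r′

    -- Each good `e n` concentrates on at most one point, so the principal points form a countable
    -- set, which is not in `U` by uniformity and ω₁ < κ. An ultrafilter containing `A` without
    -- these points cannot be principal.
    fine-cover : ∀ {A} → A ∊ U → ∃ λ n → Fine n × A ∊ e n
    fine-cover {A} A∊U =
      let X = principal-points
          X∉U : ¬ (X ∊ U)
          X∉U p = Card-¬Inj κ-card ω₁∊κ (Inj-trans (Bij.inj (Bij-sym (uniform p))) (Cnt⇒Inj-ω₁ principal-points-countable))
          κ∖X∊U = U.ultra {X} {κ ∖ X} (λ x p → proj₁ (∊-Sep⁻ _ Principal-resp p)) X∉U (λ w → ∊-∖⁺) (λ x p → proj₁ (∊-∖⁻ p))
          B∊U = U.meet {Z = A ∖ X} A∊U κ∖X∊U (λ w p q → ∊-∖⁺ p (proj₂ (∊-∖⁻ q))) (λ w p → U.members A∊U w (proj₁ (∊-∖⁻ p)))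
          B⊑κ = U.members B∊U
          W , W∊V , W-good , B∊W = V-covers (A ∖ X) B∊U
          n , W≋ = proj₂ V-countable W W∊V
          good = Good-resp W≋ W-good
          B∊en = ≋⇒⊑ W≋ _ B∊W
      in n , (good , λ ξ ξ∊κ p →
           let x , q , r = GoodUltrafilter.disjoint good (singleton-⊑ ξ∊κ) B⊑κ p B∊en
           in proj₂ (∊-∖⁻ r) (∊-Sep⁺ _ Principal-resp (B⊑κ x r)
                (Principal-resp (≋-sym (∊-singleton⁻ q)) (n , ξ∊κ , good , p)))) ,
         GoodUltrafilter.up good B∊en (λ w p → proj₁ (∊-∖⁻ p)) (U.members A∊U)

    Fine-sequence : (ℕ → 𝕍) → Set (suc ℓ)
    Fine-sequence W = (∀ n → Good κ (W n)) × (∀ n → Nonprincipal (W n)) × (∀ {A} → A ∊ U → ∃ λ n → A ∊ W n)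

    fine-sequence : ∃ Fine-sequence
    fine-sequence = (λ n → W n em) , (λ n → proj₁ (fine n em)) , (λ n → proj₂ (fine n em)) ,
        λ p → let n , f , q = fine-cover p in n , ∊-≋ʳ (hit n f em) q
      where
      -- One fine index exists because κ belongs to `U`; its ultrafilter replaces all entries that
      -- are not fine.
      n₀ = fine-cover U.full
      W : ∀ n → Dec (Fine n) → 𝕍
      W n (yes _) = e n
      W n (no _) = e (proj₁ n₀)
      fine : ∀ n d → Good κ (W n d) × Nonprincipal (W n d)
      fine n (yes f) = f
      fine n (no _) = proj₁ (proj₂ n₀)
      hit : ∀ n → Fine n → ∀ d → e n ≋ W n d
      hit n f (yes _) = ≋-refl
      hit n f (no h) = ⊥-elim (h f)

    module _ {W : ℕ → 𝕍} (fine : Fine-sequence W) where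
      private
        W-good = proj₁ fine
        W-covers = proj₂ (proj₂ fine)

        -- When `W n` has no set missing from `W m`, the whole of κ is a harmless default.
        separator′ : ∀ n m → ∃ λ B → B ⊑ κ × B ∊ W n × ((∃ λ A → A ⊑ κ × A ∊ W n × ¬ (A ∊ W m)) → ¬ (B ∊ W m))
        separator′ n m = case em {∃ λ A → A ⊑ κ × A ∊ W n × ¬ (A ∊ W m)} of λ where
          (yes (A , p , q , r)) → A , p , q , λ _ → r
          (no h) → κ , (λ _ p → p) , GoodUltrafilter.full (W-good n) , λ p → ⊥-elim (h p)

      abstract
        separator : ℕ → ℕ → 𝕍
        separator n m = proj₁ (separator′ n m)

        separator-⊑ : ∀ n m → separator n m ⊑ κ
        separator-⊑ n m = proj₁ (proj₂ (separator′ n m))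

        separator-∊ : ∀ n m → separator n m ∊ W n
        separator-∊ n m = proj₁ (proj₂ (proj₂ (separator′ n m)))

        separator-∉ : ∀ n m {A} → A ⊑ κ → A ∊ W n → ¬ (A ∊ W m) → ¬ (separator n m ∊ W m)
        separator-∉ n m p q r = proj₂ (proj₂ (proj₂ (separator′ n m))) (_ , p , q , r)

      -- With n(x) the least n such that x belongs to all separators of W n,
      -- the map x ↦ gₙ₍ₓ₎(x) agrees with gₙ on a set of W n, up to repetitions
      -- in the sequence W. It has countable image on a set of U, whereas all
      -- fibres of gₙ are W n-null.
      unbounded : ∀ {β} (δ : ℕ → 𝕍) → β ∊ κ → ω ∊ β → (∀ n → δ n ⊑ β) → (∀ n → NullFibers κ (W n) (δ n)) → ⊥
      unbounded {β} δ β∊κ ω∊β δ⊑β null =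
        let R , R⊑β , (c , R-covered) , X∊U = countable-image β∊κ (Inj-⊑ λ _ p → p) U.full G G-cong (λ x p → proj₁ (G-spec x p))
            X = Pre κ G R
            X⊑κ = U.members X∊U
            n , X∊Wn , n-least = least-ℕ (λ n → X ∊ W n) (W-covers X∊U)
            -- One point has to decide the separators of `W n`, those of the other ultrafilters
            -- against `W n`, the fibres of `g n` over the listed values, and `X`.
            E : ℕ → ℕ → 𝕍
            E = λ where
              0 m → separator n m
              1 m → separator m n
              2 m → Fiber κ (g n) (c m)
              _ _ → X
            E⊑κ : ∀ i j → E i j ⊑ κ
            E⊑κ = λ where
              0 m → separator-⊑ n m
              1 m → separator-⊑ m n
              2 m → Pre-⊑ (g-cong n)
              (1+ (1+ (1+ _))) m → X⊑κ
            x , x∊κ , p , q = GoodUltrafilter.resolve (W-good n) E E⊑κ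
            selected : Selects x n
            selected = λ m → p 0 m (separator-∊ n m)
            not-before : ∀ k → k < n → ¬ Selects x k
            -- As n is least with `X` in `W n`, the complement of `X` is in `W k` but not in `W n`.
            -- So these two ultrafilters differ, and `x`, which decides like `W n`, lies outside
            -- `separator k n`.
            not-before k k<n sel =
              separator-∉ k n {κ ∖ X} (λ w r → proj₁ (∊-∖⁻ r))
                (GoodUltrafilter.complement (W-good k) X⊑κ (λ w r → proj₁ (∊-∖⁻ r)) (n-least k k<n) (λ w → ∊-∖⁺))
                (λ r → let w , t , v = GoodUltrafilter.disjoint (W-good n) X⊑κ (λ w t → proj₁ (∊-∖⁻ t)) X∊Wn r
                       in proj₂ (∊-∖⁻ v) t)
                (q 1 k (sel n))
            Gx≋gx = proj₂ (G-spec x x∊κ) n selected not-before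
            j , gx≋cj = R-covered _ (∊-≋ˡ Gx≋gx (proj₂ (∊-Pre⁻ G-cong (p 3 0 X∊Wn))))
        in g-null n (c j) (∊-≋ˡ gx≋cj (g-maps n x x∊κ)) (q 2 j (∊-Fiber⁺ (g-cong n) x∊κ gx≋cj))
        where
        g : ℕ → 𝕍 → 𝕍
        g n = proj₁ (null n)
        g-cong : ∀ n → Congruent (g n)
        g-cong n = proj₁ (proj₂ (null n))
        g-maps : ∀ n x → x ∊ κ → g n x ∊ δ n
        g-maps n = proj₁ (proj₂ (proj₂ (null n)))
        g-null : ∀ n β → β ∊ δ n → ¬ (Fiber κ (g n) β ∊ W n)
        g-null n = proj₂ (proj₂ (proj₂ (null n)))

        Selects : 𝕍 → ℕ → Set (suc ℓ)
        Selects x n = ∀ m → x ∊ separator n m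

        gluing : Σ (𝕍 → 𝕍) λ G → Congruent G ×
          (∀ x → x ∊ κ → G x ∊ β × (∀ n → Selects x n → (∀ k → k < n → ¬ Selects x k) → G x ≋ g n x))
        gluing = choose κ (λ x y → y ∊ β × (∀ n → Selects x n → (∀ k → k < n → ¬ Selects x k) → y ≋ g n x))
          (λ e e′ (p , h) → ∊-≋ˡ e′ p , λ n r t → ≋-sym e′ ∙
            h n (λ m → ∊-≋ˡ (≋-sym e) (r m)) (λ k v w → t k v λ m → ∊-≋ˡ e (w m)) ∙ g-cong n e)
          (λ x x∊κ → case em {∃ (Selects x)} of λ where
            (yes s) → let n , p , n-least = least-ℕ (Selects x) s in
              g n x , δ⊑β n _ (g-maps n x x∊κ) , λ m q m-least → case ℕ.<-cmp n m of λ where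
                (tri< n<m _ _) → ⊥-elim (m-least n n<m p)
                (tri≈ _ n≡m _) → subst (λ k → g n x ≋ g k x) n≡m ≋-refl
                (tri> _ _ m<n) → ⊥-elim (n-least m m<n q)
            -- Where no index is selected the value is immaterial, but it has to lie in β.
            (no h) → ω , ω∊β , λ n p _ → ⊥-elim (h (n , p)))
        G = proj₁ gluing
        G-cong : Congruent G
        G-cong = proj₁ (proj₂ gluing)
        G-spec = proj₂ (proj₂ gluing)

      -- Nonprincipality says that the identity on κ has null fibres, so each completeness is at
      -- most κ. If one equals κ, then κ is measurable; otherwise all lie below κ, and `unbounded`
      -- forbids a common bound below κ.
      dichotomy : IsMeasurable κ ⊎ (∃ λ A → Countable A × (∀ μ → μ ∈ A → IsMeasurable μ) × IsSupremum A κ)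
      dichotomy = case em {∃ λ n → ∀ α → α ∊ κ → ¬ NullFibers κ (W n) α} of λ where
          (yes (n , h)) → inj₁ (Measurable.measurable (W-good n) (κ-ord , identity n , h))
          (no h) → inj₂ (supremum λ n → by-contradiction λ h′ → h (n , λ α p q → h′ (α , p , q)))
        where
        identity : ∀ n → NullFibers κ (W n) κ
        identity n = id , (λ q → q) , (λ _ p → p) , λ ξ p q → proj₁ (proj₂ fine) n ξ p
          (GoodUltrafilter.up (W-good n) q (λ x r → ∊-pairˡ (proj₂ (∊-Fiber⁻ (λ q → q) r))) (singleton-⊑ p))
        supremum : (∀ n → ∃ λ α → α ∊ κ × NullFibers κ (W n) α) →
          ∃ λ A → Countable A × (∀ μ → μ ∈ A → IsMeasurable μ) × IsSupremum A κ
        supremum below = Range δ , Inj⇒≼ (Cnt⇒Inj (Cnt-Range δ)) ,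
            (λ μ p → let n , q = ∊-Range⁻ (∈⇒∊ p) in
              Measurable.measurable (W-good n) (Completeness-resp (≋-sym q) (δ-completeness n))) ,
            Ord⇒IsOrdinal κ-ord ,
            (λ α p → let n , q = ∊-Range⁻ (∈⇒∊ p) in ⊑⇒⊆ (∊⇒⊑ κ-ord (∊-≋ˡ (≋-sym q) (δ∊κ n)))) ,
            λ β β-ord upper →
              let δ⊑β = λ n → ⊆⇒⊑ (upper (δ n) (∊⇒∈ (∊-Range⁺ n ≋-refl)))
              in [ (λ β∊κ → ⊥-elim (unbounded δ β∊κ
                     (δ⊑β 0 ω (Measurable.ω∊δ (W-good 0) (δ-completeness 0))) δ⊑β
                     (λ n → proj₁ (proj₂ (δ-completeness n))))) ,
                   ⊑⇒⊆ ]′ (∊⊎⊒ (IsOrdinal⇒Ord β-ord) κ-ord)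
          where
          completeness-number : ∀ n → ∃ λ δ → δ ∊ κ × Completeness κ (W n) δ
          completeness-number n =
            let α , p , q = below n
                δ , o , (r , t) , m = least (λ α → α ∊ κ × NullFibers κ (W n) α) (Ord-∊ κ-ord p) (p , q)
            in δ , r , o , t , λ γ v w → m γ v (Ord.transitive κ-ord v r , w)
          δ : ℕ → 𝕍
          δ n = proj₁ (completeness-number n)
          δ∊κ : ∀ n → δ n ∊ κ
          δ∊κ n = proj₁ (proj₂ (completeness-number n))
          δ-completeness : ∀ n → Completeness κ (W n) (δ n)
          δ-completeness n = proj₂ (proj₂ (completeness-number n))

  -- Assembly of the proof

  conclusion : (ω₂ : 𝕍) → IsAleph 2 ω₂ → ISP ω₂ →
    (κ 𝔠 : 𝕍) → IsCardinal κ → IsCardinalPower (nat 2) ω 𝔠 → 𝔠 ∈ κ →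
    (∃ λ U → IsUltrafilter κ U × IsUniform κ U × IsIndecomposable κ U) →
    IsMeasurable κ ⊎ (∃ λ A → Countable A × (∀ μ → μ ∈ A → IsMeasurable μ) × IsSupremum A κ)
  conclusion ω₂ (ω₁ , aleph₁ , succ₂) isp κ 𝔠 κ-cardinal power 𝔠∈κ (U , ultra , uniform , indec) =
    let s₁ = IsAleph⇒SuccCard aleph₁
        κ-card = IsCardinal⇒Card κ-cardinal
        u = IsUltrafilter⇒Ultrafilter ultra
        indecomposable : ∀ {μ} → Card μ → ω₁ ⊑ μ → μ ∊ κ → IndecomposableAt μ κ U
        indecomposable = λ {μ} c h p → IsIndecomposableAt⇒IndecomposableAt u
          (indec ω₁ μ aleph₁ (Card⇒IsCardinal c) (⊑⇒⊆ h) (∊⇒∈ p))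
        module A = Approximation s₁ κ-card power (∈⇒∊ 𝔠∈κ) u indecomposable
        M , params⊑M , model = ModelExistence.model s₁ (IsSuccessorCardinal⇒SuccCard succ₂) isp A.parameters A.parameters-small
        V , V-countable , V-covers = A.countable-cover params⊑M model
        module D = Dichotomy s₁ κ-card A.ω₁∊κ u (λ p → ≃⇒Bij (uniform _ (∊⇒∈ p))) indecomposable V-countable V-covers
    in D.dichotomy (proj₂ D.fine-sequence)

theorem5p4 : ∀ {ℓ} → ExcludedMiddle (suc ℓ) → Choice ℓ →
    (ω₂ : V ℓ) → IsAleph 2 ω₂ → ISP ω₂ →
    (κ 𝔠 : V ℓ) → IsCardinal κ → IsCardinalPower (nat 2) ω 𝔠 → 𝔠 ∈ κ →
    (∃ λ U → IsUltrafilter κ U × IsUniform κ U × IsIndecomposable κ U) →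
    IsMeasurable κ ⊎
    (∃ λ A → Countable A × (∀ μ → μ ∈ A → IsMeasurable μ) × IsSupremum A κ)
theorem5p4 em ac = SetTheory.conclusion em ac
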